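{- Let $n\ge1$ and consider the expansion of $(2n)!\,A_n$ in the basis $\{h_\lambda\}$. Then: (a) the coefficient of $h_1^n$ is $1$; (b) the sum of all the coefficients is $E_{2n}$; (c) the coefficient of $h_n$ is $nE_{2n-1}$, which equals the number of cyclically alternating permutations of $[2n]$, i.e. $w=a_1\cdots a_{2n}\in\mathfrak{S}_{2n}$ with $a_1>a_2<a_3>\cdots>a_{2n}$ and $a_{2n}<a_1$; (d) writing $E'_{2m}=mE_{2m-1}$, for $i,j\ge1$ with $i+j=n$, $$[h_ih_j](2n)!A_n=\begin{cases}\binom{2n}{2i}E'_{2i}E'_{2j}-E'_{2n}, & i\ne j,\\[0.3em] \frac12\left(\binom{2n}{n}(E'_n)^2-E'_{2n}\right), & i=j=n/2.\end{cases}$$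
   Context: $A_n=\frac{1}{(2n)!}\sum_{\lambda\vdash n}|\phi(\lambda)|\,p_\lambda$, where for $\lambda=\langle 1^{m_1},\dots,n^{m_n}\rangle\vdash n$ ($m_k$ parts equal to $k$), $\phi(\lambda)=(2n)!\prod_{k=1}^n\frac{1}{m_k!}\left(\frac{4^k(4^k-1)B_{2k}}{(2k)(2k)!}\right)^{m_k}$ with $B_{2k}$ Bernoulli numbers, and $p_\lambda$ power sums. Euler numbers $E_k$ are defined by $\sec t+\tan t=\sum_{k\ge0}E_k\frac{t^k}{k!}$. $[h_\mu]f$ is the coefficient of $h_\mu$ in $f$; $h_1^n=h_{(1,\dots,1)}$. -}

module Defs where

open import Data.Nat as ℕ using (ℕ; zero; suc; _∸_; _!; _≤ᵇ_; _<ᵇ_; _⊔_; _⊓_)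
open import Data.Nat.Combinatorics using (_C_)
open import Data.Integer using (+_; -[1+_])
open import Data.Rational using (ℚ; 0ℚ; 1ℚ; _+_; _*_; -_; _-_; _/_; ∣_∣)
open import Data.Bool using (Bool; true; false; _∧_; if_then_else_)
open import Data.Bool.Properties renaming (_≟_ to _≟ᵇ_) using ()
open import Data.List using (List; []; _∷_; [_]; map; concatMap; upTo; _++_; replicate; length; filter; foldr)
open import Data.Vec as Vec using (Vec; []; _∷_; toList)
open import Data.Fin using (Fin; toℕ)
open import Data.Fin.Properties using (_≟_)
open import Data.List using (allFin)
open import Relation.Nullary.Decidable using (does)

ℕtoℚ : ℕ → ℚ
ℕtoℚ n = + n / 1

-- reciprocal of a natural number (only ever applied to nonzero arguments;
-- the value at 0 is an irrelevant convention)
recipℕ : ℕ → ℚ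
recipℕ zero    = 0ℚ
recipℕ (suc k) = + 1 / suc k

sgn : ℕ → ℚ
sgn zero          = 1ℚ
sgn (suc zero)    = - 1ℚ
sgn (suc (suc k)) = sgn k

_^ℚ_ : ℚ → ℕ → ℚ
x ^ℚ zero  = 1ℚ
x ^ℚ suc k = x * (x ^ℚ k)

sum : List ℚ → ℚ
sum = foldr _+_ 0ℚ

product : List ℚ → ℚ
product = foldr _*_ 1ℚ

Σ< : ℕ → (ℕ → ℚ) → ℚ
Σ< n f = sum (map f (upTo n))

Series : Set
Series = ℕ → ℚ

_⊛_ : Series → Series → Series
(f ⊛ g) k = Σ< (suc k) (λ j → f j * g (k ∸ j))

-- multiplicative inverse of a series g with g 0 = 1:
-- a₀ = 1, a_k = - Σ_{j=1}^{k} g_j a_{k-j}.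
-- invList g k = a_k ∷ a_{k-1} ∷ … ∷ a_0
private
  conv : Series → ℕ → List ℚ → ℚ
  conv g i []      = 0ℚ
  conv g i (a ∷ r) = g i * a + conv g (suc i) r

  headOr0 : List ℚ → ℚ
  headOr0 []      = 0ℚ
  headOr0 (a ∷ _) = a

invList : Series → ℕ → List ℚ
invList g zero    = 1ℚ ∷ []
invList g (suc k) = let prev = invList g k in (- conv g 1 prev) ∷ prev

inv : Series → Series
inv g k = headOr0 (invList g k)

-- Bernoulli numbers:  t / (e^t - 1) = Σ B_m t^m / m!
-- (e^t - 1)/t = Σ_j t^j/(j+1)!

expm1OverT : Series
expm1OverT j = recipℕ (suc j !)

bernoulli : ℕ → ℚ
bernoulli m = ℕtoℚ (m !) * inv expm1OverT m

isEven : ℕ → Bool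
isEven zero          = true
isEven (suc zero)    = false
isEven (suc (suc k)) = isEven k

half : ℕ → ℕ
half zero          = zero
half (suc zero)    = zero
half (suc (suc k)) = suc (half k)

cosS : Series
cosS k = if isEven k then sgn (half k) * recipℕ (k !) else 0ℚ

sinS : Series
sinS k = if isEven k then 0ℚ else sgn (half k) * recipℕ (k !)

secS : Series
secS = inv cosS

tanS : Series
tanS = sinS ⊛ secS

euler : ℕ → ℚ
euler k = ℕtoℚ (k !) * (secS k + tanS k)

-- E'_{2m} = m E_{2m-1}
euler′ : ℕ → ℚ
euler′ m = ℕtoℚ m * euler (2 ℕ.* m ∸ 1)

-- Partitions: a partition is a weakly decreasing list of positive parts.
-- partsLE k n = all partitions of n with all parts ≤ k (each exactly once).

partsLE : ℕ → ℕ → List (List ℕ)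
partsLE zero zero    = [ [] ]
partsLE zero (suc _) = []
partsLE (suc k) n =
  concatMap (λ m → if m ℕ.* suc k ≤ᵇ n
                   then map (replicate m (suc k) ++_) (partsLE k (n ∸ m ℕ.* suc k))
                   else [])
            (upTo (suc n))

partitions : ℕ → List (List ℕ)
partitions n = partsLE n n

mult : ℕ → List ℕ → ℕ
mult k λ′ = length (filter (λ i → i ℕ.≟ k) λ′)

-- Symmetric functions evaluated at finitely many variables x : Vec ℚ N

pSum : ℕ → {N : ℕ} → Vec ℚ N → ℚ
pSum k x = sum (map (λ xi → xi ^ℚ k) (toList x))

hSum : ℕ → {N : ℕ} → Vec ℚ N → ℚ
hSum zero    []       = 1ℚ
hSum (suc k) []       = 0ℚ
hSum k       (y ∷ ys) = Σ< (suc k) (λ j → (y ^ℚ j) * hSum (k ∸ j) ys)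

pPart : List ℕ → {N : ℕ} → Vec ℚ N → ℚ
pPart λ′ x = product (map (λ k → pSum k x) λ′)

hPart : List ℕ → {N : ℕ} → Vec ℚ N → ℚ
hPart λ′ x = product (map (λ k → hSum k x) λ′)

φfactor : ℕ → ℚ
φfactor k = ℕtoℚ (4 ℕ.^ k ℕ.* (4 ℕ.^ k ∸ 1)) * bernoulli (2 ℕ.* k)
            * recipℕ (2 ℕ.* k ℕ.* (2 ℕ.* k) !)

φ : ℕ → List ℕ → ℚ
φ n λ′ = ℕtoℚ ((2 ℕ.* n) !)
         * product (map (λ k → recipℕ (mult k λ′ !) * (φfactor k ^ℚ mult k λ′)) (map suc (upTo n)))

A : ℕ → {N : ℕ} → Vec ℚ N → ℚ
A n x = recipℕ ((2 ℕ.* n) !) * sum (map (λ λ′ → ∣ φ n λ′ ∣ * pPart λ′ x) (partitions n))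

hExpansion : ℕ → (List ℕ → ℚ) → {N : ℕ} → Vec ℚ N → ℚ
hExpansion n c x = sum (map (λ μ → c μ * hPart μ x) (partitions n))

allWords : (k m : ℕ) → List (Vec (Fin m) k)
allWords zero    m = [ [] ]
allWords (suc k) m = concatMap (λ i → map (i ∷_) (allWords k m)) (allFin m)

notIn : ℕ → List ℕ → Bool
notIn a []      = true
notIn a (b ∷ r) = if does (a ℕ.≟ b) then false else notIn a r

distinct : List ℕ → Bool
distinct []      = true
distinct (a ∷ r) = notIn a r ∧ distinct r

mutual
  downUp : List ℕ → Bool
  downUp (a ∷ b ∷ r) = (b <ᵇ a) ∧ upDown (b ∷ r)
  downUp _           = true

  upDown : List ℕ → Bool
  upDown (a ∷ b ∷ r) = (a <ᵇ b) ∧ downUp (b ∷ r)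
  upDown _           = true

lastOr : ℕ → List ℕ → ℕ
lastOr d []      = d
lastOr d (a ∷ r) = lastOr a r

cycAlt : List ℕ → Bool
cycAlt []      = true
cycAlt (a ∷ r) = downUp (a ∷ r) ∧ (lastOr a r <ᵇ a)

isCycAltPerm : {m : ℕ} → Vec (Fin m) m → Bool
isCycAltPerm w = let l = map toℕ (toList w) in distinct l ∧ cycAlt l

numCycAlt : ℕ → ℕ
numCycAlt m = length (filter (λ w → isCycAltPerm w ≟ᵇ true) (allWords m m))

{-# OPTIONS --safe #-}
-- Write s(t) = sec √t and log s(t) = ∑ L_k t^k. The definition of A n is the exponential
-- formula for exp(∑ L_k p_k t^k) = ∏ s(x_i t), where L_k = |φfactor k| because the
-- Bernoulli numbers give the coefficients of tanh, whose signs are those of (-1)^k.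
-- For the variables consisting of a copies of a fixed alphabet, p_k becomes a p_k; both the
-- h_k and A n are then polynomials in a, so that an identity for all a ∈ ℕ is an identity
-- of polynomials. With the alphabet {1}, the value a = 1 gives the sum of the coefficients,
-- a = -1 (where H(t) = 1 - t) the coefficient of h_1^n, and the coefficient of a that of h_n.
-- With the alphabet {x, 1}, the coefficient of a² x^i isolates h_i h_j and h_n.
-- Cyclically alternating permutations are counted by rotating the maximum to the front.
-- Removing the maximum from a concatenation of alternating words of odd lengths 2k+1 splits
-- one of the words in two, which is the recurrence tan′ = 1 + tan²; hence the number of
-- permutations that alternate in every such block is N! times a product of coefficients of tan.
module Submission where

-- The hypothesis speaks of values at finitely many rational variables, so every coefficient is
-- extracted by specialisation. A number of copies is a natural number; a = -1 and single powers of
-- a are reached because a rational polynomial that vanishes at all naturals is zero. Short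
-- partitions are isolated by divisibility: for k ≥ 1 the polynomial h_k has no constant term in a,
-- so h_μ has no term aᵈ with d below its number of parts. Thus a² keeps only h_n and products of
-- two, and x separates the latter: with k + l = n and 0 < i < n, (xᵏ + 1)(xˡ + 1) contains xⁱ only
-- if i is k or l. Series are never composed: G = exp(∑ rⱼ tʲ / j) means t G′ = r G and G(0) = 1, a
-- recurrence that yields uniqueness and turns products into sums. The signs of the Bernoulli
-- numbers, hidden in the absolute values of `A n`, come from comparing the Riccati equations f′ = 1
-- ± f² of tan and tanh. The count treats several blocks from the outset, because deleting the
-- maximum leads out of the class of single alternating words.

open import Defs
open import Data.Nat using (ℕ; zero; suc; _+_; _*_; _!; _⊔_; _⊓_; _∸_; _^_; _≤_; _<_; z≤n; s≤s; _≤ᵇ_; _<ᵇ_; _≡ᵇ_)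
open import Data.Nat.Combinatorics using (_C_; k![n∸k]!∣n!; nCk≡n!/k![n-k]!)
open import Data.Nat.DivMod using (m/n*n≡m)
open import Relation.Binary using (Tri; tri<; tri≈; tri>)
open import Data.Rational using (ℚ; _-_; 0ℚ; 1ℚ; ∣_∣) renaming (_*_ to _*ℚ_; _+_ to _+ℚ_; -_ to -ℚ_)
open import Data.Bool using (Bool; true; false; not; _∧_; if_then_else_; T)
open import Data.Bool.Properties using (∧-comm; ∧-assoc; ∧-zeroʳ; ∧-identityʳ) renaming (_≟_ to _≟ᵇ_)
open import Data.Fin as Fin using (Fin; toℕ)
open import Data.Maybe as Maybe using (Maybe; just; nothing)
open import Data.List.Relation.Unary.All using (All; []; _∷_)
open import Data.List.Relation.Unary.All.Properties using (++⁺; take⁺; drop⁺)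
open import Data.Unit using (tt)
open import Data.Sum using (_⊎_; inj₁; inj₂)
open import Data.List.Properties using (filter-accept; filter-reject; ++-cancelˡ; ++-identityʳ; ++-assoc; length-++; length-drop; take-all; map-upTo; map-applyUpTo)
open import Data.Nat.Induction using (<-rec)
open import Data.Vec using (Vec; []; _∷_; toList) renaming (_++_ to _++ᵛ_)
open import Data.List using (List; _∷_; []; replicate; map; upTo; applyUpTo; _++_; concatMap; length; filter; tabulate; allFin; take; drop)
open import Data.Product using (_×_; _,_)
open import Relation.Binary.PropositionalEquality using (_≡_; _≢_; refl; sym; trans; cong; cong₂; subst; module ≡-Reasoning)
open import Relation.Nullary using (¬_; yes; no; dec⇒maybe; contradiction)
open import Function using (_∘_; id)
import Data.Nat.Properties as ℕP
import Data.Rational.Properties as QP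
import Data.Rational.Unnormalised as U
import Data.Rational.Unnormalised.Properties as UP
import Data.Integer as ℤ
import Data.Integer.Properties as ℤP
open import Algebra.Bundles using (CommutativeRing)
open import Algebra.Structures using (IsCommutativeRing)
open import Tactic.RingSolver using (solve-∀)
open import Tactic.RingSolver.Core.AlmostCommutativeRing using (AlmostCommutativeRing; fromCommutativeRing)
open ≡-Reasoning

-- Rational arithmetic and finite sums

infixl 6 _⊕_
infixl 7 _⊗_
infix 8 ⊖_

-- Opaque copies of the operations of ℚ: unlike the originals they are inert,
-- so that their arguments can be inferred by unification.
opaque
  _⊕_ _⊗_ : ℚ → ℚ → ℚ
  _⊕_ = _+ℚ_
  _⊗_ = _*ℚ_

  ⊖_ : ℚ → ℚ
  ⊖_ = -ℚ_

  ι κ : ℕ → ℚ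
  ι = ℕtoℚ
  κ = recipℕ

  ⊕-def : ∀ x y → x +ℚ y ≡ x ⊕ y
  ⊕-def x y = refl

  ⊗-def : ∀ x y → x *ℚ y ≡ x ⊗ y
  ⊗-def x y = refl

  ⊖-def : ∀ x → -ℚ x ≡ ⊖ x
  ⊖-def x = refl

  ι-def : ∀ n → ℕtoℚ n ≡ ι n
  ι-def n = refl

  κ-def : ∀ n → recipℕ n ≡ κ n
  κ-def n = refl

  ⊕-⊗-isCommutativeRing : IsCommutativeRing _≡_ _⊕_ _⊗_ ⊖_ 0ℚ 1ℚ
  ⊕-⊗-isCommutativeRing = QP.+-*-isCommutativeRing

  ι-+ : ∀ m n → ι (m + n) ≡ ι m ⊕ ι n
  ι-+ m n = QP.toℚᵘ-injective (UP.≃-trans (QP.toℚᵘ-fromℚᵘ (U.mkℚᵘ (ℤ.+ (m + n)) 0))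
    (UP.≃-sym (UP.≃-trans (QP.toℚᵘ-homo-+ (ℕtoℚ m) (ℕtoℚ n))
      (UP.≃-trans (UP.+-cong (QP.toℚᵘ-fromℚᵘ (U.mkℚᵘ (ℤ.+ m) 0)) (QP.toℚᵘ-fromℚᵘ (U.mkℚᵘ (ℤ.+ n) 0)))
        (U.*≡* (cong (ℤ._* ℤ.1ℤ) (trans (cong₂ ℤ._+_ (ℤP.*-identityʳ (ℤ.+ m)) (ℤP.*-identityʳ (ℤ.+ n))) (sym (ℤP.pos-+ m n)))))))))

  ι-* : ∀ m n → ι (m * n) ≡ ι m ⊗ ι n
  ι-* m n = QP.toℚᵘ-injective (UP.≃-trans (QP.toℚᵘ-fromℚᵘ (U.mkℚᵘ (ℤ.+ (m * n)) 0))
    (UP.≃-sym (UP.≃-trans (QP.toℚᵘ-homo-* (ℕtoℚ m) (ℕtoℚ n))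
      (UP.≃-trans (UP.*-cong (QP.toℚᵘ-fromℚᵘ (U.mkℚᵘ (ℤ.+ m) 0)) (QP.toℚᵘ-fromℚᵘ (U.mkℚᵘ (ℤ.+ n) 0)))
        (U.*≡* (cong (ℤ._* ℤ.1ℤ) (sym (ℤP.pos-* m n))))))))

  ι-0 : ι 0 ≡ 0ℚ
  ι-0 = refl

  ι-1 : ι 1 ≡ 1ℚ
  ι-1 = refl

  κ-0 : κ 0 ≡ 0ℚ
  κ-0 = refl

  κ-1 : κ 1 ≡ 1ℚ
  κ-1 = refl

  ι⊗κ-suc : ∀ k → ι (suc k) ⊗ κ (suc k) ≡ 1ℚ
  ι⊗κ-suc k = QP.toℚᵘ-injective
    (UP.≃-trans (QP.toℚᵘ-homo-* (ℕtoℚ (suc k)) (recipℕ (suc k)))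
      (UP.≃-trans (UP.*-cong (QP.toℚᵘ-fromℚᵘ (U.mkℚᵘ (ℤ.+ (suc k)) 0)) (QP.toℚᵘ-fromℚᵘ (U.mkℚᵘ (ℤ.+ 1) k)))
        (U.*≡* (trans (ℤP.*-identityʳ _) (trans (ℤP.*-comm (ℤ.+ suc k) (ℤ.+ 1)) (cong (λ z → ℤ.+ 1 ℤ.* ℤ.+ z) (sym (ℕP.*-identityˡ (suc k)))))))))

ℚ-commutativeRing : CommutativeRing _ _
ℚ-commutativeRing = record { isCommutativeRing = ⊕-⊗-isCommutativeRing }

open CommutativeRing ℚ-commutativeRing public using ()
  renaming ( +-assoc to ⊕-assoc; +-comm to ⊕-comm; +-identityˡ to ⊕-identityˡ; +-identityʳ to ⊕-identityʳ
           ; *-assoc to ⊗-assoc; *-comm to ⊗-comm; *-identityˡ to ⊗-identityˡ; *-identityʳ to ⊗-identityʳ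
           ; distribˡ to ⊗-distribˡ; distribʳ to ⊗-distribʳ; zeroˡ to ⊗-zeroˡ; zeroʳ to ⊗-zeroʳ )

-- Built on the transparent operations: the solver is called only inside blocks that unfold `_⊕_`,
-- where these coincide with the opaque ones.
ℚ-ring : AlmostCommutativeRing _ _
ℚ-ring = fromCommutativeRing QP.+-*-commutativeRing λ x → dec⇒maybe (0ℚ QP.≟ x)

opaque
  unfolding _⊕_

  ⊕-interchange : ∀ a b c d → (a ⊕ b) ⊕ (c ⊕ d) ≡ (a ⊕ c) ⊕ (b ⊕ d)
  ⊕-interchange = solve-∀ ℚ-ring

  ⊗-interchange : ∀ a b c d → (a ⊗ b) ⊗ (c ⊗ d) ≡ (a ⊗ c) ⊗ (b ⊗ d)
  ⊗-interchange = solve-∀ ℚ-ring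

⊗≡0ˡ : ∀ {x y} → x ≡ 0ℚ → x ⊗ y ≡ 0ℚ
⊗≡0ˡ {y = y} eq = trans (cong (_⊗ y) eq) (⊗-zeroˡ y)

⊗≡0ʳ : ∀ {x y} → y ≡ 0ℚ → x ⊗ y ≡ 0ℚ
⊗≡0ʳ {x} eq = trans (cong (x ⊗_) eq) (⊗-zeroʳ x)

ι-suc : ∀ n → ι (suc n) ≡ 1ℚ ⊕ ι n
ι-suc n = trans (ι-+ 1 n) (cong (_⊕ ι n) ι-1)

ι⊗κ : ∀ {k} → 1 ≤ k → ι k ⊗ κ k ≡ 1ℚ
ι⊗κ {suc k} _ = ι⊗κ-suc k

ι-cancelˡ : ∀ {k} → 1 ≤ k → ∀ {x y} → ι k ⊗ x ≡ ι k ⊗ y → x ≡ y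
ι-cancelˡ {k} 1≤k {x} {y} eq = begin
  x                  ≡⟨ step x ⟨
  κ k ⊗ (ι k ⊗ x)    ≡⟨ cong (κ k ⊗_) eq ⟩
  κ k ⊗ (ι k ⊗ y)    ≡⟨ step y ⟩
  y                  ∎
  where
  step : ∀ z → κ k ⊗ (ι k ⊗ z) ≡ z
  step z = trans (trans (sym (⊗-assoc _ _ z)) (cong (_⊗ z) (⊗-comm _ _))) (trans (cong (_⊗ z) (ι⊗κ 1≤k)) (⊗-identityˡ z))

κ-unique : ∀ {k} → 1 ≤ k → ∀ {x} → ι k ⊗ x ≡ 1ℚ → x ≡ κ k
κ-unique 1≤k eq = ι-cancelˡ 1≤k (trans eq (sym (ι⊗κ 1≤k)))

κ-* : ∀ {m n} → 1 ≤ m → 1 ≤ n → κ (m * n) ≡ κ m ⊗ κ n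
κ-* {m} {n} 1≤m 1≤n = sym (κ-unique (ℕP.*-mono-≤ 1≤m 1≤n) (begin
  ι (m * n) ⊗ (κ m ⊗ κ n)      ≡⟨ cong (_⊗ (κ m ⊗ κ n)) (ι-* m n) ⟩
  (ι m ⊗ ι n) ⊗ (κ m ⊗ κ n)    ≡⟨ ⊗-interchange _ _ _ _ ⟩
  (ι m ⊗ κ m) ⊗ (ι n ⊗ κ n)    ≡⟨ cong₂ _⊗_ (ι⊗κ 1≤m) (ι⊗κ 1≤n) ⟩
  1ℚ ⊗ 1ℚ                      ≡⟨ ⊗-identityˡ 1ℚ ⟩
  1ℚ                           ∎))

∑ : ℕ → (ℕ → ℚ) → ℚ
∑ zero    f = 0ℚ
∑ (suc n) f = f 0 ⊕ ∑ n (f ∘ suc)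

∑-cong : ∀ n {f g} → (∀ i → i < n → f i ≡ g i) → ∑ n f ≡ ∑ n g
∑-cong zero    _  = refl
∑-cong (suc n) eq = cong₂ _⊕_ (eq 0 (s≤s z≤n)) (∑-cong n (λ i i<n → eq (suc i) (s≤s i<n)))

∑-zero : ∀ n {f} → (∀ i → i < n → f i ≡ 0ℚ) → ∑ n f ≡ 0ℚ
∑-zero zero    _  = refl
∑-zero (suc n) eq = trans
  (cong₂ _⊕_ (eq 0 (s≤s z≤n)) (∑-zero n (λ i i<n → eq (suc i) (s≤s i<n)))) (⊕-identityˡ 0ℚ)

∑-⊕ : ∀ n f g → ∑ n (λ i → f i ⊕ g i) ≡ ∑ n f ⊕ ∑ n g
∑-⊕ zero    f g = sym (⊕-identityˡ 0ℚ)
∑-⊕ (suc n) f g = trans (cong ((f 0 ⊕ g 0) ⊕_) (∑-⊕ n (f ∘ suc) (g ∘ suc))) (⊕-interchange _ _ _ _)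

∑-⊗ˡ : ∀ n x f → ∑ n (λ i → x ⊗ f i) ≡ x ⊗ ∑ n f
∑-⊗ˡ zero    x f = sym (⊗-zeroʳ x)
∑-⊗ˡ (suc n) x f = trans (cong (x ⊗ f 0 ⊕_) (∑-⊗ˡ n x (f ∘ suc))) (sym (⊗-distribˡ x _ _))

∑-split : ∀ m n f → ∑ (m + n) f ≡ ∑ m f ⊕ ∑ n (λ i → f (m + i))
∑-split zero    n f = sym (⊕-identityˡ _)
∑-split (suc m) n f = trans (cong (f 0 ⊕_) (∑-split m n (f ∘ suc))) (sym (⊕-assoc _ _ _))

∑-last : ∀ n f → ∑ (suc n) f ≡ ∑ n f ⊕ f n
∑-last zero    f = ⊕-comm (f 0) 0ℚ
∑-last (suc n) f = trans (cong (f 0 ⊕_) (∑-last n (f ∘ suc))) (sym (⊕-assoc _ _ _))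

∑-swap : ∀ m n (f : ℕ → ℕ → ℚ) → ∑ m (λ i → ∑ n (f i)) ≡ ∑ n (λ j → ∑ m (λ i → f i j))
∑-swap zero    n f = sym (∑-zero n (λ _ _ → refl))
∑-swap (suc m) n f = trans (cong (∑ n (f 0) ⊕_) (∑-swap m n (f ∘ suc))) (sym (∑-⊕ n _ _))

∑-single : ∀ n {f} k → k < n → (∀ i → i < n → i ≢ k → f i ≡ 0ℚ) → ∑ n f ≡ f k
∑-single (suc n) {f} zero _ z = trans
  (cong (f 0 ⊕_) (∑-zero n (λ i i<n → z (suc i) (s≤s i<n) (λ ())))) (⊕-identityʳ _)
∑-single (suc n) {f} (suc k) (s≤s k<n) z = trans
  (cong₂ _⊕_ (z 0 (s≤s z≤n) (λ ()))
             (∑-single n k k<n (λ i i<n i≢k → z (suc i) (s≤s i<n) (i≢k ∘ ℕP.suc-injective))))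
  (⊕-identityˡ _)

sum-applyUpTo : ∀ n f → sum (applyUpTo f n) ≡ ∑ n f
sum-applyUpTo zero    f = refl
sum-applyUpTo (suc n) f = trans (⊕-def _ _) (cong (f 0 ⊕_) (sum-applyUpTo n (f ∘ suc)))

Σ<≡∑ : ∀ n f → Σ< n f ≡ ∑ n f
Σ<≡∑ n f = trans (cong sum (map-upTo f n)) (sum-applyUpTo n f)

infixl 7 _⋆_
-- The Cauchy product by recursion on the index, the first factor being shifted; in this form the
-- ring laws are structural inductions free of truncated subtraction.
_⋆_ : Series → Series → Series
(f ⋆ g) zero    = f 0 ⊗ g 0
(f ⋆ g) (suc k) = f 0 ⊗ g (suc k) ⊕ ((f ∘ suc) ⋆ g) k

⋆≡∑ : ∀ f g k → (f ⋆ g) k ≡ ∑ (suc k) (λ j → f j ⊗ g (k ∸ j))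
⋆≡∑ f g zero    = sym (⊕-identityʳ _)
⋆≡∑ f g (suc k) = cong (f 0 ⊗ g (suc k) ⊕_) (⋆≡∑ (f ∘ suc) g k)

⊛≡⋆ : ∀ f g k → (f ⊛ g) k ≡ (f ⋆ g) k
⊛≡⋆ f g k = trans (Σ<≡∑ (suc k) (λ j → f j *ℚ g (k ∸ j)))
  (trans (∑-cong (suc k) (λ j _ → ⊗-def (f j) (g (k ∸ j)))) (sym (⋆≡∑ f g k)))

-- Power series

δ : Series
δ zero    = 1ℚ
δ (suc _) = 0ℚ

⋆-cong≤ : ∀ {f f′ g g′} k → (∀ j → j ≤ k → f j ≡ f′ j) → (∀ j → j ≤ k → g j ≡ g′ j) → (f ⋆ g) k ≡ (f′ ⋆ g′) k
⋆-cong≤ zero    p q = cong₂ _⊗_ (p 0 z≤n) (q 0 z≤n)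
⋆-cong≤ (suc k) p q = cong₂ _⊕_ (cong₂ _⊗_ (p 0 z≤n) (q (suc k) ℕP.≤-refl))
  (⋆-cong≤ k (λ j j≤k → p (suc j) (s≤s j≤k)) (λ j j≤k → q j (ℕP.m≤n⇒m≤1+n j≤k)))

⋆-cong : ∀ {f f′ g g′} → (∀ j → f j ≡ f′ j) → (∀ j → g j ≡ g′ j) → ∀ k → (f ⋆ g) k ≡ (f′ ⋆ g′) k
⋆-cong p q k = ⋆-cong≤ k (λ j _ → p j) (λ j _ → q j)

⋆-congˡ : ∀ f {g g′} → (∀ j → g j ≡ g′ j) → ∀ k → (f ⋆ g) k ≡ (f ⋆ g′) k
⋆-congˡ f q = ⋆-cong {f} (λ _ → refl) q

⋆-congʳ : ∀ {f f′} g → (∀ j → f j ≡ f′ j) → ∀ k → (f ⋆ g) k ≡ (f′ ⋆ g) k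
⋆-congʳ g p = ⋆-cong p (λ _ → refl)

-- The definition splits off the first coefficient of `f`; splitting off that of `g` instead is the
-- inductive step of commutativity.
⋆-sucʳ : ∀ f g k → (f ⋆ g) (suc k) ≡ f (suc k) ⊗ g 0 ⊕ (f ⋆ (g ∘ suc)) k
⋆-sucʳ f g zero    = ⊕-comm _ _
⋆-sucʳ f g (suc k) = trans (cong (f 0 ⊗ g (suc (suc k)) ⊕_) (⋆-sucʳ (f ∘ suc) g k)) (swap _ _ _)
  where
  swap : ∀ a b c → a ⊕ (b ⊕ c) ≡ b ⊕ (a ⊕ c)
  swap a b c = trans (sym (⊕-assoc a b c)) (trans (cong (_⊕ c) (⊕-comm a b)) (⊕-assoc b a c))

⋆-comm : ∀ f g k → (f ⋆ g) k ≡ (g ⋆ f) k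
⋆-comm f g zero    = ⊗-comm _ _
⋆-comm f g (suc k) = trans (cong₂ _⊕_ (⊗-comm _ _) (⋆-comm (f ∘ suc) g k)) (sym (⋆-sucʳ g f k))

⋆-zeroˡ : ∀ g {f} → (∀ j → f j ≡ 0ℚ) → ∀ k → (f ⋆ g) k ≡ 0ℚ
⋆-zeroˡ g z zero    = trans (cong (_⊗ g 0) (z 0)) (⊗-zeroˡ _)
⋆-zeroˡ g z (suc k) = trans (cong₂ _⊕_ (trans (cong (_⊗ g (suc k)) (z 0)) (⊗-zeroˡ _)) (⋆-zeroˡ g (z ∘ suc) k)) (⊕-identityˡ _)

⋆-identityˡ : ∀ g k → (δ ⋆ g) k ≡ g k
⋆-identityˡ g zero    = ⊗-identityˡ _
⋆-identityˡ g (suc k) = trans (cong₂ _⊕_ (⊗-identityˡ _) (⋆-zeroˡ g (λ _ → refl) k)) (⊕-identityʳ _)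

⋆-identityʳ : ∀ g k → (g ⋆ δ) k ≡ g k
⋆-identityʳ g k = trans (⋆-comm g δ k) (⋆-identityˡ g k)

⋆-distribʳ : ∀ f g h k → ((λ j → f j ⊕ g j) ⋆ h) k ≡ (f ⋆ h) k ⊕ (g ⋆ h) k
⋆-distribʳ f g h zero    = ⊗-distribʳ _ _ _
⋆-distribʳ f g h (suc k) = trans (cong₂ _⊕_ (⊗-distribʳ _ _ _) (⋆-distribʳ (f ∘ suc) (g ∘ suc) h k)) (⊕-interchange _ _ _ _)

⋆-distribˡ : ∀ f g h k → (f ⋆ (λ j → g j ⊕ h j)) k ≡ (f ⋆ g) k ⊕ (f ⋆ h) k
⋆-distribˡ f g h k = trans (⋆-comm f _ k) (trans (⋆-distribʳ g h f k) (cong₂ _⊕_ (⋆-comm g f k) (⋆-comm h f k)))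

⋆-⊗ˡ : ∀ x f g k → ((λ j → x ⊗ f j) ⋆ g) k ≡ x ⊗ (f ⋆ g) k
⋆-⊗ˡ x f g zero    = ⊗-assoc _ _ _
⋆-⊗ˡ x f g (suc k) = trans (cong₂ _⊕_ (⊗-assoc _ _ _) (⋆-⊗ˡ x (f ∘ suc) g k)) (sym (⊗-distribˡ _ _ _))

⋆-⊗ʳ : ∀ x f g k → (f ⋆ (λ j → x ⊗ g j)) k ≡ x ⊗ (f ⋆ g) k
⋆-⊗ʳ x f g k = trans (⋆-comm f _ k) (trans (⋆-⊗ˡ x g f k) (cong (x ⊗_) (⋆-comm g f k)))

⋆-assoc : ∀ f g h k → ((f ⋆ g) ⋆ h) k ≡ (f ⋆ (g ⋆ h)) k
⋆-assoc f g h zero    = ⊗-assoc _ _ _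
⋆-assoc f g h (suc k) = begin
  (f 0 ⊗ g 0) ⊗ h (suc k) ⊕ (((f ⋆ g) ∘ suc) ⋆ h) k
    ≡⟨ cong₂ _⊕_ (⊗-assoc _ _ _) (⋆-distribʳ (λ j → f 0 ⊗ g (suc j)) ((f ∘ suc) ⋆ g) h k) ⟩
  f 0 ⊗ (g 0 ⊗ h (suc k)) ⊕ (((λ j → f 0 ⊗ g (suc j)) ⋆ h) k ⊕ (((f ∘ suc) ⋆ g) ⋆ h) k)
    ≡⟨ cong (f 0 ⊗ (g 0 ⊗ h (suc k)) ⊕_) (cong₂ _⊕_ (⋆-⊗ˡ (f 0) (g ∘ suc) h k) (⋆-assoc (f ∘ suc) g h k)) ⟩
  f 0 ⊗ (g 0 ⊗ h (suc k)) ⊕ (f 0 ⊗ ((g ∘ suc) ⋆ h) k ⊕ ((f ∘ suc) ⋆ (g ⋆ h)) k)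
    ≡⟨ ⊕-assoc _ _ _ ⟨
  (f 0 ⊗ (g 0 ⊗ h (suc k)) ⊕ f 0 ⊗ ((g ∘ suc) ⋆ h) k) ⊕ ((f ∘ suc) ⋆ (g ⋆ h)) k
    ≡⟨ cong (_⊕ ((f ∘ suc) ⋆ (g ⋆ h)) k) (⊗-distribˡ _ _ _) ⟨
  f 0 ⊗ (g ⋆ h) (suc k) ⊕ ((f ∘ suc) ⋆ (g ⋆ h)) k ∎

⋆-∑ʳ : ∀ f n (g : ℕ → Series) k → (f ⋆ (λ j → ∑ n (λ i → g i j))) k ≡ ∑ n (λ i → (f ⋆ g i) k)
⋆-∑ʳ f zero    g k = trans (⋆-comm f _ k) (⋆-zeroˡ f (λ _ → refl) k)
⋆-∑ʳ f (suc n) g k = trans (⋆-distribˡ f (g 0) _ k) (cong ((f ⋆ g 0) k ⊕_) (⋆-∑ʳ f n (g ∘ suc) k))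

⊖⋆ : ∀ f g k → ((λ j → ⊖ f j) ⋆ g) k ≡ ⊖ (f ⋆ g) k
⊖⋆ f g k = trans (⋆-congʳ g (λ j → ⊖≡-1⊗ (f j)) k) (trans (⋆-⊗ˡ (⊖ 1ℚ) f g k) (sym (⊖≡-1⊗ _)))
  where
  opaque
    unfolding _⊕_
    ⊖≡-1⊗ : ∀ x → ⊖ x ≡ ⊖ 1ℚ ⊗ x
    ⊖≡-1⊗ = solve-∀ ℚ-ring

-- D = t d/dt and ∂ = d/dt
D ∂ : Series → Series
D f k = ι k ⊗ f k
∂ f k = ι (suc k) ⊗ f (suc k)

-- Each summand carries the factor k = j + (k - j), and the two parts fall on the two factors.
D-⋆ : ∀ f g k → D (f ⋆ g) k ≡ (D f ⋆ g) k ⊕ (f ⋆ D g) k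
D-⋆ f g k = begin
  ι k ⊗ (f ⋆ g) k                                            ≡⟨ cong (ι k ⊗_) (⋆≡∑ f g k) ⟩
  ι k ⊗ ∑ (suc k) (λ j → f j ⊗ g (k ∸ j))                    ≡⟨ ∑-⊗ˡ (suc k) (ι k) (λ j → f j ⊗ g (k ∸ j)) ⟨
  ∑ (suc k) (λ j → ι k ⊗ (f j ⊗ g (k ∸ j)))                  ≡⟨ ∑-cong (suc k) step ⟩
  ∑ (suc k) (λ j → D f j ⊗ g (k ∸ j) ⊕ f j ⊗ D g (k ∸ j))    ≡⟨ ∑-⊕ (suc k) (λ j → D f j ⊗ g (k ∸ j)) (λ j → f j ⊗ D g (k ∸ j)) ⟩
  ∑ (suc k) (λ j → D f j ⊗ g (k ∸ j)) ⊕ ∑ (suc k) (λ j → f j ⊗ D g (k ∸ j))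
    ≡⟨ cong₂ _⊕_ (⋆≡∑ (D f) g k) (⋆≡∑ f (D g) k) ⟨
  (D f ⋆ g) k ⊕ (f ⋆ D g) k                                  ∎
  where
  opaque
    unfolding _⊕_
    leibniz : ∀ i j x y → (i ⊕ j) ⊗ (x ⊗ y) ≡ (i ⊗ x) ⊗ y ⊕ x ⊗ (j ⊗ y)
    leibniz = solve-∀ ℚ-ring
  step : ∀ j → j < suc k → ι k ⊗ (f j ⊗ g (k ∸ j)) ≡ D f j ⊗ g (k ∸ j) ⊕ f j ⊗ D g (k ∸ j)
  step j (s≤s j≤k) = trans
    (cong (λ m → m ⊗ (f j ⊗ g (k ∸ j))) (trans (cong ι (sym (ℕP.m+[n∸m]≡n j≤k))) (ι-+ j (k ∸ j))))
    (leibniz _ _ _ _)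

D-0 : ∀ f → D f 0 ≡ 0ℚ
D-0 f = trans (cong (_⊗ f 0) ι-0) (⊗-zeroˡ _)

-- This is `D-⋆` one index higher: `∂ f k` is `D f (suc k)`, and the boundary terms contain `D f 0`
-- or `D g 0`, which vanish.
∂-⋆ : ∀ f g k → ∂ (f ⋆ g) k ≡ (∂ f ⋆ g) k ⊕ (f ⋆ ∂ g) k
∂-⋆ f g k = trans (D-⋆ f g (suc k)) (cong₂ _⊕_
  (trans (cong (_⊕ (∂ f ⋆ g) k) (trans (cong (_⊗ g (suc k)) (D-0 f)) (⊗-zeroˡ _))) (⊕-identityˡ _))
  (trans (⋆-sucʳ f (D g) k) (trans (cong (_⊕ (f ⋆ ∂ g) k) (trans (cong (f (suc k) ⊗_) (D-0 g)) (⊗-zeroʳ _))) (⊕-identityˡ _))))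

convList : Series → ℕ → List ℚ → ℚ
convList g i []      = 0ℚ
convList g i (a ∷ r) = g i *ℚ a +ℚ convList g (suc i) r

-- Stated for an arbitrary `F`, because the convolution it is applied to has no accessible name and
-- is known only through its two equations.
convList-unique : (F : Series → ℕ → List ℚ → ℚ) → (∀ g i → F g i [] ≡ 0ℚ) →
  (∀ g i a r → F g i (a ∷ r) ≡ g i *ℚ a +ℚ F g (suc i) r) →
  ∀ g i l → F g i l ≡ convList g i l
convList-unique F F[] F∷ g i []      = F[] g i
convList-unique F F[] F∷ g i (a ∷ r) = trans (F∷ g i a r) (cong (g i *ℚ a +ℚ_) (convList-unique F F[] F∷ g (suc i) r))

-- The convolution inside invList is private to Defs: the underscore is solved by
-- unification once the arguments of the convolution have been abstracted.
mutual
  invConv : Series → ℕ → List ℚ → ℚ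
  invConv = _

  inv-suc : ∀ g k → inv g (suc k) ≡ -ℚ convList g 1 (invList g k)
  inv-suc g k with 1 | invList g k
  ... | i | l = cong -ℚ_ (convList-unique invConv (λ _ _ → refl) (λ _ _ _ _ → refl) g i l)

-- `invList g k` lists the inverse from index k down to 0, so pairing it with g i, g (i + 1), ... is
-- a Cauchy product at k.
convList-invList : ∀ g i k → convList g i (invList g k) ≡ ((λ j → g (i + j)) ⋆ inv g) k
convList-invList g i zero    = trans (⊕-def _ _) (trans (⊕-identityʳ _) (trans (⊗-def _ _) (cong (λ j → g j ⊗ 1ℚ) (sym (ℕP.+-identityʳ i)))))
convList-invList g i (suc k) = trans (⊕-def _ _) (cong₂ _⊕_
  (trans (⊗-def _ _) (cong (λ j → g j ⊗ inv g (suc k)) (sym (ℕP.+-identityʳ i))))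
  (trans (convList-invList g (suc i) k) (⋆-congʳ (inv g) (λ j → cong g (sym (ℕP.+-suc i j))) k)))

inv-⋆ : ∀ g → g 0 ≡ 1ℚ → ∀ k → (g ⋆ inv g) k ≡ δ k
inv-⋆ g g0 zero    = trans (⊗-identityʳ _) g0
inv-⋆ g g0 (suc k) = begin
  g 0 ⊗ inv g (suc k) ⊕ ((g ∘ suc) ⋆ inv g) k
    ≡⟨ cong₂ (λ x y → x ⊗ y ⊕ ((g ∘ suc) ⋆ inv g) k) g0
         (trans (inv-suc g k) (trans (⊖-def _) (cong ⊖_ (convList-invList g 1 k)))) ⟩
  1ℚ ⊗ (⊖ ((g ∘ suc) ⋆ inv g) k) ⊕ ((g ∘ suc) ⋆ inv g) k   ≡⟨ cancel _ ⟩
  0ℚ ∎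
  where
  opaque
    unfolding _⊕_
    cancel : ∀ x → 1ℚ ⊗ (⊖ x) ⊕ x ≡ 0ℚ
    cancel = solve-∀ ℚ-ring

-- Secant and tangent

-- Unlike `2 * m` this reduces to two successors, so that `isEven`, `half` and products of series
-- compute on it.
dbl : ℕ → ℕ
dbl zero    = zero
dbl (suc m) = suc (suc (dbl m))

2*≡dbl : ∀ m → 2 * m ≡ dbl m
2*≡dbl zero    = refl
2*≡dbl (suc m) = trans (ℕP.*-suc 2 m) (cong (suc ∘ suc) (2*≡dbl m))

isEven-suc : ∀ k → isEven (suc k) ≡ not (isEven k)
isEven-suc zero          = refl
isEven-suc (suc zero)    = refl
isEven-suc (suc (suc k)) = isEven-suc k

isEven-dbl : ∀ m → isEven (dbl m) ≡ true
isEven-dbl zero    = refl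
isEven-dbl (suc m) = isEven-dbl m

isEven-suc-dbl : ∀ m → isEven (suc (dbl m)) ≡ false
isEven-suc-dbl m = trans (isEven-suc (dbl m)) (cong not (isEven-dbl m))

half-dbl : ∀ m → half (dbl m) ≡ m
half-dbl zero    = refl
half-dbl (suc m) = cong suc (half-dbl m)

half-suc-even : ∀ k → isEven k ≡ true → half (suc k) ≡ half k
half-suc-even zero          _ = refl
half-suc-even (suc (suc k)) e = cong suc (half-suc-even k e)

half-suc-odd : ∀ k → isEven k ≡ false → half (suc k) ≡ suc (half k)
half-suc-odd (suc zero)    _ = refl
half-suc-odd (suc (suc k)) e = cong suc (half-suc-odd k e)

isEven-∸ : ∀ j k → j ≤ k → isEven k ≡ false → isEven j ≡ false → isEven (k ∸ j) ≡ true
isEven-∸ (suc zero)    (suc k)       _             k-odd j-odd with isEven k | isEven-suc k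
... | true  | _  = refl
... | false | eq = contradiction (trans (sym k-odd) eq) λ ()
isEven-∸ (suc (suc j)) (suc (suc k)) (s≤s (s≤s p)) k-odd j-odd = isEven-∸ j k p k-odd j-odd

sgn-suc : ∀ k → sgn (suc k) ≡ ⊖ sgn k
sgn-suc zero          = ⊖-def _
sgn-suc (suc zero)    = trans (sym ⊖⊖1≡1) (⊖-def _)
  where
  ⊖⊖1≡1 : -ℚ (-ℚ 1ℚ) ≡ 1ℚ
  ⊖⊖1≡1 = refl
sgn-suc (suc (suc k)) = sgn-suc k

suc⊗κ! : ∀ k → ι (suc k) ⊗ κ (suc k !) ≡ κ (k !)
suc⊗κ! k = begin
  ι (suc k) ⊗ κ (suc k * k !)          ≡⟨ cong (ι (suc k) ⊗_) (κ-* (s≤s z≤n) (ℕP.1≤n! k)) ⟩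
  ι (suc k) ⊗ (κ (suc k) ⊗ κ (k !))    ≡⟨ ⊗-assoc _ _ _ ⟨
  (ι (suc k) ⊗ κ (suc k)) ⊗ κ (k !)    ≡⟨ cong (_⊗ κ (k !)) (ι⊗κ-suc k) ⟩
  1ℚ ⊗ κ (k !)                         ≡⟨ ⊗-identityˡ _ ⟩
  κ (k !)                              ∎

opaque
  unfolding _⊕_
  ⊖-⊗ : ∀ x y → (⊖ x) ⊗ y ≡ ⊖ (x ⊗ y)
  ⊖-⊗ = solve-∀ ℚ-ring
  ⊖0 : ⊖ 0ℚ ≡ 0ℚ
  ⊖0 = refl
  ⊗-swapˡ : ∀ a b c → a ⊗ (b ⊗ c) ≡ b ⊗ (a ⊗ c)
  ⊗-swapˡ = solve-∀ ℚ-ring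

cos-even : ∀ k → isEven k ≡ true → cosS k ≡ sgn (half k) ⊗ κ (k !)
cos-even k e rewrite e = trans (⊗-def _ _) (cong (sgn (half k) ⊗_) (κ-def _))

cos-odd : ∀ k → isEven k ≡ false → cosS k ≡ 0ℚ
cos-odd k e rewrite e = refl

sin-even : ∀ k → isEven k ≡ true → sinS k ≡ 0ℚ
sin-even k e rewrite e = refl

sin-odd : ∀ k → isEven k ≡ false → sinS k ≡ sgn (half k) ⊗ κ (k !)
sin-odd k e rewrite e = trans (⊗-def _ _) (cong (sgn (half k) ⊗_) (κ-def _))

∂-cos : ∀ k → ∂ cosS k ≡ ⊖ sinS k
∂-cos k with isEven k in e
... | true  = trans (cong (ι (suc k) ⊗_) (cos-odd (suc k) (trans (isEven-suc k) (cong not e))))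
                (trans (⊗-zeroʳ _) (sym ⊖0))
... | false = begin
  ι (suc k) ⊗ cosS (suc k)
    ≡⟨ cong (ι (suc k) ⊗_) (cos-even (suc k) (trans (isEven-suc k) (cong not e))) ⟩
  ι (suc k) ⊗ (sgn (half (suc k)) ⊗ κ (suc k !))
    ≡⟨ ⊗-swapˡ _ _ _ ⟩
  sgn (half (suc k)) ⊗ (ι (suc k) ⊗ κ (suc k !))
    ≡⟨ cong₂ _⊗_ (trans (cong sgn (half-suc-odd k e)) (sgn-suc (half k))) (suc⊗κ! k) ⟩
  (⊖ sgn (half k)) ⊗ κ (k !)
    ≡⟨ ⊖-⊗ _ _ ⟩
  ⊖ (sgn (half k) ⊗ κ (k !))
    ≡⟨ cong ⊖_ (trans (⊗-def _ _) (cong (sgn (half k) ⊗_) (κ-def _))) ⟨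
  ⊖ (sgn (half k) *ℚ recipℕ (k !)) ∎

∂-sin : ∀ k → ∂ sinS k ≡ cosS k
∂-sin k with isEven k in e
... | false = trans (cong (ι (suc k) ⊗_) (sin-even (suc k) (trans (isEven-suc k) (cong not e)))) (⊗-zeroʳ _)
... | true  = begin
  ι (suc k) ⊗ sinS (suc k)
    ≡⟨ cong (ι (suc k) ⊗_) (sin-odd (suc k) (trans (isEven-suc k) (cong not e))) ⟩
  ι (suc k) ⊗ (sgn (half (suc k)) ⊗ κ (suc k !))
    ≡⟨ ⊗-swapˡ _ _ _ ⟩
  sgn (half (suc k)) ⊗ (ι (suc k) ⊗ κ (suc k !))
    ≡⟨ cong₂ _⊗_ (cong sgn (half-suc-even k e)) (suc⊗κ! k) ⟩
  sgn (half k) ⊗ κ (k !)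
    ≡⟨ trans (⊗-def _ _) (cong (sgn (half k) ⊗_) (κ-def _)) ⟨
  sgn (half k) *ℚ recipℕ (k !) ∎

tan : Series
tan = sinS ⋆ secS

tanS≡tan : ∀ k → tanS k ≡ tan k
tanS≡tan = ⊛≡⋆ sinS secS

cos⋆sec : ∀ k → (cosS ⋆ secS) k ≡ δ k
cos⋆sec = inv-⋆ cosS refl

sec⋆cos : ∀ k → (secS ⋆ cosS) k ≡ δ k
sec⋆cos k = trans (⋆-comm secS cosS k) (cos⋆sec k)

tan⋆cos : ∀ k → (tan ⋆ cosS) k ≡ sinS k
tan⋆cos k = begin
  ((sinS ⋆ secS) ⋆ cosS) k    ≡⟨ ⋆-assoc sinS secS cosS k ⟩
  (sinS ⋆ (secS ⋆ cosS)) k    ≡⟨ ⋆-congˡ sinS sec⋆cos k ⟩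
  (sinS ⋆ δ) k                ≡⟨ ⋆-identityʳ sinS k ⟩
  sinS k                      ∎

∂δ : ∀ k → ∂ δ k ≡ 0ℚ
∂δ k = ⊗-zeroʳ _

opaque
  unfolding _⊕_
  x⊕⊖y≡0⇒x≡y : ∀ {x y} → x ⊕ ⊖ y ≡ 0ℚ → x ≡ y
  x⊕⊖y≡0⇒x≡y {x} {y} eq = trans (sym (lem x y)) (trans (cong (_⊕ y) eq) (⊕-identityˡ y))
    where
    lem : ∀ x y → (x ⊕ ⊖ y) ⊕ y ≡ x
    lem = solve-∀ ℚ-ring

-- Differentiation of sec · cos = 1 together with cos′ = - sin. Multiplying by sec then yields sec′
-- = sec tan.
∂-sec⋆cos : ∀ k → (∂ secS ⋆ cosS) k ≡ (secS ⋆ sinS) k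
∂-sec⋆cos k = x⊕⊖y≡0⇒x≡y (begin
  (∂ secS ⋆ cosS) k ⊕ ⊖ (secS ⋆ sinS) k
    ≡⟨ cong ((∂ secS ⋆ cosS) k ⊕_) (trans (cong ⊖_ (⋆-comm secS sinS k)) (trans (sym (⊖⋆ sinS secS k)) (⋆-comm _ secS k))) ⟩
  (∂ secS ⋆ cosS) k ⊕ (secS ⋆ (λ j → ⊖ sinS j)) k
    ≡⟨ cong ((∂ secS ⋆ cosS) k ⊕_) (⋆-congˡ secS ∂-cos k) ⟨
  (∂ secS ⋆ cosS) k ⊕ (secS ⋆ ∂ cosS) k
    ≡⟨ ∂-⋆ secS cosS k ⟨
  ∂ (secS ⋆ cosS) k
    ≡⟨ cong (ι (suc k) ⊗_) (sec⋆cos (suc k)) ⟩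
  ∂ δ k
    ≡⟨ ∂δ k ⟩
  0ℚ ∎)

∂-sec : ∀ k → ∂ secS k ≡ (secS ⋆ tan) k
∂-sec k = begin
  ∂ secS k                        ≡⟨ ⋆-identityʳ (∂ secS) k ⟨
  (∂ secS ⋆ δ) k                  ≡⟨ ⋆-congˡ (∂ secS) cos⋆sec k ⟨
  (∂ secS ⋆ (cosS ⋆ secS)) k      ≡⟨ ⋆-assoc (∂ secS) cosS secS k ⟨
  ((∂ secS ⋆ cosS) ⋆ secS) k      ≡⟨ ⋆-congʳ secS ∂-sec⋆cos k ⟩
  ((secS ⋆ sinS) ⋆ secS) k        ≡⟨ ⋆-assoc secS sinS secS k ⟩
  (secS ⋆ tan) k                  ∎

∂-tan : ∀ k → ∂ tan k ≡ δ k ⊕ (tan ⋆ tan) k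
∂-tan k = trans (∂-⋆ sinS secS k) (cong₂ _⊕_
  (trans (⋆-congʳ secS ∂-sin k) (cos⋆sec k))
  (trans (⋆-congˡ sinS ∂-sec k) (sym (⋆-assoc sinS secS tan k))))

tan-0 : tan 0 ≡ 0ℚ
tan-0 = ⊗-zeroˡ _

⋆-vanish : ∀ f g k → (∀ j → j ≤ k → f j ⊗ g (k ∸ j) ≡ 0ℚ) → (f ⋆ g) k ≡ 0ℚ
⋆-vanish f g k z = trans (⋆≡∑ f g k) (∑-zero (suc k) (λ { j (s≤s j≤k) → z j j≤k }))

-- The Riccati equation f′ = 1 + ε f², solved by tan (ε = 1) and tanh (ε = -1).
Riccati : ℚ → Series → Set
Riccati ε f = ∀ k → ∂ f k ≡ δ k ⊕ ε ⊗ (f ⋆ f) k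

-- At an odd index k each product f j · f (k - j) in the square has one factor of even index, which
-- vanishes by induction.
riccati-even : ∀ {ε f} → f 0 ≡ 0ℚ → Riccati ε f → ∀ k → isEven k ≡ true → f k ≡ 0ℚ
riccati-even {ε} {f} f0 ric = <-rec (λ k → isEven k ≡ true → f k ≡ 0ℚ) step
  where
  odd-δ : ∀ k → isEven k ≡ false → δ k ≡ 0ℚ
  odd-δ (suc k) _ = refl
  step : ∀ k → (∀ {j} → j < k → isEven j ≡ true → f j ≡ 0ℚ) → isEven k ≡ true → f k ≡ 0ℚ
  step zero    _   _ = f0
  step (suc k) rec e = ι-cancelˡ (s≤s z≤n) (begin
    ∂ f k                    ≡⟨ ric k ⟩
    δ k ⊕ ε ⊗ (f ⋆ f) k      ≡⟨ cong₂ _⊕_ (odd-δ k k-odd) (⊗≡0ʳ (⋆-vanish f f k vanish)) ⟩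
    0ℚ ⊕ 0ℚ                  ≡⟨ ⊕-identityˡ 0ℚ ⟩
    0ℚ                       ≡⟨ ⊗-zeroʳ _ ⟨
    ι (suc k) ⊗ 0ℚ           ∎)
    where
    k-odd : isEven k ≡ false
    k-odd with isEven k | isEven-suc k
    ... | true  | eq = contradiction (trans (sym e) eq) λ ()
    ... | false | _  = refl
    vanish : ∀ j → j ≤ k → f j ⊗ f (k ∸ j) ≡ 0ℚ
    vanish j j≤k with isEven j in ej
    ... | true  = ⊗≡0ˡ (rec (s≤s j≤k) ej)
    ... | false = ⊗≡0ʳ (rec (s≤s (ℕP.m∸n≤m k j)) (isEven-∸ j k j≤k k-odd ej))

tan-riccati : Riccati 1ℚ tan
tan-riccati k = trans (∂-tan k) (cong (δ k ⊕_) (sym (⊗-identityˡ _)))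

tan-even : ∀ k → isEven k ≡ true → tan k ≡ 0ℚ
tan-even = riccati-even tan-0 tan-riccati

-- In sec · tan at an even index one factor always vanishes: for odd j the secant by induction, for
-- even j the tangent at k - j.
sec-odd : ∀ k → isEven k ≡ false → secS k ≡ 0ℚ
sec-odd = <-rec (λ k → isEven k ≡ false → secS k ≡ 0ℚ) step
  where
  isEven-∸ᵉ : ∀ j k → j ≤ k → isEven k ≡ true → isEven j ≡ true → isEven (k ∸ j) ≡ true
  isEven-∸ᵉ zero          k             _             ek _  = ek
  isEven-∸ᵉ (suc (suc j)) (suc (suc k)) (s≤s (s≤s p)) ek ej = isEven-∸ᵉ j k p ek ej
  isEven-∸ᵉ (suc zero)    _             _             _  ()
  step : ∀ k → (∀ {j} → j < k → isEven j ≡ false → secS j ≡ 0ℚ) → isEven k ≡ false → secS k ≡ 0ℚ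
  step (suc k) rec e = ι-cancelˡ (s≤s z≤n) (begin
    ∂ secS k                 ≡⟨ ∂-sec k ⟩
    (secS ⋆ tan) k           ≡⟨ ⋆-vanish secS tan k vanish ⟩
    0ℚ                       ≡⟨ ⊗-zeroʳ _ ⟨
    ι (suc k) ⊗ 0ℚ           ∎)
    where
    k-even : isEven k ≡ true
    k-even with isEven k | isEven-suc k
    ... | true  | _  = refl
    ... | false | eq = contradiction (trans (sym e) eq) λ ()
    vanish : ∀ j → j ≤ k → secS j ⊗ tan (k ∸ j) ≡ 0ℚ
    vanish j j≤k with isEven j in ej
    ... | false = ⊗≡0ˡ (rec (s≤s j≤k) ej)
    ... | true  = ⊗≡0ʳ (tan-even (k ∸ j) (isEven-∸ᵉ j k j≤k k-even ej))

-- Only odd j contribute, and j = 2i + 1 leaves 2(k - i) + 1 for `g`. This is t F(t²) · t G(t²) = t²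
-- (F G)(t²), where G collects the odd coefficients of `g`.
⋆-odd-odd : ∀ f g → (∀ k → f (dbl k) ≡ 0ℚ) → g 0 ≡ 0ℚ → ∀ k →
  (f ⋆ g) (dbl (suc k)) ≡ ((λ i → f (suc (dbl i))) ⋆ (λ i → g (suc (dbl i)))) k
⋆-odd-odd f g f-odd g0 zero = begin
  f 0 ⊗ g 2 ⊕ (f 1 ⊗ g 1 ⊕ f 2 ⊗ g 0)    ≡⟨ cong₂ (λ x y → x ⊗ g 2 ⊕ (f 1 ⊗ g 1 ⊕ f 2 ⊗ y)) (f-odd 0) g0 ⟩
  0ℚ ⊗ g 2 ⊕ (f 1 ⊗ g 1 ⊕ f 2 ⊗ 0ℚ)      ≡⟨ cong₂ (λ x y → x ⊕ (f 1 ⊗ g 1 ⊕ y)) (⊗-zeroˡ _) (⊗-zeroʳ _) ⟩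
  0ℚ ⊕ (f 1 ⊗ g 1 ⊕ 0ℚ)                  ≡⟨ trans (⊕-identityˡ _) (⊕-identityʳ _) ⟩
  f 1 ⊗ g 1                              ∎
⋆-odd-odd f g f-odd g0 (suc k) = trans
  (cong₂ _⊕_ (⊗≡0ˡ (f-odd 0)) (cong (f 1 ⊗ g (suc (dbl (suc k))) ⊕_)
    (⋆-odd-odd (f ∘ suc ∘ suc) g (f-odd ∘ suc) g0 k)))
  (⊕-identityˡ _)

⋆-even-odd : ∀ f g → (∀ k → f (suc (dbl k)) ≡ 0ℚ) → ∀ k →
  (f ⋆ g) (suc (dbl k)) ≡ ((λ i → f (dbl i)) ⋆ (λ i → g (suc (dbl i)))) k
⋆-even-odd f g f-even zero    = trans (cong (f 0 ⊗ g 1 ⊕_) (⊗≡0ˡ (f-even 0))) (⊕-identityʳ _)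
⋆-even-odd f g f-even (suc k) = cong (f 0 ⊗ g (suc (dbl (suc k))) ⊕_) (trans
  (cong₂ _⊕_ (⊗≡0ˡ (f-even 0)) (⋆-even-odd (f ∘ suc ∘ suc) g (f-even ∘ suc) k))
  (⊕-identityˡ _))

-- The coefficients of tan √t / √t, sec √t and cos √t.
τ sec₂ cos₂ : Series
τ k    = tan (suc (dbl k))
sec₂ k = secS (dbl k)
cos₂ k = cosS (dbl k)

shift : Series → Series
shift f zero    = 0ℚ
shift f (suc k) = f k

riccati-odd : ∀ {ε f} → f 0 ≡ 0ℚ → Riccati ε f → ∀ k →
  ι (suc (dbl k)) ⊗ f (suc (dbl k)) ≡ δ k ⊕ ε ⊗ shift ((λ i → f (suc (dbl i))) ⋆ (λ i → f (suc (dbl i)))) k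
riccati-odd {ε} {f} f0 ric zero    = trans (ric 0) (cong (λ x → 1ℚ ⊕ ε ⊗ x) (⊗≡0ˡ f0))
riccati-odd {ε} {f} f0 ric (suc k) = trans (ric (dbl (suc k)))
  (cong (λ x → 0ℚ ⊕ ε ⊗ x) (⋆-odd-odd f f (λ j → riccati-even f0 ric (dbl j) (isEven-dbl j)) f0 k))

-- The recurrence behind three later arguments: the comparison with tanh, the nonnegativity of τ and
-- the count of alternating words.
τ-rec : ∀ k → ι (suc (dbl k)) ⊗ τ k ≡ δ k ⊕ shift (τ ⋆ τ) k
τ-rec k = trans (riccati-odd tan-0 tan-riccati k) (cong (δ k ⊕_) (⊗-identityˡ _))

sec₂-rec : ∀ m → ι (dbl (suc m)) ⊗ sec₂ (suc m) ≡ (sec₂ ⋆ τ) m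
sec₂-rec m = trans (∂-sec (suc (dbl m))) (⋆-even-odd secS tan (λ k → sec-odd (suc (dbl k)) (isEven-suc-dbl k)) m)

cos₂-rec : ∀ m → ι (dbl (suc m)) ⊗ cos₂ (suc m) ≡ ⊖ (cos₂ ⋆ τ) m
cos₂-rec m = trans (∂-cos (suc (dbl m))) (cong ⊖_ (trans (sym (tan⋆cos (suc (dbl m))))
  (trans (⋆-comm tan cosS (suc (dbl m))) (⋆-even-odd cosS tan (λ k → cos-odd (suc (dbl k)) (isEven-suc-dbl k)) m))))

-- Bernoulli numbers and the coefficients of tanh

-- A family with c (i + j) = c i · c j acts as a substitution t ↦ q t, which respects products. It
-- is used with the powers of 2 and of -1.
⋆-scale : ∀ (c : Series) → (∀ i j → c (i + j) ≡ c i ⊗ c j) → ∀ f g k →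
  ((λ j → c j ⊗ f j) ⋆ (λ j → c j ⊗ g j)) k ≡ c k ⊗ (f ⋆ g) k
⋆-scale c c-+ f g k = begin
  ((λ j → c j ⊗ f j) ⋆ (λ j → c j ⊗ g j)) k
    ≡⟨ ⋆≡∑ (λ j → c j ⊗ f j) (λ j → c j ⊗ g j) k ⟩
  ∑ (suc k) (λ j → (c j ⊗ f j) ⊗ (c (k ∸ j) ⊗ g (k ∸ j)))
    ≡⟨ ∑-cong (suc k) step ⟩
  ∑ (suc k) (λ j → c k ⊗ (f j ⊗ g (k ∸ j)))
    ≡⟨ ∑-⊗ˡ (suc k) (c k) (λ j → f j ⊗ g (k ∸ j)) ⟩
  c k ⊗ ∑ (suc k) (λ j → f j ⊗ g (k ∸ j))
    ≡⟨ cong (c k ⊗_) (⋆≡∑ f g k) ⟨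
  c k ⊗ (f ⋆ g) k ∎
  where
  step : ∀ j → j < suc k → (c j ⊗ f j) ⊗ (c (k ∸ j) ⊗ g (k ∸ j)) ≡ c k ⊗ (f j ⊗ g (k ∸ j))
  step j (s≤s j≤k) = trans (⊗-interchange _ _ _ _)
    (cong (_⊗ (f j ⊗ g (k ∸ j))) (trans (sym (c-+ j (k ∸ j))) (cong c (ℕP.m+[n∸m]≡n j≤k))))

two : Series
two k = ι (2 ^ k)

two-+ : ∀ i j → two (i + j) ≡ two i ⊗ two j
two-+ i j = trans (cong ι (ℕP.^-distribˡ-+-* 2 i j)) (ι-* (2 ^ i) (2 ^ j))

two-suc : ∀ k → two (suc k) ≡ ι 2 ⊗ two k
two-suc k = ι-* 2 (2 ^ k)

ι-2 : ι 2 ≡ 1ℚ ⊕ 1ℚ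
ι-2 = trans (ι-+ 1 1) (cong₂ _⊕_ ι-1 ι-1)

opaque
  unfolding _⊕_
  ⊖1⊗ : ∀ x → (⊖ 1ℚ) ⊗ x ≡ ⊖ x
  ⊖1⊗ = solve-∀ ℚ-ring
  x⊕⊖x : ∀ x → x ⊕ ⊖ x ≡ 0ℚ
  x⊕⊖x = solve-∀ ℚ-ring
  twice : ∀ x → x ⊕ x ≡ (1ℚ ⊕ 1ℚ) ⊗ x
  twice = solve-∀ ℚ-ring

sgn-+ : ∀ i j → sgn (i + j) ≡ sgn i ⊗ sgn j
sgn-+ zero    j = sym (⊗-identityˡ _)
sgn-+ (suc i) j = begin
  sgn (suc (i + j))        ≡⟨ sgn-suc (i + j) ⟩
  ⊖ sgn (i + j)            ≡⟨ cong ⊖_ (sgn-+ i j) ⟩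
  ⊖ (sgn i ⊗ sgn j)        ≡⟨ ⊖-⊗ _ _ ⟨
  (⊖ sgn i) ⊗ sgn j        ≡⟨ cong (_⊗ sgn j) (sgn-suc i) ⟨
  sgn (suc i) ⊗ sgn j      ∎

-- Bern = t / (eᵗ - 1), and V is the series with t V = Bern(t) - Bern(2t) = t / (eᵗ + 1).
exp exp+1 Bern V : Series
exp k   = κ (k !)
exp+1 k = δ k ⊕ exp k
Bern    = inv expm1OverT
V k     = Bern (suc k) ⊕ ⊖ (two (suc k) ⊗ Bern (suc k))

∂-exp : ∀ k → ∂ exp k ≡ exp k
∂-exp = suc⊗κ!

-- By the product rule eᵗ eᵗ satisfies G′ = 2 G, a recurrence that the coefficients 2ᵏ / k! satisfy
-- too.
exp⋆exp : ∀ k → (exp ⋆ exp) k ≡ two k ⊗ exp k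
exp⋆exp zero    = cong (_⊗ exp 0) (trans κ-1 (sym ι-1))
exp⋆exp (suc k) = ι-cancelˡ (s≤s z≤n) (begin
  ∂ (exp ⋆ exp) k                        ≡⟨ ∂-⋆ exp exp k ⟩
  (∂ exp ⋆ exp) k ⊕ (exp ⋆ ∂ exp) k      ≡⟨ cong₂ _⊕_ (⋆-congʳ exp ∂-exp k) (⋆-congˡ exp ∂-exp k) ⟩
  (exp ⋆ exp) k ⊕ (exp ⋆ exp) k          ≡⟨ trans (twice _) (cong (_⊗ (exp ⋆ exp) k) (sym ι-2)) ⟩
  ι 2 ⊗ (exp ⋆ exp) k                    ≡⟨ cong (ι 2 ⊗_) (exp⋆exp k) ⟩
  ι 2 ⊗ (two k ⊗ exp k)                  ≡⟨ ⊗-assoc _ _ _ ⟨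
  (ι 2 ⊗ two k) ⊗ exp k                  ≡⟨ cong₂ _⊗_ (two-suc k) (∂-exp k) ⟨
  two (suc k) ⊗ ∂ exp k                  ≡⟨ ⊗-swapˡ _ _ _ ⟩
  ι (suc k) ⊗ (two (suc k) ⊗ exp (suc k)) ∎)

expm1 : ∀ k → expm1OverT k ≡ exp (suc k)
expm1 k = κ-def _

-- The factorisation (eᵗ - 1)(eᵗ + 1) = e²ᵗ - 1 divided by t. The 2 in front appears because
-- `two k ⊗ expm1OverT k` belongs to (e²ᵗ - 1) / (2t).
expm1⋆exp+1 : ∀ k → (expm1OverT ⋆ exp+1) k ≡ ι 2 ⊗ (two k ⊗ expm1OverT k)
expm1⋆exp+1 k = begin
  (expm1OverT ⋆ exp+1) k
    ≡⟨ ⋆-distribˡ expm1OverT δ exp k ⟩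
  (expm1OverT ⋆ δ) k ⊕ (expm1OverT ⋆ exp) k
    ≡⟨ cong₂ _⊕_ (trans (⋆-identityʳ expm1OverT k) (trans (expm1 k) (trans (sym (⊗-identityˡ _)) (cong (_⊗ exp (suc k)) (sym κ-1)))))
                 (⋆-congʳ exp expm1 k) ⟩
  (exp ⋆ exp) (suc k)
    ≡⟨ exp⋆exp (suc k) ⟩
  two (suc k) ⊗ exp (suc k)
    ≡⟨ cong₂ _⊗_ (two-suc k) (sym (expm1 k)) ⟩
  (ι 2 ⊗ two k) ⊗ expm1OverT k
    ≡⟨ ⊗-assoc _ _ _ ⟩
  ι 2 ⊗ (two k ⊗ expm1OverT k) ∎

Bern⋆expm1 : ∀ k → (Bern ⋆ expm1OverT) k ≡ δ k
Bern⋆expm1 k = trans (⋆-comm Bern expm1OverT k) (inv-⋆ expm1OverT refl k)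

scale2 : Series → Series
scale2 f k = two k ⊗ f k

exp+1≡ : ∀ k → exp+1 k ≡ ι 2 ⊗ (Bern ⋆ scale2 expm1OverT) k
exp+1≡ k = begin
  exp+1 k                                          ≡⟨ ⋆-identityˡ exp+1 k ⟨
  (δ ⋆ exp+1) k                                    ≡⟨ ⋆-congʳ exp+1 Bern⋆expm1 k ⟨
  ((Bern ⋆ expm1OverT) ⋆ exp+1) k                  ≡⟨ ⋆-assoc Bern expm1OverT exp+1 k ⟩
  (Bern ⋆ (expm1OverT ⋆ exp+1)) k                  ≡⟨ ⋆-congˡ Bern expm1⋆exp+1 k ⟩
  (Bern ⋆ (λ j → ι 2 ⊗ scale2 expm1OverT j)) k     ≡⟨ ⋆-⊗ʳ (ι 2) Bern (scale2 expm1OverT) k ⟩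
  ι 2 ⊗ (Bern ⋆ scale2 expm1OverT) k               ∎

scale2-inverse : ∀ k → (scale2 expm1OverT ⋆ scale2 Bern) k ≡ δ k
scale2-inverse k = trans (⋆-scale two two-+ expm1OverT Bern k)
  (trans (cong (two k ⊗_) (inv-⋆ expm1OverT refl k)) (two⊗δ k))
  where
  two⊗δ : ∀ k → two k ⊗ δ k ≡ δ k
  two⊗δ zero    = trans (cong (_⊗ 1ℚ) ι-1) (⊗-identityˡ 1ℚ)
  two⊗δ (suc k) = ⊗-zeroʳ _

exp+1⋆scale2-Bern : ∀ k → (exp+1 ⋆ scale2 Bern) k ≡ ι 2 ⊗ Bern k
exp+1⋆scale2-Bern k = begin
  (exp+1 ⋆ scale2 Bern) k
    ≡⟨ ⋆-congʳ (scale2 Bern) exp+1≡ k ⟩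
  ((λ j → ι 2 ⊗ (Bern ⋆ scale2 expm1OverT) j) ⋆ scale2 Bern) k
    ≡⟨ ⋆-⊗ˡ (ι 2) (Bern ⋆ scale2 expm1OverT) (scale2 Bern) k ⟩
  ι 2 ⊗ ((Bern ⋆ scale2 expm1OverT) ⋆ scale2 Bern) k
    ≡⟨ cong (ι 2 ⊗_) (trans (⋆-assoc Bern (scale2 expm1OverT) (scale2 Bern) k)
         (trans (⋆-congˡ Bern scale2-inverse k) (⋆-identityʳ Bern k))) ⟩
  ι 2 ⊗ Bern k ∎

-- Put W = t V = Bern(t) - Bern(2t). From Bern (eᵗ - 1) = t follows Bern (eᵗ + 1) = 2 Bern + t,
-- while Bern(2t) (eᵗ + 1) = 2 Bern; the difference is t, and W 0 = 0 allows the division by t.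
V⋆exp+1 : ∀ k → (V ⋆ exp+1) k ≡ δ k
V⋆exp+1 k = begin
  (V ⋆ exp+1) k
    ≡⟨ ⊕-identityˡ _ ⟨
  0ℚ ⊕ (V ⋆ exp+1) k
    ≡⟨ cong (_⊕ (V ⋆ exp+1) k) (⊗≡0ˡ W0) ⟨
  (W ⋆ exp+1) (suc k)
    ≡⟨ ⋆-distribʳ Bern (λ j → ⊖ scale2 Bern j) exp+1 (suc k) ⟩
  (Bern ⋆ exp+1) (suc k) ⊕ ((λ j → ⊖ scale2 Bern j) ⋆ exp+1) (suc k)
    ≡⟨ cong₂ _⊕_ Bern⋆exp+1 (trans (⊖⋆ (scale2 Bern) exp+1 (suc k))
         (cong ⊖_ (trans (⋆-comm (scale2 Bern) exp+1 (suc k)) (exp+1⋆scale2-Bern (suc k))))) ⟩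
  (Bern (suc k) ⊕ (Bern (suc k) ⊕ δ k)) ⊕ ⊖ (ι 2 ⊗ Bern (suc k))
    ≡⟨ cong (λ x → (Bern (suc k) ⊕ (Bern (suc k) ⊕ δ k)) ⊕ ⊖ (x ⊗ Bern (suc k))) ι-2 ⟩
  (Bern (suc k) ⊕ (Bern (suc k) ⊕ δ k)) ⊕ ⊖ ((1ℚ ⊕ 1ℚ) ⊗ Bern (suc k))
    ≡⟨ cancel _ _ ⟩
  δ k ∎
  where
  opaque
    unfolding _⊕_
    cancel : ∀ b d → (b ⊕ (b ⊕ d)) ⊕ ⊖ ((1ℚ ⊕ 1ℚ) ⊗ b) ≡ d
    cancel = solve-∀ ℚ-ring
  W : Series
  W j = Bern j ⊕ ⊖ (two j ⊗ Bern j)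
  W0 : W 0 ≡ 0ℚ
  W0 = trans (cong (λ x → Bern 0 ⊕ ⊖ x) (trans (cong (_⊗ Bern 0) ι-1) (⊗-identityˡ _))) (x⊕⊖x _)
  Bern⋆exp+1 : (Bern ⋆ exp+1) (suc k) ≡ Bern (suc k) ⊕ (Bern (suc k) ⊕ δ k)
  Bern⋆exp+1 = trans (⋆-distribˡ Bern δ exp (suc k)) (cong₂ _⊕_ (⋆-identityʳ Bern (suc k))
    (trans (⋆-sucʳ Bern exp k) (cong₂ _⊕_ (trans (cong (Bern (suc k) ⊗_) κ-1) (⊗-identityʳ _))
      (trans (⋆-congˡ Bern (λ j → sym (expm1 j)) k) (Bern⋆expm1 k)))))

-- Differentiating V (eᵗ + 1) = 1 gives V′ (eᵗ + 1) = - V eᵗ = V - 1, and multiplication by V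
-- finishes.
∂-V : ∀ k → ∂ V k ≡ (V ⋆ V) k ⊕ ⊖ V k
∂-V k = begin
  ∂ V k                              ≡⟨ ⋆-identityʳ (∂ V) k ⟨
  (∂ V ⋆ δ) k                        ≡⟨ ⋆-congˡ (∂ V) (λ j → trans (⋆-comm exp+1 V j) (V⋆exp+1 j)) k ⟨
  (∂ V ⋆ (exp+1 ⋆ V)) k              ≡⟨ ⋆-assoc (∂ V) exp+1 V k ⟨
  ((∂ V ⋆ exp+1) ⋆ V) k              ≡⟨ ⋆-congʳ V ∂V⋆exp+1 k ⟩
  ((λ j → V j ⊕ ⊖ δ j) ⋆ V) k        ≡⟨ ⋆-distribʳ V (λ j → ⊖ δ j) V k ⟩
  (V ⋆ V) k ⊕ ((λ j → ⊖ δ j) ⋆ V) k  ≡⟨ cong ((V ⋆ V) k ⊕_) (trans (⊖⋆ δ V k) (cong ⊖_ (⋆-identityˡ V k))) ⟩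
  (V ⋆ V) k ⊕ ⊖ V k                  ∎
  where
  opaque
    unfolding _⊕_
    rearrange : ∀ {a v w d} → v ⊕ w ≡ d → a ⊕ w ≡ 0ℚ → a ≡ v ⊕ ⊖ d
    rearrange {a} {v} {w} p q rewrite sym p = trans (sym (lem₁ a w)) (trans (cong (_⊕ ⊖ w) q) (lem₂ v w))
      where
      lem₁ : ∀ a w → (a ⊕ w) ⊕ ⊖ w ≡ a
      lem₁ = solve-∀ ℚ-ring
      lem₂ : ∀ v w → 0ℚ ⊕ ⊖ w ≡ v ⊕ ⊖ (v ⊕ w)
      lem₂ = solve-∀ ℚ-ring
  ∂-exp+1 : ∀ j → ∂ exp+1 j ≡ exp j
  ∂-exp+1 j = trans (⊗-distribˡ _ _ _) (trans (cong₂ _⊕_ (∂δ j) (∂-exp j)) (⊕-identityˡ _))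
  ∂V⋆exp+1 : ∀ j → (∂ V ⋆ exp+1) j ≡ V j ⊕ ⊖ δ j
  ∂V⋆exp+1 j = rearrange
    (trans (sym (trans (⋆-distribˡ V δ exp j) (cong (_⊕ (V ⋆ exp) j) (⋆-identityʳ V j)))) (V⋆exp+1 j))
    (begin
      (∂ V ⋆ exp+1) j ⊕ (V ⋆ exp) j       ≡⟨ cong ((∂ V ⋆ exp+1) j ⊕_) (⋆-congˡ V ∂-exp+1 j) ⟨
      (∂ V ⋆ exp+1) j ⊕ (V ⋆ ∂ exp+1) j   ≡⟨ ∂-⋆ V exp+1 j ⟨
      ∂ (V ⋆ exp+1) j                     ≡⟨ cong (ι (suc j) ⊗_) (V⋆exp+1 (suc j)) ⟩
      ∂ δ j                               ≡⟨ ∂δ j ⟩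
      0ℚ                                  ∎)

-- tanh t = 1 - 2 / (e²ᵗ + 1)
tanh : Series
tanh k = δ k ⊕ ⊖ (ι 2 ⊗ scale2 V k)

tanh-0 : tanh 0 ≡ 0ℚ
tanh-0 = begin
  1ℚ ⊕ ⊖ (ι 2 ⊗ (two 0 ⊗ V 0))    ≡⟨ cong (λ x → 1ℚ ⊕ ⊖ (ι 2 ⊗ x)) (trans (cong (_⊗ V 0) ι-1) (⊗-identityˡ _)) ⟩
  1ℚ ⊕ ⊖ (ι 2 ⊗ V 0)              ≡⟨ cong (λ x → 1ℚ ⊕ ⊖ x) (trans (⊗-comm _ _) (cong (V 0 ⊗_) (trans ι-2 (cong (1ℚ ⊕_) (sym κ-1))))) ⟩
  1ℚ ⊕ ⊖ (V 0 ⊗ exp+1 0)          ≡⟨ cong (λ x → 1ℚ ⊕ ⊖ x) (V⋆exp+1 0) ⟩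
  1ℚ ⊕ ⊖ 1ℚ                       ≡⟨ x⊕⊖x 1ℚ ⟩
  0ℚ                              ∎

-- With tanh = 1 - 2 V(2t), both sides equal - 4 (V² - V)(2t), the value `common`: the left by V′ =
-- V² - V, the right by expanding the square.
tanh-riccati : Riccati (⊖ 1ℚ) tanh
tanh-riccati k = trans lhs (sym rhs)
  where
  v v² : ℚ
  v  = V k
  v² = (V ⋆ V) k
  opaque
    unfolding _⊕_
    lhs-ring : ∀ n t y → n ⊗ (0ℚ ⊕ ⊖ ((1ℚ ⊕ 1ℚ) ⊗ (((1ℚ ⊕ 1ℚ) ⊗ t) ⊗ y))) ≡ ⊖ (((1ℚ ⊕ 1ℚ) ⊗ (1ℚ ⊕ 1ℚ)) ⊗ (t ⊗ (n ⊗ y)))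
    lhs-ring = solve-∀ ℚ-ring
    rhs-ring : ∀ d t x y → d ⊕ (⊖ 1ℚ) ⊗ ((d ⊕ ⊖ ((1ℚ ⊕ 1ℚ) ⊗ (t ⊗ y))) ⊕ ⊖ ((1ℚ ⊕ 1ℚ) ⊗ ((t ⊗ y) ⊕ ⊖ ((1ℚ ⊕ 1ℚ) ⊗ (t ⊗ x)))))
      ≡ ⊖ (((1ℚ ⊕ 1ℚ) ⊗ (1ℚ ⊕ 1ℚ)) ⊗ (t ⊗ (x ⊕ ⊖ y)))
    rhs-ring = solve-∀ ℚ-ring
  common : ℚ
  common = ⊖ (((1ℚ ⊕ 1ℚ) ⊗ (1ℚ ⊕ 1ℚ)) ⊗ (two k ⊗ (v² ⊕ ⊖ v)))
  lhs : ∂ tanh k ≡ common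
  lhs = trans (cong₂ (λ a b → ι (suc k) ⊗ (0ℚ ⊕ ⊖ (a ⊗ (b ⊗ V (suc k))))) ι-2 (trans (two-suc k) (cong (_⊗ two k) ι-2)))
    (trans (lhs-ring (ι (suc k)) (two k) (V (suc k)))
      (cong (λ x → ⊖ (((1ℚ ⊕ 1ℚ) ⊗ (1ℚ ⊕ 1ℚ)) ⊗ (two k ⊗ x))) (∂-V k)))
  neg2V : Series
  neg2V j = ⊖ (ι 2 ⊗ scale2 V j)
  neg2V⋆ : ∀ g → (neg2V ⋆ g) k ≡ ⊖ (ι 2 ⊗ (scale2 V ⋆ g) k)
  neg2V⋆ g = trans (⊖⋆ (λ j → ι 2 ⊗ scale2 V j) g k) (cong ⊖_ (⋆-⊗ˡ (ι 2) (scale2 V) g k))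
  square : (tanh ⋆ tanh) k ≡ (δ k ⊕ ⊖ (ι 2 ⊗ (two k ⊗ v))) ⊕ ⊖ (ι 2 ⊗ ((two k ⊗ v) ⊕ ⊖ (ι 2 ⊗ (two k ⊗ v²))))
  square = trans (⋆-distribʳ δ neg2V tanh k) (cong₂ _⊕_ (⋆-identityˡ tanh k)
    (trans (neg2V⋆ tanh) (cong (λ x → ⊖ (ι 2 ⊗ x)) (trans (⋆-distribˡ (scale2 V) δ neg2V k)
      (cong₂ _⊕_ (⋆-identityʳ (scale2 V) k) (trans (⋆-comm (scale2 V) neg2V k)
        (trans (neg2V⋆ (scale2 V)) (cong (λ x → ⊖ (ι 2 ⊗ x)) (⋆-scale two two-+ V V k)))))))))
  rhs : δ k ⊕ (⊖ 1ℚ) ⊗ (tanh ⋆ tanh) k ≡ common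
  rhs = trans (cong (λ x → δ k ⊕ (⊖ 1ℚ) ⊗ x) (trans square
    (cong (λ c → (δ k ⊕ ⊖ (c ⊗ (two k ⊗ v))) ⊕ ⊖ (c ⊗ ((two k ⊗ v) ⊕ ⊖ (c ⊗ (two k ⊗ v²))))) ι-2)))
    (rhs-ring (δ k) (two k) v² v)

-- This is tanh t = - i tan (i t) without complex numbers: twisting the recurrence of τ by (-1)ᵏ
-- turns ε = 1 into ε = -1, because the square stands one index lower.
tanh-τ : ∀ k → tanh (suc (dbl k)) ≡ sgn k ⊗ τ k
tanh-τ = <-rec (λ k → tanh (suc (dbl k)) ≡ sgn k ⊗ τ k) step
  where
  step : ∀ k → (∀ {j} → j < k → tanh (suc (dbl j)) ≡ sgn j ⊗ τ j) → tanh (suc (dbl k)) ≡ sgn k ⊗ τ k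
  step k rec = ι-cancelˡ (s≤s z≤n) (trans (riccati-odd tanh-0 tanh-riccati k) (trans (twist k rec)
    (trans (cong (sgn k ⊗_) (sym (τ-rec k))) (⊗-swapˡ _ _ _))))
    where
    twist : ∀ k → (∀ {j} → j < k → tanh (suc (dbl j)) ≡ sgn j ⊗ τ j) →
      δ k ⊕ (⊖ 1ℚ) ⊗ shift ((λ i → tanh (suc (dbl i))) ⋆ (λ i → tanh (suc (dbl i)))) k ≡ sgn k ⊗ (δ k ⊕ shift (τ ⋆ τ) k)
    twist zero    _   = trans (cong (1ℚ ⊕_) (⊗-zeroʳ _)) (sym (⊗-identityˡ _))
    twist (suc k) rec = trans (⊕-identityˡ _) (trans (⊖1⊗ _) (trans (cong ⊖_ (trans
        (⋆-cong≤ k (λ j j≤k → rec (s≤s j≤k)) (λ j j≤k → rec (s≤s j≤k)))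
        (⋆-scale sgn sgn-+ τ τ k)))
      (trans (sym (⊖-⊗ _ _)) (cong₂ _⊗_ (sym (sgn-suc k)) (sym (⊕-identityˡ _))))))

opaque
  unfolding _⊕_
  ∣∣-⊗ : ∀ x y → ∣ x ⊗ y ∣ ≡ ∣ x ∣ ⊗ ∣ y ∣
  ∣∣-⊗ = QP.∣p*q∣≡∣p∣*∣q∣
  ∣ι∣ : ∀ n → ∣ ι n ∣ ≡ ι n
  ∣ι∣ n = QP.0≤p⇒∣p∣≡p (QP.nonNegative⁻¹ (ι n) {{QP.normalize-nonNeg n 1}})
  ∣κ∣ : ∀ n → ∣ κ n ∣ ≡ κ n
  ∣κ∣ zero    = refl
  ∣κ∣ (suc n) = QP.0≤p⇒∣p∣≡p (QP.nonNegative⁻¹ (κ (suc n)) {{QP.normalize-nonNeg 1 (suc n)}})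
  ∣∣-⊕ : ∀ {x y} → ∣ x ∣ ≡ x → ∣ y ∣ ≡ y → ∣ x ⊕ y ∣ ≡ x ⊕ y
  ∣∣-⊕ {x} {y} p q = QP.0≤p⇒∣p∣≡p (QP.+-mono-≤ (QP.∣p∣≡p⇒0≤p p) (QP.∣p∣≡p⇒0≤p q))

∣sgn∣ : ∀ k → ∣ sgn k ∣ ≡ 1ℚ
∣sgn∣ zero          = refl
∣sgn∣ (suc zero)    = refl
∣sgn∣ (suc (suc k)) = ∣sgn∣ k

-- The recurrence builds τ from 1 by sums, products and division by positive numbers. Nonnegativity
-- takes the form ∣ x ∣ ≡ x, which strips the absolute value in `∣φfactor∣-τ`.
∣τ∣ : ∀ k → ∣ τ k ∣ ≡ τ k
∣τ∣ = <-rec (λ k → ∣ τ k ∣ ≡ τ k) step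
  where
  ∣∣-⋆ : ∀ {f g} k → (∀ j → j ≤ k → ∣ f j ∣ ≡ f j) → (∀ j → j ≤ k → ∣ g j ∣ ≡ g j) → ∣ (f ⋆ g) k ∣ ≡ (f ⋆ g) k
  ∣∣-⋆ zero    p q = trans (∣∣-⊗ _ _) (cong₂ _⊗_ (p 0 z≤n) (q 0 z≤n))
  ∣∣-⋆ (suc k) p q = ∣∣-⊕ (trans (∣∣-⊗ _ _) (cong₂ _⊗_ (p 0 z≤n) (q (suc k) ℕP.≤-refl)))
    (∣∣-⋆ k (λ j j≤k → p (suc j) (s≤s j≤k)) (λ j j≤k → q j (ℕP.m≤n⇒m≤1+n j≤k)))
  rhs : ∀ k → (∀ {j} → j < k → ∣ τ j ∣ ≡ τ j) → ∣ δ k ⊕ shift (τ ⋆ τ) k ∣ ≡ δ k ⊕ shift (τ ⋆ τ) k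
  rhs zero    rec = ∣∣-⊕ refl refl
  rhs (suc k) rec = ∣∣-⊕ refl (∣∣-⋆ k (λ j j≤k → rec (s≤s j≤k)) (λ j j≤k → rec (s≤s j≤k)))
  step : ∀ k → (∀ {j} → j < k → ∣ τ j ∣ ≡ τ j) → ∣ τ k ∣ ≡ τ k
  step k rec = ι-cancelˡ (s≤s z≤n) (begin
    ι (suc (dbl k)) ⊗ ∣ τ k ∣            ≡⟨ cong (_⊗ ∣ τ k ∣) (∣ι∣ (suc (dbl k))) ⟨
    ∣ ι (suc (dbl k)) ∣ ⊗ ∣ τ k ∣        ≡⟨ ∣∣-⊗ _ _ ⟨
    ∣ ι (suc (dbl k)) ⊗ τ k ∣            ≡⟨ cong ∣_∣ (τ-rec k) ⟩
    ∣ δ k ⊕ shift (τ ⋆ τ) k ∣            ≡⟨ rhs k rec ⟩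
    δ k ⊕ shift (τ ⋆ τ) k                ≡⟨ τ-rec k ⟨
    ι (suc (dbl k)) ⊗ τ k                ∎)

4^≡two : ∀ k → ι (4 ^ k) ≡ two (dbl k)
4^≡two zero    = refl
4^≡two (suc k) = begin
  ι (4 * 4 ^ k)                ≡⟨ ι-* 4 (4 ^ k) ⟩
  ι 4 ⊗ ι (4 ^ k)              ≡⟨ cong₂ _⊗_ (ι-* 2 2) (4^≡two k) ⟩
  (ι 2 ⊗ ι 2) ⊗ two (dbl k)    ≡⟨ ⊗-assoc _ _ _ ⟩
  ι 2 ⊗ (ι 2 ⊗ two (dbl k))    ≡⟨ cong (ι 2 ⊗_) (two-suc (dbl k)) ⟨
  ι 2 ⊗ two (suc (dbl k))      ≡⟨ two-suc (suc (dbl k)) ⟨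
  two (dbl (suc k))            ∎

ι-∸1 : ∀ {m} → 1 ≤ m → ι (m ∸ 1) ≡ ι m ⊕ ⊖ 1ℚ
ι-∸1 {suc m} _ = sym (trans (cong (_⊕ ⊖ 1ℚ) (ι-suc m)) (cancel _ _))
  where
  opaque
    unfolding _⊕_
    cancel : ∀ x y → (x ⊕ y) ⊕ ⊖ x ≡ y
    cancel = solve-∀ ℚ-ring

-- For N = 2k the coefficient of tanh at N - 1 is 4ᵏ (4ᵏ - 1) B_N / N!, because 2ᴺ = 4ᵏ; this is N
-- times `φfactor k`.
φfactor-τ : ∀ m → ι (dbl (suc m)) ⊗ φfactor (suc m) ≡ sgn m ⊗ τ m
φfactor-τ m = trans (begin
  ι N ⊗ φfactor k
    ≡⟨ cong (ι N ⊗_) φfactor-def ⟩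
  ι N ⊗ (((q ⊗ (q ⊕ ⊖ 1ℚ)) ⊗ (ι (N !) ⊗ Bern N)) ⊗ (κ N ⊗ κ (N !)))
    ≡⟨ regroup _ _ _ _ _ _ ⟩
  (ι N ⊗ κ N) ⊗ ((ι (N !) ⊗ κ (N !)) ⊗ ((q ⊗ (q ⊕ ⊖ 1ℚ)) ⊗ Bern N))
    ≡⟨ cong₂ (λ x y → x ⊗ (y ⊗ ((q ⊗ (q ⊕ ⊖ 1ℚ)) ⊗ Bern N))) (ι⊗κ (s≤s z≤n)) (ι⊗κ (ℕP.1≤n! N)) ⟩
  1ℚ ⊗ (1ℚ ⊗ ((q ⊗ (q ⊕ ⊖ 1ℚ)) ⊗ Bern N))
    ≡⟨ expand _ _ ⟩
  0ℚ ⊕ ⊖ (q ⊗ (Bern N ⊕ ⊖ (q ⊗ Bern N)))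
    ≡⟨ cong (λ x → 0ℚ ⊕ ⊖ (x ⊗ V (suc (dbl m)))) (two-suc (suc (dbl m))) ⟩
  0ℚ ⊕ ⊖ ((ι 2 ⊗ two (suc (dbl m))) ⊗ V (suc (dbl m)))
    ≡⟨ cong (λ x → 0ℚ ⊕ ⊖ x) (⊗-assoc _ _ _) ⟩
  tanh (suc (dbl m)) ∎) (tanh-τ m)
  where
  k N : ℕ
  k = suc m
  N = dbl k
  q : ℚ
  q = two N
  opaque
    unfolding _⊕_
    regroup : ∀ n r f b x g → n ⊗ ((r ⊗ (f ⊗ b)) ⊗ (x ⊗ g)) ≡ (n ⊗ x) ⊗ ((f ⊗ g) ⊗ (r ⊗ b))
    regroup = solve-∀ ℚ-ring
    expand : ∀ q b → 1ℚ ⊗ (1ℚ ⊗ ((q ⊗ (q ⊕ ⊖ 1ℚ)) ⊗ b)) ≡ 0ℚ ⊕ ⊖ (q ⊗ (b ⊕ ⊖ (q ⊗ b)))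
    expand = solve-∀ ℚ-ring
  4^-part : ℕtoℚ (4 ^ k * (4 ^ k ∸ 1)) ≡ q ⊗ (q ⊕ ⊖ 1ℚ)
  4^-part = trans (ι-def _) (trans (ι-* (4 ^ k) _) (cong₂ _⊗_ (4^≡two k)
    (trans (ι-∸1 (ℕP.m^n>0 4 k)) (cong (_⊕ ⊖ 1ℚ) (4^≡two k)))))
  φfactor-def : φfactor k ≡ ((q ⊗ (q ⊕ ⊖ 1ℚ)) ⊗ (ι (N !) ⊗ Bern N)) ⊗ (κ N ⊗ κ (N !))
  φfactor-def = trans (⊗-def _ _) (cong₂ _⊗_
    (trans (⊗-def _ _) (cong₂ _⊗_ 4^-part
      (trans (⊗-def _ _) (trans (cong (λ j → ℕtoℚ (j !) ⊗ Bern j) (2*≡dbl k)) (cong (_⊗ Bern N) (ι-def (N !)))))))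
    (trans (κ-def _) (trans (cong (λ j → κ (j * j !)) (2*≡dbl k)) (κ-* {N} (s≤s z≤n) (ℕP.1≤n! N)))))

-- This identifies ∑ ∣φfactor k∣ tᵏ as log sec √t: the derivative of log sec is tan, whose
-- coefficient at 2k - 1 is 2k times the k-th one here.
∣φfactor∣-τ : ∀ m → ι (dbl (suc m)) ⊗ ∣ φfactor (suc m) ∣ ≡ τ m
∣φfactor∣-τ m = begin
  ι (dbl (suc m)) ⊗ ∣ φfactor (suc m) ∣         ≡⟨ cong (_⊗ ∣ φfactor (suc m) ∣) (∣ι∣ (dbl (suc m))) ⟨
  ∣ ι (dbl (suc m)) ∣ ⊗ ∣ φfactor (suc m) ∣     ≡⟨ ∣∣-⊗ _ _ ⟨
  ∣ ι (dbl (suc m)) ⊗ φfactor (suc m) ∣         ≡⟨ cong ∣_∣ (φfactor-τ m) ⟩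
  ∣ sgn m ⊗ τ m ∣                               ≡⟨ ∣∣-⊗ _ _ ⟩
  ∣ sgn m ∣ ⊗ ∣ τ m ∣                           ≡⟨ cong₂ _⊗_ (∣sgn∣ m) (∣τ∣ m) ⟩
  1ℚ ⊗ τ m                                      ≡⟨ ⊗-identityˡ _ ⟩
  τ m                                           ∎

-- Polynomials and exponentials of power series

Poly : Set
Poly = List ℚ

evalP : Poly → ℚ → ℚ
evalP []      a = 0ℚ
evalP (c ∷ p) a = c ⊕ a ⊗ evalP p a

coef : Poly → Series
coef []      _       = 0ℚ
coef (c ∷ p) zero    = c
coef (c ∷ p) (suc d) = coef p d

addP mulP : Poly → Poly → Poly
addP []      q       = q
addP (c ∷ p) []      = c ∷ p
addP (c ∷ p) (d ∷ q) = (c ⊕ d) ∷ addP p q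

scaleP : ℚ → Poly → Poly
scaleP x = map (x ⊗_)

mulP []      q = []
mulP (c ∷ p) q = addP (scaleP c q) (0ℚ ∷ mulP p q)

tabP : ℕ → Series → Poly
tabP zero    f = []
tabP (suc B) f = f 0 ∷ tabP B (f ∘ suc)

opaque
  unfolding _⊕_
  horner-⊕ : ∀ c d a x y → (c ⊕ d) ⊕ a ⊗ (x ⊕ y) ≡ (c ⊕ a ⊗ x) ⊕ (d ⊕ a ⊗ y)
  horner-⊕ = solve-∀ ℚ-ring
  horner-⊗ : ∀ x c a y → x ⊗ c ⊕ a ⊗ (x ⊗ y) ≡ x ⊗ (c ⊕ a ⊗ y)
  horner-⊗ = solve-∀ ℚ-ring
  horner-mul : ∀ c a x y → c ⊗ x ⊕ (0ℚ ⊕ a ⊗ (y ⊗ x)) ≡ (c ⊕ a ⊗ y) ⊗ x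
  horner-mul = solve-∀ ℚ-ring

evalP-add : ∀ p q a → evalP (addP p q) a ≡ evalP p a ⊕ evalP q a
evalP-add []      q       a = sym (⊕-identityˡ _)
evalP-add (c ∷ p) []      a = sym (⊕-identityʳ _)
evalP-add (c ∷ p) (d ∷ q) a = trans (cong (λ x → (c ⊕ d) ⊕ a ⊗ x) (evalP-add p q a)) (horner-⊕ _ _ _ _ _)

evalP-scale : ∀ x p a → evalP (scaleP x p) a ≡ x ⊗ evalP p a
evalP-scale x []      a = sym (⊗-zeroʳ x)
evalP-scale x (c ∷ p) a = trans (cong (λ y → x ⊗ c ⊕ a ⊗ y) (evalP-scale x p a)) (horner-⊗ _ _ _ _)

evalP-mul : ∀ p q a → evalP (mulP p q) a ≡ evalP p a ⊗ evalP q a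
evalP-mul []      q a = sym (⊗-zeroˡ _)
evalP-mul (c ∷ p) q a = trans (evalP-add (scaleP c q) (0ℚ ∷ mulP p q) a)
  (trans (cong₂ (λ x y → x ⊕ (0ℚ ⊕ a ⊗ y)) (evalP-scale c q a) (evalP-mul p q a)) (horner-mul _ _ _ _))

coef-add : ∀ p q d → coef (addP p q) d ≡ coef p d ⊕ coef q d
coef-add []      q       d       = sym (⊕-identityˡ _)
coef-add (c ∷ p) []      d       = sym (⊕-identityʳ _)
coef-add (c ∷ p) (e ∷ q) zero    = refl
coef-add (c ∷ p) (e ∷ q) (suc d) = coef-add p q d

coef-scale : ∀ x p d → coef (scaleP x p) d ≡ x ⊗ coef p d
coef-scale x []      d       = sym (⊗-zeroʳ x)
coef-scale x (c ∷ p) zero    = refl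
coef-scale x (c ∷ p) (suc d) = coef-scale x p d

coef-mul : ∀ p q d → coef (mulP p q) d ≡ (coef p ⋆ coef q) d
coef-mul []      q d       = sym (⋆-zeroˡ (coef q) (λ _ → refl) d)
coef-mul (c ∷ p) q zero    = trans (coef-add (scaleP c q) (0ℚ ∷ mulP p q) 0)
  (trans (cong (_⊕ 0ℚ) (coef-scale c q 0)) (⊕-identityʳ _))
coef-mul (c ∷ p) q (suc d) = trans (coef-add (scaleP c q) (0ℚ ∷ mulP p q) (suc d))
  (cong₂ _⊕_ (coef-scale c q (suc d)) (coef-mul p q d))

coef-tab : ∀ B f d → d < B → coef (tabP B f) d ≡ f d
coef-tab (suc B) f zero    _         = refl
coef-tab (suc B) f (suc d) (s≤s d<B) = coef-tab B (f ∘ suc) d d<B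

-- The quotient of c ∷ p by X - m.
divP : ℚ → ℚ → Poly → Poly
divP m c []      = []
divP m c (d ∷ p) = evalP (d ∷ p) m ∷ divP m d p

length-divP : ∀ m c p → length (divP m c p) ≡ length p
length-divP m c []      = refl
length-divP m c (d ∷ p) = cong suc (length-divP m d p)

evalP-divP : ∀ m c p a → evalP (c ∷ p) a ≡ evalP (c ∷ p) m ⊕ (a ⊕ ⊖ m) ⊗ evalP (divP m c p) a
evalP-divP m c []      a = lem c a m
  where
  opaque
    unfolding _⊕_
    lem : ∀ c a m → c ⊕ a ⊗ 0ℚ ≡ (c ⊕ m ⊗ 0ℚ) ⊕ (a ⊕ ⊖ m) ⊗ 0ℚ
    lem = solve-∀ ℚ-ring
evalP-divP m c (d ∷ p) a = trans (cong (λ x → c ⊕ a ⊗ x) (evalP-divP m d p a)) (lem _ _ _ _ _)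
  where
  opaque
    unfolding _⊕_
    lem : ∀ c a m e q → c ⊕ a ⊗ (e ⊕ (a ⊕ ⊖ m) ⊗ q) ≡ (c ⊕ m ⊗ e) ⊕ (a ⊕ ⊖ m) ⊗ (e ⊕ a ⊗ q)
    lem = solve-∀ ℚ-ring

divP≡0⇒≡0 : ∀ m c p → evalP (c ∷ p) m ≡ 0ℚ → (∀ d → coef (divP m c p) d ≡ 0ℚ) → ∀ d → coef (c ∷ p) d ≡ 0ℚ
divP≡0⇒≡0 m c p e z zero = trans (sym (trans (cong (c ⊕_) (⊗≡0ʳ (evalP-m p z))) (⊕-identityʳ c))) e
  where
  evalP-m : ∀ p → (∀ d → coef (divP m c p) d ≡ 0ℚ) → evalP p m ≡ 0ℚ
  evalP-m []      z = refl
  evalP-m (d ∷ p) z = z 0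
divP≡0⇒≡0 m c []      e z (suc d) = refl
divP≡0⇒≡0 m c (x ∷ p) e z (suc d) = divP≡0⇒≡0 m x p (z 0) (z ∘ suc) d

-- Divide by X - m: the quotient is shorter and vanishes at every a > m, where a - m is invertible.
-- Vanishing is asked only from m onwards because each division gives up one point.
poly-identity≥ : ∀ n p → length p ≤ n → ∀ m → (∀ a → m ≤ a → evalP p (ι a) ≡ 0ℚ) → ∀ d → coef p d ≡ 0ℚ
poly-identity≥ n       []      _         m z d = refl
poly-identity≥ (suc n) (c ∷ p) (s≤s len) m z = divP≡0⇒≡0 (ι m) c p (z m ℕP.≤-refl)
  (poly-identity≥ n (divP (ι m) c p) (subst (_≤ n) (sym (length-divP (ι m) c p)) len) (suc m) quotient-vanishes)
  where
  opaque
    unfolding _⊕_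
    lem : ∀ x y → (x ⊕ y) ⊕ ⊖ x ≡ y
    lem = solve-∀ ℚ-ring
  quotient-vanishes : ∀ a → suc m ≤ a → evalP (divP (ι m) c p) (ι a) ≡ 0ℚ
  quotient-vanishes a m<a = ι-cancelˡ (ℕP.m<n⇒0<n∸m m<a) (begin
    ι (a ∸ m) ⊗ q                       ≡⟨ cong (_⊗ q) (lem (ι m) (ι (a ∸ m))) ⟨
    ((ι m ⊕ ι (a ∸ m)) ⊕ ⊖ ι m) ⊗ q     ≡⟨ cong (λ x → (x ⊕ ⊖ ι m) ⊗ q) (trans (sym (ι-+ m (a ∸ m))) (cong ι (ℕP.m+[n∸m]≡n m≤a))) ⟩
    (ι a ⊕ ⊖ ι m) ⊗ q                   ≡⟨ ⊕-identityˡ _ ⟨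
    0ℚ ⊕ (ι a ⊕ ⊖ ι m) ⊗ q              ≡⟨ cong (_⊕ (ι a ⊕ ⊖ ι m) ⊗ q) (z m ℕP.≤-refl) ⟨
    evalP (c ∷ p) (ι m) ⊕ (ι a ⊕ ⊖ ι m) ⊗ q ≡⟨ evalP-divP (ι m) c p (ι a) ⟨
    evalP (c ∷ p) (ι a)                 ≡⟨ z a m≤a ⟩
    0ℚ                                  ≡⟨ ⊗-zeroʳ _ ⟨
    ι (a ∸ m) ⊗ 0ℚ                      ∎)
    where
    m≤a = ℕP.<⇒≤ m<a
    q = evalP (divP (ι m) c p) (ι a)

poly-identity : ∀ p → (∀ a → evalP p (ι a) ≡ 0ℚ) → ∀ d → coef p d ≡ 0ℚ
poly-identity p z = poly-identity≥ (length p) p ℕP.≤-refl 0 (λ a _ → z a)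

coef≡0⇒evalP≡0 : ∀ p → (∀ d → coef p d ≡ 0ℚ) → ∀ a → evalP p a ≡ 0ℚ
coef≡0⇒evalP≡0 []      z a = refl
coef≡0⇒evalP≡0 (c ∷ p) z a = trans (cong₂ _⊕_ (z 0) (⊗≡0ʳ (coef≡0⇒evalP≡0 p (z ∘ suc) a))) (⊕-identityˡ 0ℚ)

-- G = exp(∑ rⱼ tʲ / j), characterised by t G′ = r G.
record IsExp (r G : Series) : Set where
  field
    r-0 : r 0 ≡ 0ℚ
    G-0 : G 0 ≡ 1ℚ
    D-G : ∀ n → D G n ≡ (r ⋆ G) n
open IsExp

-- Since `f` has no constant term, the coefficient n + 1 sees `g` only up to n. This is what makes t
-- G′ = r G a recurrence for G.
⋆-cong< : ∀ {f f′ g g′} n → f 0 ≡ 0ℚ → (∀ j → j ≤ suc n → f j ≡ f′ j) → (∀ j → j ≤ n → g j ≡ g′ j) →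
  (f ⋆ g) (suc n) ≡ (f′ ⋆ g′) (suc n)
⋆-cong< n f0 p q = cong₂ _⊕_ (trans (⊗≡0ˡ f0) (sym (⊗≡0ˡ (trans (sym (p 0 z≤n)) f0))))
  (⋆-cong≤ n (λ j j≤n → p (suc j) (s≤s j≤n)) q)

-- Agreement is asked only up to order N, so that an exponential truncated at N can be compared with
-- the full one.
exp-unique : ∀ N {r r′ G G′} → IsExp r G → IsExp r′ G′ → (∀ j → j ≤ N → r j ≡ r′ j) → ∀ n → n ≤ N → G n ≡ G′ n
exp-unique N {r} {r′} {G} {G′} E E′ p = <-rec (λ n → n ≤ N → G n ≡ G′ n) step
  where
  step : ∀ n → (∀ {j} → j < n → j ≤ N → G j ≡ G′ j) → n ≤ N → G n ≡ G′ n
  step zero    _   _   = trans (G-0 E) (sym (G-0 E′))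
  step (suc n) rec n≤N = ι-cancelˡ (s≤s z≤n) (trans (D-G E (suc n)) (trans
    (⋆-cong< n (r-0 E) (λ j j≤n → p j (ℕP.≤-trans j≤n n≤N))
      (λ j j≤n → rec (s≤s j≤n) (ℕP.≤-trans j≤n (ℕP.<⇒≤ n≤N))))
    (sym (D-G E′ (suc n)))))

exp-cong : ∀ {r r′ G} → (∀ j → r j ≡ r′ j) → IsExp r G → IsExp r′ G
exp-cong p E = record
  { r-0 = trans (sym (p 0)) (r-0 E) ; G-0 = G-0 E ; D-G = λ n → trans (D-G E n) (⋆-congʳ _ p n) }

-- expCoef ρ d n is the coefficient of aᵈtⁿ in exp(a ∑ ρⱼ tʲ / j).
expCoef : Series → ℕ → Series
expCoef ρ zero    n = δ n
expCoef ρ (suc d) n = κ n ⊗ (ρ ⋆ expCoef ρ d) n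

expPoly : Series → ℕ → ℕ → Poly
expPoly ρ B n = tabP B (λ d → expCoef ρ d n)

evalP-tab-⋆ : ∀ ρ x B (g : ℕ → Series) a n →
  evalP (tabP B (λ d → x ⊗ (ρ ⋆ g d) n)) a ≡ x ⊗ (ρ ⋆ (λ k → evalP (tabP B (λ d → g d k)) a)) n
evalP-tab-⋆ ρ x zero    g a n = sym (⊗≡0ʳ (trans (⋆-comm ρ _ n) (⋆-zeroˡ ρ (λ _ → refl) n)))
evalP-tab-⋆ ρ x (suc B) g a n = begin
  x ⊗ (ρ ⋆ g 0) n ⊕ a ⊗ evalP (tabP B (λ d → x ⊗ (ρ ⋆ g (suc d)) n)) a
    ≡⟨ cong (λ y → x ⊗ (ρ ⋆ g 0) n ⊕ a ⊗ y) (evalP-tab-⋆ ρ x B (g ∘ suc) a n) ⟩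
  x ⊗ (ρ ⋆ g 0) n ⊕ a ⊗ (x ⊗ (ρ ⋆ h) n)
    ≡⟨ horner-⊗ _ _ _ _ ⟩
  x ⊗ ((ρ ⋆ g 0) n ⊕ a ⊗ (ρ ⋆ h) n)
    ≡⟨ cong (x ⊗_) (trans (⋆-distribˡ ρ (g 0) (λ k → a ⊗ h k) n) (cong ((ρ ⋆ g 0) n ⊕_) (⋆-⊗ʳ a ρ h n))) ⟨
  x ⊗ (ρ ⋆ (λ k → g 0 k ⊕ a ⊗ h k)) n ∎
  where
  h : Series
  h k = evalP (tabP B (λ d → g (suc d) k)) a

-- Comparing powers of a in n Gₙ = a (ρ ⋆ G)ₙ gives the recursion of `expCoef`. The bound `B` is
-- quantified inside the induction because taking out one factor a leaves polynomials with one
-- coefficient fewer.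
exp-expPoly : ∀ {ρ a G} → ρ 0 ≡ 0ℚ → IsExp (λ j → a ⊗ ρ j) G → ∀ n B → n < B → G n ≡ evalP (expPoly ρ B n) a
exp-expPoly {ρ} {a} {G} ρ0 E = <-rec (λ n → ∀ B → n < B → G n ≡ evalP (expPoly ρ B n) a) step
  where
  step : ∀ n → (∀ {j} → j < n → ∀ B → j < B → G j ≡ evalP (expPoly ρ B j) a) → ∀ B → n < B → G n ≡ evalP (expPoly ρ B n) a
  -- The convention κ 0 = 0 makes all coefficients of positive degree vanish at n = 0.
  step zero    _   (suc B) _         = trans (G-0 E) (sym (trans (cong (1ℚ ⊕_) (⊗≡0ʳ
    (trans (evalP-tab-⋆ ρ (κ 0) B (expCoef ρ) a 0) (⊗≡0ˡ κ-0)))) (⊕-identityʳ 1ℚ)))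
  step (suc n) rec (suc B) (s≤s n<B) = ι-cancelˡ (s≤s z≤n) (begin
    D G (suc n)                                           ≡⟨ D-G E (suc n) ⟩
    ((λ j → a ⊗ ρ j) ⋆ G) (suc n)                         ≡⟨ ⋆-⊗ˡ a ρ G (suc n) ⟩
    a ⊗ (ρ ⋆ G) (suc n)
      ≡⟨ cong (a ⊗_) (⋆-cong< {ρ} n ρ0 (λ _ _ → refl) (λ j j≤n → rec (s≤s j≤n) B (ℕP.≤-trans (s≤s j≤n) n<B))) ⟩
    a ⊗ (ρ ⋆ h) (suc n)                                   ≡⟨ cong (a ⊗_) (trans (sym (⊗-assoc _ _ _)) (trans (cong (_⊗ (ρ ⋆ h) (suc n)) (ι⊗κ-suc n)) (⊗-identityˡ _))) ⟨
    a ⊗ (ι (suc n) ⊗ (κ (suc n) ⊗ (ρ ⋆ h) (suc n)))       ≡⟨ ⊗-swapˡ _ _ _ ⟩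
    ι (suc n) ⊗ (a ⊗ (κ (suc n) ⊗ (ρ ⋆ h) (suc n)))       ≡⟨ cong (λ x → ι (suc n) ⊗ (a ⊗ x)) (evalP-tab-⋆ ρ (κ (suc n)) B (expCoef ρ) a (suc n)) ⟨
    ι (suc n) ⊗ (a ⊗ evalP (tabP B (λ d → κ (suc n) ⊗ (ρ ⋆ expCoef ρ d) (suc n))) a) ≡⟨ cong (ι (suc n) ⊗_) (⊕-identityˡ _) ⟨
    ι (suc n) ⊗ evalP (expPoly ρ (suc B) (suc n)) a       ∎)
    where
    h : Series
    h k = evalP (expPoly ρ B k) a

expCoef-1 : ∀ ρ n → expCoef ρ 1 n ≡ κ n ⊗ ρ n
expCoef-1 ρ n = cong (κ n ⊗_) (⋆-identityʳ ρ n)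

expCoef-2 : ∀ ρ n → expCoef ρ 2 n ≡ κ n ⊗ (ρ ⋆ (λ k → κ k ⊗ ρ k)) n
expCoef-2 ρ n = cong (κ n ⊗_) (⋆-congˡ ρ (expCoef-1 ρ) n)

-- Sums over partitions

∑ˡ : ∀ {A : Set} → (A → ℚ) → List A → ℚ
∑ˡ f []       = 0ℚ
∑ˡ f (x ∷ xs) = f x ⊕ ∑ˡ f xs

sum-map : ∀ {A : Set} (f : A → ℚ) xs → sum (map f xs) ≡ ∑ˡ f xs
sum-map f []       = refl
sum-map f (x ∷ xs) = trans (⊕-def _ _) (cong (f x ⊕_) (sum-map f xs))

∑ˡ-++ : ∀ {A : Set} (f : A → ℚ) xs ys → ∑ˡ f (xs ++ ys) ≡ ∑ˡ f xs ⊕ ∑ˡ f ys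
∑ˡ-++ f []       ys = sym (⊕-identityˡ _)
∑ˡ-++ f (x ∷ xs) ys = trans (cong (f x ⊕_) (∑ˡ-++ f xs ys)) (sym (⊕-assoc _ _ _))

∑ˡ-map : ∀ {A B : Set} (f : B → ℚ) (g : A → B) xs → ∑ˡ f (map g xs) ≡ ∑ˡ (f ∘ g) xs
∑ˡ-map f g []       = refl
∑ˡ-map f g (x ∷ xs) = cong (f (g x) ⊕_) (∑ˡ-map f g xs)

∑ˡ-cong : ∀ {A : Set} {f g : A → ℚ} → (∀ x → f x ≡ g x) → ∀ xs → ∑ˡ f xs ≡ ∑ˡ g xs
∑ˡ-cong p []       = refl
∑ˡ-cong p (x ∷ xs) = cong₂ _⊕_ (p x) (∑ˡ-cong p xs)

∑ˡ-⊕ : ∀ {A : Set} (f g : A → ℚ) xs → ∑ˡ (λ x → f x ⊕ g x) xs ≡ ∑ˡ f xs ⊕ ∑ˡ g xs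
∑ˡ-⊕ f g []       = sym (⊕-identityˡ 0ℚ)
∑ˡ-⊕ f g (x ∷ xs) = trans (cong ((f x ⊕ g x) ⊕_) (∑ˡ-⊕ f g xs)) (⊕-interchange _ _ _ _)

∑ˡ-⊗ˡ : ∀ {A : Set} c (f : A → ℚ) xs → ∑ˡ (λ x → c ⊗ f x) xs ≡ c ⊗ ∑ˡ f xs
∑ˡ-⊗ˡ c f []       = sym (⊗-zeroʳ c)
∑ˡ-⊗ˡ c f (x ∷ xs) = trans (cong (c ⊗ f x ⊕_) (∑ˡ-⊗ˡ c f xs)) (sym (⊗-distribˡ c _ _))

∑ˡ-concatMap : ∀ {A B : Set} (f : B → ℚ) (g : A → List B) xs → ∑ˡ f (concatMap g xs) ≡ ∑ˡ (λ x → ∑ˡ f (g x)) xs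
∑ˡ-concatMap f g []       = refl
∑ˡ-concatMap f g (x ∷ xs) = trans (∑ˡ-++ f (g x) (concatMap g xs)) (cong (∑ˡ f (g x) ⊕_) (∑ˡ-concatMap f g xs))

∑ˡ-upTo : ∀ n f → ∑ˡ f (upTo n) ≡ ∑ n f
∑ˡ-upTo n f = trans (sym (sum-map f (upTo n))) (Σ<≡∑ n f)

-- μ is a partition of n with parts at most K, generated in the same way as by partsLE.
data PartLE : ℕ → ℕ → List ℕ → Set where
  nil   : PartLE 0 0 []
  block : ∀ {K n n′ μ} m → m * suc K + n′ ≡ n → PartLE K n′ μ → PartLE (suc K) n (replicate m (suc K) ++ μ)

∑ᵖ : ℕ → ℕ → (List ℕ → ℚ) → ℚ
∑ᵖ K n g = ∑ˡ g (partsLE K n)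

if-cong : ∀ {A : Set} b {x y z : A} → (b ≡ true → x ≡ y) → (if b then x else z) ≡ (if b then y else z)
if-cong true  p = p refl
if-cong false p = refl

≤ᵇ-true : ∀ {m n} → (m ≤ᵇ n) ≡ true → m ≤ n
≤ᵇ-true {m} {n} e = ℕP.≤ᵇ⇒≤ m n (subst T (sym e) tt)

≤⇒≤ᵇ-true : ∀ {m n} → m ≤ n → (m ≤ᵇ n) ≡ true
≤⇒≤ᵇ-true {m} {n} p with m ≤ᵇ n | ℕP.≤⇒≤ᵇ p
... | true | _ = refl

∑ᵖ-suc : ∀ K n g → ∑ᵖ (suc K) n g ≡
  ∑ (suc n) (λ m → if m * suc K ≤ᵇ n then ∑ᵖ K (n ∸ m * suc K) (λ μ → g (replicate m (suc K) ++ μ)) else 0ℚ)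
∑ᵖ-suc K n g = trans
  (∑ˡ-concatMap g (λ m → if m * suc K ≤ᵇ n then map (replicate m (suc K) ++_) (partsLE K (n ∸ m * suc K)) else []) (upTo (suc n)))
  (trans (∑ˡ-upTo (suc n) _) (∑-cong (suc n) (λ m _ → guard m (m * suc K ≤ᵇ n))))
  where
  guard : ∀ m b → ∑ˡ g (if b then map (replicate m (suc K) ++_) (partsLE K (n ∸ m * suc K)) else [])
    ≡ (if b then ∑ᵖ K (n ∸ m * suc K) (λ μ → g (replicate m (suc K) ++ μ)) else 0ℚ)
  guard m true  = ∑ˡ-map g (replicate m (suc K) ++_) (partsLE K (n ∸ m * suc K))
  guard m false = refl

∑ᵖ-cong : ∀ K n {g g′} → (∀ μ → PartLE K n μ → g μ ≡ g′ μ) → ∑ᵖ K n g ≡ ∑ᵖ K n g′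
∑ᵖ-cong zero    zero    p = cong (_⊕ 0ℚ) (p [] nil)
∑ᵖ-cong zero    (suc n) p = refl
∑ᵖ-cong (suc K) n {g} {g′} p = trans (∑ᵖ-suc K n g) (trans
  (∑-cong (suc n) (λ m _ → if-cong (m * suc K ≤ᵇ n) {z = 0ℚ} (λ e → ∑ᵖ-cong K (n ∸ m * suc K)
    (λ μ μ-part → p _ (block m (ℕP.m+[n∸m]≡n (≤ᵇ-true {m * suc K} e)) μ-part)))))
  (sym (∑ᵖ-suc K n g′)))

∑ᵖ-zero : ∀ K n {g} → (∀ μ → PartLE K n μ → g μ ≡ 0ℚ) → ∑ᵖ K n g ≡ 0ℚ
∑ᵖ-zero K n p = trans (∑ᵖ-cong K n p) (∑ˡ-zero (partsLE K n))
  where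
  ∑ˡ-zero : ∀ {A : Set} (xs : List A) → ∑ˡ (λ _ → 0ℚ) xs ≡ 0ℚ
  ∑ˡ-zero []       = refl
  ∑ˡ-zero (x ∷ xs) = trans (⊕-identityˡ _) (∑ˡ-zero xs)

mult-replicate : ∀ m k μ → mult k (replicate m k ++ μ) ≡ m + mult k μ
mult-replicate zero    k μ = refl
mult-replicate (suc m) k μ = trans (cong length (filter-accept (λ i → i ℕP.≟ k) {k} refl)) (cong suc (mult-replicate m k μ))

mult-replicate-≢ : ∀ m {k j} → k ≢ j → ∀ μ → mult j (replicate m k ++ μ) ≡ mult j μ
mult-replicate-≢ zero    k≢j μ = refl
mult-replicate-≢ (suc m) {k} {j} k≢j μ = trans (cong length (filter-reject (λ i → i ℕP.≟ j) {k} k≢j)) (mult-replicate-≢ m k≢j μ)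

mult-large : ∀ {K n μ} → PartLE K n μ → ∀ {j} → K < j → mult j μ ≡ 0
mult-large nil                _   = refl
mult-large (block {K} m _ p) K<j = trans (mult-replicate-≢ m (ℕP.<⇒≢ K<j) _) (mult-large p (ℕP.<-trans (ℕP.n<1+n K) K<j))

-- Each partition is enumerated once: the multiplicity of `suc K` determines the index m of the
-- outer sum, and the remainder is settled by induction.
∑ᵖ-single : ∀ {K n ν} → PartLE K n ν → ∀ g → (∀ μ → PartLE K n μ → μ ≢ ν → g μ ≡ 0ℚ) → ∑ᵖ K n g ≡ g ν
∑ᵖ-single nil g z = ⊕-identityʳ _
∑ᵖ-single {n = n} (block {K} {_} {n′} {ν} m eq p) g z = trans (∑ᵖ-suc K n g) (trans
  (∑-single (suc n) m (s≤s (ℕP.≤-trans (ℕP.m≤m*n m (suc K)) m-fits)) other-m) at-m)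
  where
  m-fits : m * suc K ≤ n
  m-fits = subst (m * suc K ≤_) eq (ℕP.m≤m+n _ n′)
  term : ℕ → ℚ
  term i = if i * suc K ≤ᵇ n then ∑ᵖ K (n ∸ i * suc K) (λ μ → g (replicate i (suc K) ++ μ)) else 0ℚ
  mult-block : ∀ {i n″ μ} → PartLE K n″ μ → mult (suc K) (replicate i (suc K) ++ μ) ≡ i
  mult-block {i} {μ = μ} q = trans (mult-replicate i (suc K) μ) (trans (cong (i +_) (mult-large q ℕP.≤-refl)) (ℕP.+-identityʳ i))
  other-m : ∀ i → i < suc n → i ≢ m → term i ≡ 0ℚ
  other-m i _ i≢m = trans
    (if-cong (i * suc K ≤ᵇ n) (λ e → ∑ᵖ-zero K (n ∸ i * suc K) (λ μ q →
      z _ (block i (ℕP.m+[n∸m]≡n (≤ᵇ-true {i * suc K} e)) q)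
        (λ same → i≢m (trans (sym (mult-block q)) (trans (cong (mult (suc K)) same) (mult-block p)))))))
    (if-same (i * suc K ≤ᵇ n))
    where
    if-same : ∀ b → (if b then 0ℚ else 0ℚ) ≡ 0ℚ
    if-same true  = refl
    if-same false = refl
  at-m : term m ≡ g (replicate m (suc K) ++ ν)
  at-m rewrite ≤⇒≤ᵇ-true m-fits | sym eq | ℕP.m+n∸m≡n (m * suc K) n′ =
    ∑ᵖ-single p (λ μ → g (replicate m (suc K) ++ μ))
      (λ μ q μ≢ν → z _ (block m refl q) (μ≢ν ∘ ++-cancelˡ (replicate m (suc K)) μ ν))

weaken : ∀ {K n μ} d → PartLE K n μ → PartLE (d + K) n μ
weaken zero    p = p
weaken (suc d) p = block 0 refl (weaken d p)

weaken≤ : ∀ {K K′ n μ} → K ≤ K′ → PartLE K n μ → PartLE K′ n μ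
weaken≤ {K} {K′} {n} {μ} K≤K′ p = subst (λ k → PartLE k n μ) (ℕP.m∸n+n≡m K≤K′) (weaken (K′ ∸ K) p)

part-nil : ∀ K → PartLE K 0 []
part-nil K = weaken≤ z≤n nil

part-one : ∀ {n K} → 1 ≤ n → n ≤ K → PartLE K n (n ∷ [])
part-one {suc n} _ n≤K = weaken≤ n≤K (block 1 (trans (ℕP.+-identityʳ _) (ℕP.+-identityʳ _)) (part-nil n))

-- Equal parts form one block of multiplicity two, distinct parts two blocks of multiplicity one.
part-two : ∀ {i j K} → 1 ≤ j → j ≤ i → i ≤ K → PartLE K (i + j) (i ∷ j ∷ [])
part-two {zero} (s≤s _) ()
part-two {suc i} {j} 1≤j j≤i i≤K with j ℕP.≟ suc i
... | yes refl = weaken≤ i≤K (block 2 (trans (ℕP.+-identityʳ _) (cong (suc i +_) (ℕP.+-identityʳ _))) (part-nil i))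
... | no j≢i   = weaken≤ i≤K (block 1 (cong (_+ j) (ℕP.+-identityʳ _)) (part-one 1≤j (ℕP.≤-pred (ℕP.≤∧≢⇒< j≤i j≢i))))

part-ones : ∀ n {K} → 1 ≤ K → PartLE K n (replicate n 1)
part-ones n 1≤K = weaken≤ 1≤K (subst (PartLE 1 n) (++-identityʳ _)
  (block n (trans (ℕP.+-identityʳ _) (ℕP.*-identityʳ n)) nil))

total : List ℕ → ℕ
total []      = 0
total (k ∷ μ) = k + total μ

total-replicate : ∀ m k μ → total (replicate m k ++ μ) ≡ m * k + total μ
total-replicate zero    k μ = refl
total-replicate (suc m) k μ = trans (cong (k +_) (total-replicate m k μ)) (sym (ℕP.+-assoc k (m * k) (total μ)))

part-total : ∀ {K n μ} → PartLE K n μ → total μ ≡ n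
part-total nil                    = refl
part-total (block {K} {μ = μ} m eq p) = trans (total-replicate m (suc K) μ) (trans (cong (m * suc K +_) (part-total p)) eq)

data Positive : List ℕ → Set where
  []  : Positive []
  _∷_ : ∀ {k μ} → 1 ≤ k → Positive μ → Positive (k ∷ μ)

part-positive : ∀ {K n μ} → PartLE K n μ → Positive μ
part-positive nil             = []
part-positive (block {K} m _ p) = replicate-positive m
  where
  replicate-positive : ∀ m → Positive (replicate m (suc K) ++ _)
  replicate-positive zero    = part-positive p
  replicate-positive (suc m) = s≤s z≤n ∷ replicate-positive m

part-descending : ∀ {K n i j μ} → PartLE K n (i ∷ j ∷ μ) → j ≤ i
part-descending p = descend p refl
  where
  head≤ : ∀ {K n ν} → PartLE K n ν → ∀ {i μ} → ν ≡ i ∷ μ → i ≤ K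
  head≤ (block zero    _ p) eq   = ℕP.m≤n⇒m≤1+n (head≤ p eq)
  head≤ (block (suc m) _ p) refl = ℕP.≤-refl
  descend : ∀ {K n ν} → PartLE K n ν → ∀ {i j μ} → ν ≡ i ∷ j ∷ μ → j ≤ i
  descend (block zero          _ p) eq   = descend p eq
  descend (block (suc zero)    _ p) {μ = μ} refl = ℕP.m≤n⇒m≤1+n (head≤ p refl)
  descend (block (suc (suc m)) _ p) refl = ℕP.≤-refl

-- The exponential formula and A n

pow : ℚ → ℕ → ℚ
pow x zero    = 1ℚ
pow x (suc k) = x ⊗ pow x k

^ℚ≡pow : ∀ x k → x ^ℚ k ≡ pow x k
^ℚ≡pow x zero    = refl
^ℚ≡pow x (suc k) = trans (⊗-def _ _) (cong (x ⊗_) (^ℚ≡pow x k))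

pow-⊗ : ∀ x y k → pow (x ⊗ y) k ≡ pow x k ⊗ pow y k
pow-⊗ x y zero    = sym (⊗-identityˡ 1ℚ)
pow-⊗ x y (suc k) = trans (cong ((x ⊗ y) ⊗_) (pow-⊗ x y k)) (⊗-interchange _ _ _ _)

pow-1 : ∀ k → pow 1ℚ k ≡ 1ℚ
pow-1 zero    = refl
pow-1 (suc k) = trans (⊗-identityˡ _) (pow-1 k)

∏ : ℕ → (ℕ → ℚ) → ℚ
∏ zero    f = 1ℚ
∏ (suc n) f = f 0 ⊗ ∏ n (f ∘ suc)

∏-cong : ∀ n {f g} → (∀ i → i < n → f i ≡ g i) → ∏ n f ≡ ∏ n g
∏-cong zero    _ = refl
∏-cong (suc n) p = cong₂ _⊗_ (p 0 (s≤s z≤n)) (∏-cong n (λ i i<n → p (suc i) (s≤s i<n)))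

∏-last : ∀ n f → ∏ (suc n) f ≡ ∏ n f ⊗ f n
∏-last zero    f = ⊗-comm (f 0) 1ℚ
∏-last (suc n) f = trans (cong (f 0 ⊗_) (∏-last n (f ∘ suc))) (sym (⊗-assoc _ _ _))

product-upTo : ∀ n (f : ℕ → ℚ) → product (map f (map suc (upTo n))) ≡ ∏ n (f ∘ suc)
product-upTo n f = trans (cong (product ∘ map f) (map-upTo suc n))
  (trans (cong product (map-applyUpTo suc f n)) (product-applyUpTo n (f ∘ suc)))
  where
  product-applyUpTo : ∀ n f → product (applyUpTo f n) ≡ ∏ n f
  product-applyUpTo zero    f = refl
  product-applyUpTo (suc n) f = trans (⊗-def _ _) (cong (f 0 ⊗_) (product-applyUpTo n (f ∘ suc)))

∏ˡ : (ℕ → ℚ) → List ℕ → ℚ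
∏ˡ p []      = 1ℚ
∏ˡ p (k ∷ μ) = p k ⊗ ∏ˡ p μ

product-map : ∀ p μ → product (map p μ) ≡ ∏ˡ p μ
product-map p []      = refl
product-map p (k ∷ μ) = trans (⊗-def _ _) (cong (p k ⊗_) (product-map p μ))

∏ˡ-replicate : ∀ p m k μ → ∏ˡ p (replicate m k ++ μ) ≡ pow (p k) m ⊗ ∏ˡ p μ
∏ˡ-replicate p zero    k μ = sym (⊗-identityˡ _)
∏ˡ-replicate p (suc m) k μ = trans (cong (p k ⊗_) (∏ˡ-replicate p m k μ)) (sym (⊗-assoc _ _ _))

∏ˡ-cong : ∀ {p q} → (∀ k → p k ≡ q k) → ∀ μ → ∏ˡ p μ ≡ ∏ˡ q μ
∏ˡ-cong e []      = refl
∏ˡ-cong e (k ∷ μ) = cong₂ _⊗_ (e k) (∏ˡ-cong e μ)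

-- Multiplication by tⁱ.
shifts : ℕ → Series → Series
shifts zero    f = f
shifts (suc i) f = shift (shifts i f)

shift-cong≤ : ∀ {f g} n → (∀ j → j < n → f j ≡ g j) → shift f n ≡ shift g n
shift-cong≤ zero    p = refl
shift-cong≤ (suc n) p = p n ℕP.≤-refl

shifts-cong≤ : ∀ i {f g} n → (∀ j → j ≤ n → f j ≡ g j) → shifts i f n ≡ shifts i g n
shifts-cong≤ zero    n p = p n ℕP.≤-refl
shifts-cong≤ (suc i) n p = shift-cong≤ n (λ j j<n → shifts-cong≤ i j (λ l l≤j → p l (ℕP.≤-trans l≤j (ℕP.<⇒≤ j<n))))

shifts-cong : ∀ i {f g} → (∀ j → f j ≡ g j) → ∀ n → shifts i f n ≡ shifts i g n
shifts-cong i p n = shifts-cong≤ i n (λ j _ → p j)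

shifts-+ : ∀ i j f n → shifts (i + j) f n ≡ shifts i (shifts j f) n
shifts-+ zero    j f n = refl
shifts-+ (suc i) j f n = shift-cong≤ n (λ l _ → shifts-+ i j f l)

shift-⋆ : ∀ r f n → shift (r ⋆ f) n ≡ (r ⋆ shift f) n
shift-⋆ r f zero    = sym (⊗-zeroʳ _)
shift-⋆ r f (suc n) = sym (trans (⋆-sucʳ r (shift f) n) (trans (cong (_⊕ (r ⋆ f) n) (⊗-zeroʳ _)) (⊕-identityˡ _)))

shifts-⋆ : ∀ i r f n → shifts i (r ⋆ f) n ≡ (r ⋆ shifts i f) n
shifts-⋆ zero    r f n = refl
shifts-⋆ (suc i) r f n = trans (shift-cong≤ n (λ j _ → shifts-⋆ i r f j)) (shift-⋆ r (shifts i f) n)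

shifts-⋆ˡ : ∀ i f g n → (shifts i f ⋆ g) n ≡ shifts i (f ⋆ g) n
shifts-⋆ˡ i f g n = trans (⋆-comm (shifts i f) g n) (trans (sym (shifts-⋆ i g f n)) (shifts-cong i (⋆-comm g f) n))

shift-⊗ : ∀ x f n → shift (λ j → x ⊗ f j) n ≡ x ⊗ shift f n
shift-⊗ x f zero    = sym (⊗-zeroʳ x)
shift-⊗ x f (suc n) = refl

shifts-⊗ : ∀ i x f n → shifts i (λ j → x ⊗ f j) n ≡ x ⊗ shifts i f n
shifts-⊗ zero    x f n = refl
shifts-⊗ (suc i) x f n = trans (shift-cong≤ n (λ j _ → shifts-⊗ i x f j)) (shift-⊗ x (shifts i f) n)

shifts-zero : ∀ i n → shifts i (λ _ → 0ℚ) n ≡ 0ℚ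
shifts-zero zero    n       = refl
shifts-zero (suc i) zero    = refl
shifts-zero (suc i) (suc n) = shifts-zero i n

shifts-⊕ : ∀ i f g n → shifts i (λ j → f j ⊕ g j) n ≡ shifts i f n ⊕ shifts i g n
shifts-⊕ zero    f g n       = refl
shifts-⊕ (suc i) f g zero    = sym (⊕-identityˡ 0ℚ)
shifts-⊕ (suc i) f g (suc n) = shifts-⊕ i f g n

shifts-∑ : ∀ i B (f : ℕ → Series) n → shifts i (λ j → ∑ B (λ m → f m j)) n ≡ ∑ B (λ m → shifts i (f m) n)
shifts-∑ i zero    f n = shifts-zero i n
shifts-∑ i (suc B) f n = trans (shifts-⊕ i (f 0) (λ j → ∑ B (λ m → f (suc m) j)) n) (cong (shifts i (f 0) n ⊕_) (shifts-∑ i B (f ∘ suc) n))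

shifts-large : ∀ i f n → n < i → shifts i f n ≡ 0ℚ
shifts-large (suc i) f zero    _         = refl
shifts-large (suc i) f (suc n) (s≤s n<i) = shifts-large i f n n<i

-- The guard is the one in the enumeration of partitions, so that a block of m parts equal to k
-- corresponds to multiplication by the mk-th power of t.
shifts-≤ᵇ : ∀ i f n → shifts i f n ≡ (if i ≤ᵇ n then f (n ∸ i) else 0ℚ)
shifts-≤ᵇ zero          f n       = refl
shifts-≤ᵇ (suc i)       f zero    = refl
shifts-≤ᵇ (suc zero)    f (suc n) = refl
shifts-≤ᵇ (suc (suc i)) f (suc n) = shifts-≤ᵇ (suc i) f n

shifts-δ : ∀ k x → shifts k (λ j → x ⊗ δ j) k ≡ x
shifts-δ zero    x = ⊗-identityʳ x
shifts-δ (suc k) x = shifts-δ k x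

shifts-δ-< : ∀ k x j → k < j → shifts k (λ j → x ⊗ δ j) j ≡ 0ℚ
shifts-δ-< zero    x (suc j) _         = ⊗-zeroʳ x
shifts-δ-< (suc k) x (suc j) (s≤s k<j) = shifts-δ-< k x j k<j

D-shift : ∀ f n → D (shift f) n ≡ shift (D f) n ⊕ shift f n
D-shift f zero    = trans (⊗-zeroʳ _) (sym (⊕-identityˡ 0ℚ))
D-shift f (suc n) = trans (cong (_⊗ f n) (ι-suc n)) (trans (⊗-distribʳ _ _ _)
  (trans (cong (_⊕ ι n ⊗ f n) (⊗-identityˡ _)) (⊕-comm _ _)))

D-shifts : ∀ i f n → D (shifts i f) n ≡ shifts i (D f) n ⊕ ι i ⊗ shifts i f n
D-shifts zero    f n = sym (trans (cong (D f n ⊕_) (⊗≡0ˡ ι-0)) (⊕-identityʳ _))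
D-shifts (suc i) f n = begin
  D (shift (shifts i f)) n
    ≡⟨ D-shift (shifts i f) n ⟩
  shift (D (shifts i f)) n ⊕ shift (shifts i f) n
    ≡⟨ cong (_⊕ shift (shifts i f) n) (trans (shift-cong≤ n (λ j _ → D-shifts i f j))
         (trans (shifts-⊕ 1 (shifts i (D f)) (λ j → ι i ⊗ shifts i f j) n) (cong (shift (shifts i (D f)) n ⊕_) (shift-⊗ (ι i) (shifts i f) n)))) ⟩
  (shift (shifts i (D f)) n ⊕ ι i ⊗ shift (shifts i f) n) ⊕ shift (shifts i f) n
    ≡⟨ ⊕-assoc _ _ _ ⟩
  shift (shifts i (D f)) n ⊕ (ι i ⊗ shift (shifts i f) n ⊕ shift (shifts i f) n)
    ≡⟨ cong (shift (shifts i (D f)) n ⊕_) (trans (cong (_⊗ shift (shifts i f) n) (ι-suc i))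
         (trans (⊗-distribʳ _ _ _) (trans (cong (_⊕ ι i ⊗ shift (shifts i f) n) (⊗-identityˡ _)) (⊕-comm _ _)))) ⟨
  shift (shifts i (D f)) n ⊕ ι (suc i) ⊗ shift (shifts i f) n ∎

-- Multiplication by exp(y tᵏ), where k = suc K.
module ExpMonomial (K : ℕ) (y : ℚ) where

  k : ℕ
  k = suc K

  c : ℕ → ℚ
  c m = κ (m !) ⊗ pow y m

  c-suc : ∀ m → ι (suc m) ⊗ c (suc m) ≡ y ⊗ c m
  c-suc m = trans (sym (⊗-assoc _ _ _)) (trans (cong (_⊗ pow y (suc m)) (suc⊗κ! m)) (⊗-swapˡ _ _ _))

  partial : ℕ → Series → Series
  partial B f n = ∑ B (λ m → c m ⊗ shifts (m * k) f n)

  mul : Series → Series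
  mul f n = partial (suc n) f n

  -- Terms with m > n are shifted past n because k ≥ 1. `mul` has its own cut-off for each
  -- coefficient; a common cut-off `B` allows the sum over m to be exchanged with `⋆` and with
  -- shifts.
  partial≡mul : ∀ B f n → n < B → partial B f n ≡ mul f n
  partial≡mul B f n n<B = begin
    partial B f n                                 ≡⟨ cong (λ b → partial b f n) (ℕP.m+[n∸m]≡n n<B) ⟨
    partial (suc n + (B ∸ suc n)) f n             ≡⟨ ∑-split (suc n) (B ∸ suc n) (λ m → c m ⊗ shifts (m * k) f n) ⟩
    mul f n ⊕ ∑ (B ∸ suc n) (λ i → c (suc n + i) ⊗ shifts ((suc n + i) * k) f n)
      ≡⟨ cong (mul f n ⊕_) (∑-zero (B ∸ suc n) (λ i _ → ⊗≡0ʳ (shifts-large ((suc n + i) * k) f n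
           (ℕP.≤-trans (ℕP.m≤m+n (suc n) i) (ℕP.m≤m*n (suc n + i) k))))) ⟩
    mul f n ⊕ 0ℚ                                  ≡⟨ ⊕-identityʳ _ ⟩
    mul f n                                       ∎

  mul-0 : ∀ f → mul f 0 ≡ f 0
  mul-0 f = trans (⊕-identityʳ _) (trans (cong (_⊗ f 0) (trans (⊗-identityʳ _) κ-1)) (⊗-identityˡ _))

  mul-⋆ : ∀ r f n → mul (r ⋆ f) n ≡ (r ⋆ mul f) n
  mul-⋆ r f n = begin
    ∑ (suc n) (λ m → c m ⊗ shifts (m * k) (r ⋆ f) n)
      ≡⟨ ∑-cong (suc n) (λ m _ → trans (cong (c m ⊗_) (shifts-⋆ (m * k) r f n)) (sym (⋆-⊗ʳ (c m) r (shifts (m * k) f) n))) ⟩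
    ∑ (suc n) (λ m → (r ⋆ (λ j → c m ⊗ shifts (m * k) f j)) n)
      ≡⟨ ⋆-∑ʳ r (suc n) (λ m j → c m ⊗ shifts (m * k) f j) n ⟨
    (r ⋆ partial (suc n) f) n
      ≡⟨ ⋆-cong≤ {r} n (λ _ _ → refl) (λ j j≤n → partial≡mul (suc n) f j (s≤s j≤n)) ⟩
    (r ⋆ mul f) n ∎

  -- The product rule with t d/dt exp(y tᵏ) = k y tᵏ exp(y tᵏ). The factor tᵐᵏ contributes mk; since
  -- (m + 1) c (m + 1) = y c m, re-indexing pulls out k y tᵏ.
  D-mul : ∀ f n → D (mul f) n ≡ mul (D f) n ⊕ (shifts k (λ j → (ι k ⊗ y) ⊗ δ j) ⋆ mul f) n
  D-mul f n = begin
    ι n ⊗ ∑ (suc n) (λ m → c m ⊗ shifts (m * k) f n)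
      ≡⟨ ∑-⊗ˡ (suc n) (ι n) (λ m → c m ⊗ shifts (m * k) f n) ⟨
    ∑ (suc n) (λ m → ι n ⊗ (c m ⊗ shifts (m * k) f n))
      ≡⟨ ∑-cong (suc n) (λ m _ → trans (⊗-swapˡ _ _ _) (trans (cong (c m ⊗_) (D-shifts (m * k) f n)) (⊗-distribˡ _ _ _))) ⟩
    ∑ (suc n) (λ m → c m ⊗ shifts (m * k) (D f) n ⊕ c m ⊗ (ι (m * k) ⊗ shifts (m * k) f n))
      ≡⟨ ∑-⊕ (suc n) (λ m → c m ⊗ shifts (m * k) (D f) n) (λ m → c m ⊗ (ι (m * k) ⊗ shifts (m * k) f n)) ⟩
    mul (D f) n ⊕ ∑ (suc n) (λ m → c m ⊗ (ι (m * k) ⊗ shifts (m * k) f n))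
      ≡⟨ cong (mul (D f) n ⊕_) (trans (cong₂ _⊕_ (⊗≡0ʳ (⊗≡0ˡ ι-0)) refl) (⊕-identityˡ _)) ⟩
    mul (D f) n ⊕ ∑ n (λ m → c (suc m) ⊗ (ι (suc m * k) ⊗ shifts (suc m * k) f n))
      ≡⟨ cong (mul (D f) n ⊕_) (∑-cong n (λ m _ → step m)) ⟩
    mul (D f) n ⊕ ∑ n (λ m → (ι k ⊗ y) ⊗ shifts k (λ j → c m ⊗ shifts (m * k) f j) n)
      ≡⟨ cong (mul (D f) n ⊕_) (trans (∑-⊗ˡ n (ι k ⊗ y) _) (cong ((ι k ⊗ y) ⊗_) (sym (shifts-∑ k n (λ m j → c m ⊗ shifts (m * k) f j) n)))) ⟩
    mul (D f) n ⊕ (ι k ⊗ y) ⊗ shifts k (partial n f) n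
      -- A shift by k ≥ 1 reads only indices below n, for which the cut-off n is large enough.
      ≡⟨ cong (λ x → mul (D f) n ⊕ (ι k ⊗ y) ⊗ x) (shift-cong≤ n (λ j j<n → shifts-cong≤ K j (λ l l≤j → partial≡mul n f l (ℕP.≤-<-trans l≤j j<n)))) ⟩
    mul (D f) n ⊕ (ι k ⊗ y) ⊗ shifts k (mul f) n
      ≡⟨ cong (mul (D f) n ⊕_) (trans (shifts-⋆ˡ k (λ j → (ι k ⊗ y) ⊗ δ j) (mul f) n)
           (trans (shifts-cong k (λ j → trans (⋆-⊗ˡ (ι k ⊗ y) δ (mul f) j) (cong ((ι k ⊗ y) ⊗_) (⋆-identityˡ (mul f) j))) n)
             (shifts-⊗ k (ι k ⊗ y) (mul f) n))) ⟨
    mul (D f) n ⊕ (shifts k (λ j → (ι k ⊗ y) ⊗ δ j) ⋆ mul f) n ∎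
    where
    opaque
      unfolding _⊕_
      regroup : ∀ a b d s → a ⊗ ((b ⊗ d) ⊗ s) ≡ ((b ⊗ a) ⊗ d) ⊗ s
      regroup = solve-∀ ℚ-ring
      regroup′ : ∀ y c d s → ((y ⊗ c) ⊗ d) ⊗ s ≡ (d ⊗ y) ⊗ (c ⊗ s)
      regroup′ = solve-∀ ℚ-ring
    step : ∀ m → c (suc m) ⊗ (ι (suc m * k) ⊗ shifts (suc m * k) f n) ≡ (ι k ⊗ y) ⊗ shifts k (λ j → c m ⊗ shifts (m * k) f j) n
    step m = begin
      c (suc m) ⊗ (ι (suc m * k) ⊗ shifts (suc m * k) f n)
        ≡⟨ cong₂ (λ x z → c (suc m) ⊗ (x ⊗ z)) (ι-* (suc m) k) (shifts-+ k (m * k) f n) ⟩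
      c (suc m) ⊗ ((ι (suc m) ⊗ ι k) ⊗ shifts k (shifts (m * k) f) n)
        ≡⟨ regroup _ _ _ _ ⟩
      ((ι (suc m) ⊗ c (suc m)) ⊗ ι k) ⊗ shifts k (shifts (m * k) f) n
        ≡⟨ cong (λ x → (x ⊗ ι k) ⊗ shifts k (shifts (m * k) f) n) (c-suc m) ⟩
      ((y ⊗ c m) ⊗ ι k) ⊗ shifts k (shifts (m * k) f) n
        ≡⟨ regroup′ _ _ _ _ ⟩
      (ι k ⊗ y) ⊗ (c m ⊗ shifts k (shifts (m * k) f) n)
        ≡⟨ cong ((ι k ⊗ y) ⊗_) (shifts-⊗ k (c m) (shifts (m * k) f) n) ⟨
      (ι k ⊗ y) ⊗ shifts k (λ j → c m ⊗ shifts (m * k) f j) n ∎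

-- The truncated exponential exp(∑_{k ≤ K} q k tᵏ) and its logarithmic derivative.
truncExp truncLog : (ℕ → ℚ) → ℕ → Series
truncExp q zero    = δ
truncExp q (suc K) = ExpMonomial.mul K (q (suc K)) (truncExp q K)
truncLog q zero    j = 0ℚ
truncLog q (suc K) j = truncLog q K j ⊕ shifts (suc K) (λ i → (ι (suc K) ⊗ q (suc K)) ⊗ δ i) j

truncExp-isExp : ∀ q K → IsExp (truncLog q K) (truncExp q K)
truncExp-isExp q zero = record
  { r-0 = refl ; G-0 = refl
  ; D-G = λ { zero → trans (D-0 δ) (sym (⋆-zeroˡ δ {λ _ → 0ℚ} (λ _ → refl) 0))
            ; (suc n) → trans (⊗-zeroʳ _) (sym (⋆-zeroˡ δ {λ _ → 0ℚ} (λ _ → refl) (suc n))) } }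
truncExp-isExp q (suc K) = record
  { r-0 = trans (⊕-identityʳ _) (IsExp.r-0 E)
  ; G-0 = trans (mul-0 (truncExp q K)) (IsExp.G-0 E)
  ; D-G = λ n → trans (D-mul (truncExp q K) n) (trans
      (cong (_⊕ (shifts k (λ j → (ι k ⊗ q k) ⊗ δ j) ⋆ mul (truncExp q K)) n)
        (trans (∑-cong (suc n) (λ m _ → cong (c m ⊗_) (shifts-cong (m * k) (IsExp.D-G E) n))) (mul-⋆ (truncLog q K) (truncExp q K) n)))
      (sym (⋆-distribʳ (truncLog q K) (shifts k (λ j → (ι k ⊗ q k) ⊗ δ j)) (mul (truncExp q K)) n))) }
  where
  open ExpMonomial K (q (suc K))
  E = truncExp-isExp q K

truncLog-large : ∀ q K j → K < j → truncLog q K j ≡ 0ℚ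
truncLog-large q zero    j _   = refl
truncLog-large q (suc K) j K<j = trans
  (cong₂ _⊕_ (truncLog-large q K j (ℕP.<⇒≤ K<j)) (shifts-δ-< (suc K) _ j K<j)) (⊕-identityˡ 0ℚ)

truncLog-value : ∀ q K j → j ≤ K → truncLog q K j ≡ ι j ⊗ q j
truncLog-value q zero    zero    _   = sym (⊗≡0ˡ ι-0)
truncLog-value q (suc K) j       j≤K with j ℕP.≟ suc K
... | yes refl = trans (cong₂ _⊕_ (truncLog-large q K j ℕP.≤-refl) (shifts-δ (suc K) _)) (⊕-identityˡ _)
... | no j≢K   = trans (cong₂ _⊕_ (truncLog-value q K j (ℕP.≤-pred j<K)) (shifts-large (suc K) _ j j<K)) (⊕-identityʳ _)
  where
  j<K = ℕP.≤∧≢⇒< j≤K j≢K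

-- The factor ∏ Lᵢ^mᵢ / mᵢ! with which p_μ enters exp(∑ L k p_k tᵏ).
weight : (ℕ → ℚ) → ℕ → List ℕ → ℚ
weight L K μ = ∏ K (λ i → κ (mult (suc i) μ !) ⊗ pow (L (suc i)) (mult (suc i) μ))

weight-block : ∀ L {K n μ} m → PartLE K n μ →
  weight L (suc K) (replicate m (suc K) ++ μ) ≡ weight L K μ ⊗ (κ (m !) ⊗ pow (L (suc K)) m)
weight-block L {K} {n} {μ} m p = trans (∏-last K _) (cong₂ _⊗_
  (∏-cong K (λ i i<K → cong (λ e → κ (e !) ⊗ pow (L (suc i)) e)
    (mult-replicate-≢ m (λ eq → ℕP.<⇒≢ i<K (sym (ℕP.suc-injective eq))) μ)))
  (cong (λ e → κ (e !) ⊗ pow (L (suc K)) e)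
    (trans (mult-replicate m (suc K) μ) (trans (cong (m +_) (mult-large p ℕP.≤-refl)) (ℕP.+-identityʳ m)))))

-- Expanding the factor exp(L k p k tᵏ) with k = K + 1 amounts to choosing the multiplicity m of the
-- part k; the remaining parts are at most K.
∑ᵖ-weight : ∀ L p K n → ∑ᵖ K n (λ μ → weight L K μ ⊗ ∏ˡ p μ) ≡ truncExp (λ j → L j ⊗ p j) K n
∑ᵖ-weight L p zero    zero    = trans (⊕-identityʳ _) (⊗-identityˡ 1ℚ)
∑ᵖ-weight L p zero    (suc n) = refl
∑ᵖ-weight L p (suc K) n = trans (∑ᵖ-suc K n _) (∑-cong (suc n) (λ m _ → term m))
  where
  y : ℚ
  y = L (suc K) ⊗ p (suc K)
  opaque
    unfolding _⊕_
    regroup : ∀ w f a b q → (w ⊗ (f ⊗ a)) ⊗ (b ⊗ q) ≡ (f ⊗ (a ⊗ b)) ⊗ (w ⊗ q)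
    regroup = solve-∀ ℚ-ring
  part-term : ∀ m n′ → ∑ᵖ K n′ (λ μ → weight L (suc K) (replicate m (suc K) ++ μ) ⊗ ∏ˡ p (replicate m (suc K) ++ μ))
    ≡ ExpMonomial.c K y m ⊗ truncExp (λ j → L j ⊗ p j) K n′
  part-term m n′ = begin
    ∑ᵖ K n′ (λ μ → weight L (suc K) (replicate m (suc K) ++ μ) ⊗ ∏ˡ p (replicate m (suc K) ++ μ))
      ≡⟨ ∑ᵖ-cong K n′ (λ μ μ-part → trans (cong₂ _⊗_ (weight-block L m μ-part) (∏ˡ-replicate p m (suc K) μ)) (trans (regroup _ _ _ _ _)
           (cong (λ x → (κ (m !) ⊗ x) ⊗ (weight L K μ ⊗ ∏ˡ p μ)) (sym (pow-⊗ (L (suc K)) (p (suc K)) m))))) ⟩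
    ∑ᵖ K n′ (λ μ → ExpMonomial.c K y m ⊗ (weight L K μ ⊗ ∏ˡ p μ))
      ≡⟨ ∑ˡ-⊗ˡ (ExpMonomial.c K y m) (λ μ → weight L K μ ⊗ ∏ˡ p μ) (partsLE K n′) ⟩
    ExpMonomial.c K y m ⊗ ∑ᵖ K n′ (λ μ → weight L K μ ⊗ ∏ˡ p μ)
      ≡⟨ cong (ExpMonomial.c K y m ⊗_) (∑ᵖ-weight L p K n′) ⟩
    ExpMonomial.c K y m ⊗ truncExp (λ j → L j ⊗ p j) K n′ ∎
  if-⊗ : ∀ x b {z} → (if b then x ⊗ z else 0ℚ) ≡ x ⊗ (if b then z else 0ℚ)
  if-⊗ x true  = refl
  if-⊗ x false = sym (⊗-zeroʳ x)
  term : ∀ m → (if m * suc K ≤ᵇ n then ∑ᵖ K (n ∸ m * suc K) (λ μ → weight L (suc K) (replicate m (suc K) ++ μ) ⊗ ∏ˡ p (replicate m (suc K) ++ μ)) else 0ℚ)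
    ≡ ExpMonomial.c K y m ⊗ shifts (m * suc K) (truncExp (λ j → L j ⊗ p j) K) n
  term m = trans (if-cong (m * suc K ≤ᵇ n) (λ _ → part-term m (n ∸ m * suc K)))
    (trans (if-⊗ (ExpMonomial.c K y m) (m * suc K ≤ᵇ n)) (cong (ExpMonomial.c K y m ⊗_) (sym (shifts-≤ᵇ (m * suc K) _ n))))

∑ᵖ-weight-exp : ∀ L p {G} → IsExp (λ j → ι j ⊗ (L j ⊗ p j)) G → ∀ n → ∑ᵖ n n (λ μ → weight L n μ ⊗ ∏ˡ p μ) ≡ G n
∑ᵖ-weight-exp L p E n = trans (∑ᵖ-weight L p n n)
  (exp-unique n (truncExp-isExp _ n) E (truncLog-value _ n) n ℕP.≤-refl)

L : ℕ → ℚ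
L k = ∣ φfactor k ∣

∣pow∣ : ∀ x k → ∣ pow x k ∣ ≡ pow ∣ x ∣ k
∣pow∣ x zero    = refl
∣pow∣ x (suc k) = trans (∣∣-⊗ _ _) (cong (∣ x ∣ ⊗_) (∣pow∣ x k))

∣∏∣ : ∀ n f → ∣ ∏ n f ∣ ≡ ∏ n (λ i → ∣ f i ∣)
∣∏∣ zero    f = refl
∣∏∣ (suc n) f = trans (∣∣-⊗ _ _) (cong (∣ f 0 ∣ ⊗_) (∣∏∣ n (f ∘ suc)))

∣φ∣ : ∀ n μ → ∣ φ n μ ∣ ≡ ι ((2 * n) !) ⊗ weight L n μ
∣φ∣ n μ = begin
  ∣ φ n μ ∣
    ≡⟨ cong ∣_∣ (trans (⊗-def _ _) (cong₂ _⊗_ (ι-def _) (product-upTo n _))) ⟩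
  ∣ ι ((2 * n) !) ⊗ ∏ n (λ i → recipℕ (mult (suc i) μ !) *ℚ (φfactor (suc i) ^ℚ mult (suc i) μ)) ∣
    ≡⟨ trans (∣∣-⊗ _ _) (cong₂ _⊗_ (∣ι∣ ((2 * n) !)) (∣∏∣ n _)) ⟩
  ι ((2 * n) !) ⊗ ∏ n (λ i → ∣ recipℕ (mult (suc i) μ !) *ℚ (φfactor (suc i) ^ℚ mult (suc i) μ) ∣)
    ≡⟨ cong (ι ((2 * n) !) ⊗_) (∏-cong n (λ i _ → factor i)) ⟩
  ι ((2 * n) !) ⊗ weight L n μ ∎
  where
  factor : ∀ i → ∣ recipℕ (mult (suc i) μ !) *ℚ (φfactor (suc i) ^ℚ mult (suc i) μ) ∣
    ≡ κ (mult (suc i) μ !) ⊗ pow (L (suc i)) (mult (suc i) μ)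
  factor i = trans (cong ∣_∣ (trans (⊗-def _ _) (cong₂ _⊗_ (κ-def _) (^ℚ≡pow (φfactor (suc i)) (mult (suc i) μ)))))
    (trans (∣∣-⊗ _ _) (cong₂ _⊗_ (∣κ∣ (mult (suc i) μ !)) (∣pow∣ (φfactor (suc i)) (mult (suc i) μ))))

-- `G` is left open: it is sec √t for one variable equal to 1, and `expOf` for copies of an
-- alphabet. The (2n)! in φ cancels against its reciprocal in `A`.
A-exp : ∀ n {N} (x : Vec ℚ N) {G} → IsExp (λ j → ι j ⊗ (L j ⊗ pSum j x)) G → A n x ≡ G n
A-exp n x {G} E = begin
  A n x
    ≡⟨ trans (⊗-def _ _) (cong₂ _⊗_ (κ-def _) (sum-map _ (partitions n))) ⟩
  κ F ⊗ ∑ᵖ n n (λ μ → ∣ φ n μ ∣ *ℚ pPart μ x)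
    ≡⟨ cong (κ F ⊗_) (∑ˡ-cong (λ μ → trans (⊗-def _ _) (trans (cong₂ _⊗_ (∣φ∣ n μ) (product-map (λ k → pSum k x) μ)) (⊗-assoc _ _ _))) (partitions n)) ⟩
  κ F ⊗ ∑ᵖ n n (λ μ → ι F ⊗ (weight L n μ ⊗ ∏ˡ (λ k → pSum k x) μ))
    ≡⟨ cong (κ F ⊗_) (∑ˡ-⊗ˡ (ι F) (λ μ → weight L n μ ⊗ ∏ˡ (λ k → pSum k x) μ) (partitions n)) ⟩
  κ F ⊗ (ι F ⊗ ∑ᵖ n n (λ μ → weight L n μ ⊗ ∏ˡ (λ k → pSum k x) μ))
    ≡⟨ trans (sym (⊗-assoc _ _ _)) (trans (cong₂ _⊗_ (trans (⊗-comm _ _) (ι⊗κ (ℕP.1≤n! (2 * n)))) (∑ᵖ-weight-exp L (λ k → pSum k x) E n)) (⊗-identityˡ _)) ⟩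
  G n ∎
  where
  F : ℕ
  F = (2 * n) !

-- Copies of an alphabet

-- Coefficient n is taken from the product truncated at n, which the later factors leave unchanged.
expOf : Series → Series
expOf r n = truncExp (λ j → κ j ⊗ r j) n n

expOf-isExp : ∀ {r} → r 0 ≡ 0ℚ → IsExp r (expOf r)
expOf-isExp {r} r0 = record { r-0 = r0 ; G-0 = refl ; D-G = λ n → trans (IsExp.D-G (truncExp-isExp q n) n)
  (⋆-cong≤ {truncLog q n} {r} {truncExp q n} {expOf r} n
    (λ j j≤n → trans (truncLog-value q n j j≤n) (ι⊗κ⊗r j))
    (λ j j≤n → exp-unique j (truncExp-isExp q n) (truncExp-isExp q j)
      (λ i i≤j → trans (truncLog-value q n i (ℕP.≤-trans i≤j j≤n)) (sym (truncLog-value q j i i≤j))) j ℕP.≤-refl)) }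
  where
  q : Series
  q j = κ j ⊗ r j
  ι⊗κ⊗r : ∀ j → ι j ⊗ q j ≡ r j
  ι⊗κ⊗r zero    = trans (⊗≡0ˡ ι-0) (sym r0)
  ι⊗κ⊗r (suc j) = trans (sym (⊗-assoc _ _ _)) (trans (cong (_⊗ r (suc j)) (ι⊗κ-suc j)) (⊗-identityˡ _))

isExp-⋆ : ∀ {r r′ G G′} → IsExp r G → IsExp r′ G′ → IsExp (λ j → r j ⊕ r′ j) (G ⋆ G′)
isExp-⋆ {r} {r′} {G} {G′} E E′ = record
  { r-0 = trans (cong₂ _⊕_ (IsExp.r-0 E) (IsExp.r-0 E′)) (⊕-identityˡ 0ℚ)
  ; G-0 = trans (cong₂ _⊗_ (IsExp.G-0 E) (IsExp.G-0 E′)) (⊗-identityˡ 1ℚ)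
  ; D-G = λ n → begin
      D (G ⋆ G′) n
        ≡⟨ D-⋆ G G′ n ⟩
      (D G ⋆ G′) n ⊕ (G ⋆ D G′) n
        ≡⟨ cong₂ _⊕_ (trans (⋆-congʳ G′ (IsExp.D-G E) n) (⋆-assoc r G G′ n))
             (trans (⋆-congˡ G (IsExp.D-G E′) n) (trans (sym (⋆-assoc G r′ G′ n))
               (trans (⋆-congʳ G′ (⋆-comm G r′) n) (⋆-assoc r′ G G′ n)))) ⟩
      (r ⋆ (G ⋆ G′)) n ⊕ (r′ ⋆ (G ⋆ G′)) n
        ≡⟨ ⋆-distribʳ r r′ (G ⋆ G′) n ⟨
      ((λ j → r j ⊕ r′ j) ⋆ (G ⋆ G′)) n ∎ }

isExp-congʳ : ∀ {r G G′} → (∀ n → G n ≡ G′ n) → IsExp r G → IsExp r G′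
isExp-congʳ {r} p E = record { r-0 = IsExp.r-0 E ; G-0 = trans (sym (p 0)) (IsExp.G-0 E)
  ; D-G = λ n → trans (cong (ι n ⊗_) (sym (p n))) (trans (IsExp.D-G E n) (⋆-congˡ r p n)) }

-- The power sum of index 0 is the number of variables; it is dropped because a logarithmic
-- derivative t G′ / G has no constant term.
positivePart : Series → Series
positivePart f zero    = 0ℚ
positivePart f (suc j) = f (suc j)

-- The series 1 / (1 - y t) has logarithmic derivative y t / (1 - y t); the computation rests on the
-- coefficients (n + 1) yⁿ of its square.
geometric-isExp : ∀ y → IsExp (positivePart (pow y)) (pow y)
geometric-isExp y = record { r-0 = refl ; G-0 = refl ; D-G = λ
  { zero    → trans (D-0 (pow y)) (sym (⊗-zeroˡ _))
  ; (suc n) → sym (trans (cong₂ _⊕_ (⊗-zeroˡ _) (trans (⋆-⊗ˡ y (pow y) (pow y) n) (trans (cong (y ⊗_) (square n)) (⊗-swapˡ _ _ _)))) (⊕-identityˡ _)) } }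
  where
  square : ∀ n → (pow y ⋆ pow y) n ≡ ι (suc n) ⊗ pow y n
  square zero    = cong (_⊗ 1ℚ) (sym ι-1)
  square (suc n) = begin
    1ℚ ⊗ pow y (suc n) ⊕ ((λ j → y ⊗ pow y j) ⋆ pow y) n    ≡⟨ cong (1ℚ ⊗ pow y (suc n) ⊕_) (⋆-⊗ˡ y (pow y) (pow y) n) ⟩
    1ℚ ⊗ pow y (suc n) ⊕ y ⊗ (pow y ⋆ pow y) n              ≡⟨ cong (1ℚ ⊗ pow y (suc n) ⊕_) (trans (cong (y ⊗_) (square n)) (⊗-swapˡ _ _ _)) ⟩
    1ℚ ⊗ pow y (suc n) ⊕ ι (suc n) ⊗ pow y (suc n)          ≡⟨ ⊗-distribʳ _ _ _ ⟨
    (1ℚ ⊕ ι (suc n)) ⊗ pow y (suc n)                        ≡⟨ cong (_⊗ pow y (suc n)) (ι-suc (suc n)) ⟨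
    ι (suc (suc n)) ⊗ pow y (suc n)                         ∎

pSum-∷ : ∀ k {N} y (x : Vec ℚ N) → pSum k (y ∷ x) ≡ pow y k ⊕ pSum k x
pSum-∷ k y x = trans (⊕-def _ _) (cong (_⊕ pSum k x) (^ℚ≡pow y k))

pSum-++ : ∀ k {M N} (x : Vec ℚ M) (y : Vec ℚ N) → pSum k (x ++ᵛ y) ≡ pSum k x ⊕ pSum k y
pSum-++ k []      y = sym (⊕-identityˡ _)
pSum-++ k (z ∷ x) y = trans (pSum-∷ k z (x ++ᵛ y)) (trans (cong (pow z k ⊕_) (pSum-++ k x y))
  (trans (sym (⊕-assoc _ _ _)) (cong (_⊕ pSum k y) (sym (pSum-∷ k z x)))))

copies : ∀ a {N} → Vec ℚ N → Vec ℚ (a * N)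
copies zero    y = []
copies (suc a) y = y ++ᵛ copies a y

pSum-copies : ∀ k a {N} (y : Vec ℚ N) → pSum k (copies a y) ≡ ι a ⊗ pSum k y
pSum-copies k zero    y = sym (⊗≡0ˡ ι-0)
pSum-copies k (suc a) y = begin
  pSum k (y ++ᵛ copies a y)             ≡⟨ pSum-++ k y (copies a y) ⟩
  pSum k y ⊕ pSum k (copies a y)        ≡⟨ cong₂ _⊕_ (sym (⊗-identityˡ _)) (pSum-copies k a y) ⟩
  1ℚ ⊗ pSum k y ⊕ ι a ⊗ pSum k y        ≡⟨ ⊗-distribʳ _ _ _ ⟨
  (1ℚ ⊕ ι a) ⊗ pSum k y                 ≡⟨ cong (_⊗ pSum k y) (ι-suc a) ⟨
  ι (suc a) ⊗ pSum k y                  ∎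

hSum-∷ : ∀ {N} y (x : Vec ℚ N) k → hSum k (y ∷ x) ≡ (pow y ⋆ (λ j → hSum j x)) k
hSum-∷ y x k = trans (unfold k) (trans (⊛≡⋆ (λ j → y ^ℚ j) (λ j → hSum j x) k) (⋆-congʳ (λ j → hSum j x) (^ℚ≡pow y) k))
  where
  unfold : ∀ k → hSum k (y ∷ x) ≡ ((λ j → y ^ℚ j) ⊛ (λ j → hSum j x)) k
  unfold zero    = refl
  unfold (suc k) = refl

powerSums : ∀ {N} → Vec ℚ N → Series
powerSums x = positivePart (λ j → pSum j x)

-- Newton's identities n hₙ = ∑ pⱼ hₙ₋ⱼ, obtained by adding the logarithmic derivatives of the
-- factors 1 / (1 - y t).
hSum-isExp : ∀ {N} (x : Vec ℚ N) → IsExp (powerSums x) (λ k → hSum k x)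
hSum-isExp []      = isExp-congʳ (λ { zero → refl ; (suc n) → refl })
  (exp-cong (λ { zero → refl ; (suc j) → refl }) (truncExp-isExp (λ _ → 0ℚ) 0))
hSum-isExp (y ∷ x) = isExp-congʳ (λ k → sym (hSum-∷ y x k))
  (exp-cong (λ { zero → ⊕-identityˡ 0ℚ ; (suc j) → sym (pSum-∷ (suc j) y x) }) (isExp-⋆ (geometric-isExp y) (hSum-isExp x)))

sumP : ∀ {A : Set} → (A → Poly) → List A → Poly
sumP f []       = []
sumP f (x ∷ xs) = addP (f x) (sumP f xs)

evalP-sum : ∀ {A : Set} (f : A → Poly) xs a → evalP (sumP f xs) a ≡ ∑ˡ (λ x → evalP (f x) a) xs
evalP-sum f []       a = refl
evalP-sum f (x ∷ xs) a = trans (evalP-add (f x) (sumP f xs) a) (cong (evalP (f x) a ⊕_) (evalP-sum f xs a))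

coef-sum : ∀ {A : Set} (f : A → Poly) xs d → coef (sumP f xs) d ≡ ∑ˡ (λ x → coef (f x) d) xs
coef-sum f []       d = refl
coef-sum f (x ∷ xs) d = trans (coef-add (f x) (sumP f xs) d) (cong (coef (f x) d ⊕_) (coef-sum f xs d))

prodP : (ℕ → Poly) → List ℕ → Poly
prodP f []      = 1ℚ ∷ []
prodP f (k ∷ μ) = mulP (f k) (prodP f μ)

evalP-prod : ∀ f μ a → evalP (prodP f μ) a ≡ ∏ˡ (λ k → evalP (f k) a) μ
evalP-prod f []      a = trans (cong (1ℚ ⊕_) (⊗-zeroʳ a)) (⊕-identityʳ 1ℚ)
evalP-prod f (k ∷ μ) a = trans (evalP-mul (f k) (prodP f μ) a) (cong (evalP (f k) a ⊗_) (evalP-prod f μ a))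

module Agree (p q : Poly) (agree : ∀ a → evalP p (ι a) ≡ evalP q (ι a)) where
  difference : Poly
  difference = addP p (scaleP (⊖ 1ℚ) q)

  difference-coef : ∀ d → coef difference d ≡ 0ℚ
  difference-coef = poly-identity difference (λ a → trans (evalP-add p _ (ι a))
    (trans (cong₂ _⊕_ (agree a) (trans (evalP-scale (⊖ 1ℚ) q (ι a)) (⊖1⊗ _))) (x⊕⊖x _)))

  coef-agree : ∀ d → coef p d ≡ coef q d
  coef-agree d = x⊕⊖y≡0⇒x≡y (trans (cong (coef p d ⊕_) (trans (sym (⊖1⊗ _)) (sym (coef-scale (⊖ 1ℚ) q d))))
    (trans (sym (coef-add p _ d)) (difference-coef d)))

  evalP-agree : ∀ a → evalP p a ≡ evalP q a
  evalP-agree a = x⊕⊖y≡0⇒x≡y (trans (cong (evalP p a ⊕_) (trans (sym (⊖1⊗ _)) (sym (evalP-scale (⊖ 1ℚ) q a))))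
    (trans (sym (evalP-add p _ a)) (coef≡0⇒evalP≡0 difference difference-coef a)))

hExpansion-def : ∀ n c {N} (x : Vec ℚ N) → hExpansion n c x ≡ ∑ᵖ n n (λ μ → c μ ⊗ ∏ˡ (λ k → hSum k x) μ)
hExpansion-def n c x = trans (sum-map _ (partitions n))
  (∑ˡ-cong (λ μ → trans (⊗-def _ _) (cong (c μ ⊗_) (product-map (λ k → hSum k x) μ))) (partitions n))

-- With ρ = `powerSums y` this is h_k, and with ρ = `tanLog y` it is `A k`, of a copies of y, as a
-- polynomial in a.
hPoly : Series → ℕ → Poly
hPoly ρ k = expPoly ρ (suc k) k

-- The series t d/dt log ∏ sec √(yᵢ t).
tanLog : ∀ {N} → Vec ℚ N → Series
tanLog y j = ι j ⊗ (L j ⊗ pSum j y)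

tanLog-0 : ∀ {N} (y : Vec ℚ N) → tanLog y 0 ≡ 0ℚ
tanLog-0 y = ⊗≡0ˡ ι-0

-- For a copies of y both sides of the expansion are polynomials in a.
module Expansion (n : ℕ) (c : List ℕ → ℚ)
  (expansion : ∀ (N : ℕ) (x : Vec ℚ N) → hExpansion n c x ≡ ℕtoℚ ((2 * n) !) *ℚ A n x)
  {N : ℕ} (y : Vec ℚ N) where

  F : ℚ
  F = ι ((2 * n) !)

  lhsPoly rhsPoly : Poly
  lhsPoly = sumP (λ μ → scaleP (c μ) (prodP (hPoly (powerSums y)) μ)) (partitions n)
  rhsPoly = scaleP F (hPoly (tanLog y) n)

  lhs-eval : ∀ a → evalP lhsPoly a ≡ ∑ᵖ n n (λ μ → c μ ⊗ ∏ˡ (λ k → evalP (hPoly (powerSums y) k) a) μ)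
  lhs-eval a = trans (evalP-sum _ (partitions n) a) (∑ˡ-cong (λ μ → trans (evalP-scale (c μ) (prodP (hPoly (powerSums y)) μ) a)
    (cong (c μ ⊗_) (evalP-prod (hPoly (powerSums y)) μ a))) (partitions n))

  hSum-copies : ∀ a k → hSum k (copies a y) ≡ evalP (hPoly (powerSums y) k) (ι a)
  hSum-copies a k = exp-expPoly {powerSums y} {ι a} refl
    (exp-cong (λ { zero → sym (⊗-zeroʳ _) ; (suc j) → pSum-copies (suc j) a y }) (hSum-isExp (copies a y))) k (suc k) ℕP.≤-refl

  A-copies : ∀ a → A n (copies a y) ≡ evalP (hPoly (tanLog y) n) (ι a)
  A-copies a = trans (A-exp n (copies a y) E) (exp-expPoly (tanLog-0 y)
      (exp-cong (λ j → trans (cong (λ p → ι j ⊗ (L j ⊗ p)) (pSum-copies j a y)) (regroup _ _ _ _)) E) n (suc n) ℕP.≤-refl)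
    where
    opaque
      unfolding _⊕_
      regroup : ∀ i l a p → i ⊗ (l ⊗ (a ⊗ p)) ≡ a ⊗ (i ⊗ (l ⊗ p))
      regroup = solve-∀ ℚ-ring
    E : IsExp (tanLog (copies a y)) (expOf (tanLog (copies a y)))
    E = expOf-isExp (tanLog-0 (copies a y))

  agree : ∀ a → evalP lhsPoly (ι a) ≡ evalP rhsPoly (ι a)
  agree a = begin
    evalP lhsPoly (ι a)
      ≡⟨ lhs-eval (ι a) ⟩
    ∑ᵖ n n (λ μ → c μ ⊗ ∏ˡ (λ k → evalP (hPoly (powerSums y) k) (ι a)) μ)
      ≡⟨ ∑ˡ-cong (λ μ → cong (c μ ⊗_) (∏ˡ-cong (hSum-copies a) μ)) (partitions n) ⟨
    ∑ᵖ n n (λ μ → c μ ⊗ ∏ˡ (λ k → hSum k (copies a y)) μ)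
      ≡⟨ hExpansion-def n c (copies a y) ⟨
    hExpansion n c (copies a y)
      ≡⟨ trans (expansion (a * N) (copies a y)) (trans (⊗-def _ _) (cong₂ _⊗_ (ι-def _) (A-copies a))) ⟩
    F ⊗ evalP (hPoly (tanLog y) n) (ι a)
      ≡⟨ evalP-scale F (hPoly (tanLog y) n) (ι a) ⟨
    evalP rhsPoly (ι a) ∎

  coef-identity : ∀ d → d ≤ n → ∑ᵖ n n (λ μ → c μ ⊗ coef (prodP (hPoly (powerSums y)) μ) d) ≡ F ⊗ expCoef (tanLog y) d n
  coef-identity d d≤n = begin
    ∑ᵖ n n (λ μ → c μ ⊗ coef (prodP (hPoly (powerSums y)) μ) d)
      ≡⟨ ∑ˡ-cong (λ μ → coef-scale (c μ) (prodP (hPoly (powerSums y)) μ) d) (partitions n) ⟨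
    ∑ˡ (λ μ → coef (scaleP (c μ) (prodP (hPoly (powerSums y)) μ)) d) (partitions n)
      ≡⟨ coef-sum _ (partitions n) d ⟨
    coef lhsPoly d
      ≡⟨ Agree.coef-agree lhsPoly rhsPoly agree d ⟩
    coef rhsPoly d
      ≡⟨ coef-scale F (hPoly (tanLog y) n) d ⟩
    F ⊗ coef (hPoly (tanLog y) n) d
      ≡⟨ cong (F ⊗_) (coef-tab (suc n) (λ e → expCoef (tanLog y) e n) d (s≤s d≤n)) ⟩
    F ⊗ expCoef (tanLog y) d n ∎

  eval-identity : ∀ a → ∑ᵖ n n (λ μ → c μ ⊗ ∏ˡ (λ k → evalP (hPoly (powerSums y) k) a) μ) ≡ F ⊗ evalP (hPoly (tanLog y) n) a
  eval-identity a = trans (sym (lhs-eval a)) (trans (Agree.evalP-agree lhsPoly rhsPoly agree a) (evalP-scale F (hPoly (tanLog y) n) a))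

module _ (ρ : Series) where

  coef-hPoly : ∀ k d → d ≤ k → coef (hPoly ρ k) d ≡ expCoef ρ d k
  coef-hPoly k d d≤k = coef-tab (suc k) (λ e → expCoef ρ e k) d (s≤s d≤k)

  coef-hPoly-0 : ∀ {k} → 1 ≤ k → coef (hPoly ρ k) 0 ≡ 0ℚ
  coef-hPoly-0 {suc k} _ = refl

  coef-one : ∀ d → coef (1ℚ ∷ []) d ≡ δ d
  coef-one zero    = refl
  coef-one (suc d) = refl

  -- Each h_k with k ≥ 1 is divisible by a, hence a product of l of them by aˡ.
  coef-prod-small : ∀ {μ} → Positive μ → ∀ d → d < length μ → coef (prodP (hPoly ρ) μ) d ≡ 0ℚ
  coef-prod-small {k ∷ μ} (1≤k ∷ pos) d d<l = trans (coef-mul (hPoly ρ k) (prodP (hPoly ρ) μ) d) (product-small d d<l)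
    where
    product-small : ∀ d → d < length (k ∷ μ) → (coef (hPoly ρ k) ⋆ coef (prodP (hPoly ρ) μ)) d ≡ 0ℚ
    product-small zero    _         = ⊗≡0ˡ (coef-hPoly-0 1≤k)
    product-small (suc d) (s≤s d<l) = trans (cong₂ _⊕_ (⊗≡0ˡ (coef-hPoly-0 1≤k))
      (⋆-vanish _ _ d (λ j j≤d → ⊗≡0ʳ (coef-prod-small pos (d ∸ j) (ℕP.≤-<-trans (ℕP.m∸n≤m d j) d<l))))) (⊕-identityˡ 0ℚ)

  coef-prod-1 : ∀ k d → d ≤ k → coef (prodP (hPoly ρ) (k ∷ [])) d ≡ expCoef ρ d k
  coef-prod-1 k d d≤k = begin
    coef (mulP (hPoly ρ k) (1ℚ ∷ [])) d          ≡⟨ coef-mul (hPoly ρ k) (1ℚ ∷ []) d ⟩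
    (coef (hPoly ρ k) ⋆ coef (1ℚ ∷ [])) d        ≡⟨ ⋆-congˡ (coef (hPoly ρ k)) coef-one d ⟩
    (coef (hPoly ρ k) ⋆ δ) d                     ≡⟨ ⋆-identityʳ (coef (hPoly ρ k)) d ⟩
    coef (hPoly ρ k) d                           ≡⟨ coef-hPoly k d d≤k ⟩
    expCoef ρ d k                                ∎

  coef-prod-2 : ∀ i j → 1 ≤ i → 1 ≤ j → coef (prodP (hPoly ρ) (i ∷ j ∷ [])) 2 ≡ (κ i ⊗ ρ i) ⊗ (κ j ⊗ ρ j)
  coef-prod-2 i j 1≤i 1≤j = begin
    coef (mulP (hPoly ρ i) q) 2
      ≡⟨ coef-mul (hPoly ρ i) q 2 ⟩
    h 0 ⊗ coef q 2 ⊕ (h 1 ⊗ coef q 1 ⊕ h 2 ⊗ coef q 0)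
      ≡⟨ cong₂ _⊕_ (⊗≡0ˡ (coef-hPoly-0 1≤i)) (cong (h 1 ⊗ coef q 1 ⊕_) (⊗≡0ʳ (coef-prod-small (1≤j ∷ []) 0 (s≤s z≤n)))) ⟩
    0ℚ ⊕ (h 1 ⊗ coef q 1 ⊕ 0ℚ)
      ≡⟨ trans (⊕-identityˡ _) (⊕-identityʳ _) ⟩
    h 1 ⊗ coef q 1
      ≡⟨ cong₂ _⊗_ (trans (coef-hPoly i 1 1≤i) (expCoef-1 ρ i)) (trans (coef-prod-1 j 1 1≤j) (expCoef-1 ρ j)) ⟩
    (κ i ⊗ ρ i) ⊗ (κ j ⊗ ρ j) ∎
    where
    h : Series
    h = coef (hPoly ρ i)
    q : Poly
    q = prodP (hPoly ρ) (j ∷ [])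

-- Coefficients of the expansion

ones : Vec ℚ 1
ones = 1ℚ ∷ []

pSum-ones : ∀ j → pSum j ones ≡ 1ℚ
pSum-ones j = trans (pSum-∷ j 1ℚ []) (trans (⊕-identityʳ _) (pow-1 j))

ι-dbl : ∀ k → ι (dbl k) ≡ ι 2 ⊗ ι k
ι-dbl k = trans (cong ι (sym (2*≡dbl k))) (ι-* 2 k)

-- The 2 is the chain rule for √t: t d/dt log sec √t = ½ √t tan √t.
tanLog-ones : ∀ m → ι 2 ⊗ tanLog ones (suc m) ≡ τ m
tanLog-ones m = trans (cong (λ x → ι 2 ⊗ (ι (suc m) ⊗ (L (suc m) ⊗ x))) (pSum-ones (suc m)))
  (trans (cong (λ x → ι 2 ⊗ (ι (suc m) ⊗ x)) (⊗-identityʳ _))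
    (trans (sym (⊗-assoc _ _ _)) (trans (cong (_⊗ L (suc m)) (sym (ι-dbl (suc m)))) (∣φfactor∣-τ m))))

2⊗tanLog⋆ : ∀ G m → ι 2 ⊗ (tanLog ones ⋆ G) (suc m) ≡ (G ⋆ τ) m
2⊗tanLog⋆ G m = begin
  ι 2 ⊗ (tanLog ones ⋆ G) (suc m)               ≡⟨ cong (ι 2 ⊗_) (trans (cong (_⊕ ((tanLog ones ∘ suc) ⋆ G) m) (⊗≡0ˡ (tanLog-0 ones))) (⊕-identityˡ _)) ⟩
  ι 2 ⊗ ((tanLog ones ∘ suc) ⋆ G) m             ≡⟨ ⋆-⊗ˡ (ι 2) (tanLog ones ∘ suc) G m ⟨
  ((λ j → ι 2 ⊗ tanLog ones (suc j)) ⋆ G) m     ≡⟨ ⋆-congʳ G tanLog-ones m ⟩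
  (τ ⋆ G) m                                     ≡⟨ ⋆-comm τ G m ⟩
  (G ⋆ τ) m                                     ∎

2⊗D : ∀ G m → ι 2 ⊗ D G (suc m) ≡ ι (dbl (suc m)) ⊗ G (suc m)
2⊗D G m = trans (sym (⊗-assoc _ _ _)) (cong (_⊗ G (suc m)) (sym (ι-dbl (suc m))))

sec₂-isExp : IsExp (tanLog ones) sec₂
sec₂-isExp = record { r-0 = tanLog-0 ones ; G-0 = refl ; D-G = λ
  { zero    → trans (D-0 sec₂) (sym (⊗≡0ˡ (tanLog-0 ones)))
  ; (suc m) → ι-cancelˡ {2} (s≤s z≤n) (trans (2⊗D sec₂ m) (trans (sec₂-rec m) (sym (2⊗tanLog⋆ sec₂ m)))) } }

-- At a = -1 the exponential is 1 / sec √t = cos √t, verified through cos′ = - cos tan.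
cos₂-isExp : IsExp (λ j → (⊖ 1ℚ) ⊗ tanLog ones j) cos₂
cos₂-isExp = record { r-0 = ⊗≡0ʳ (tanLog-0 ones) ; G-0 = refl ; D-G = λ
  { zero    → trans (D-0 cos₂) (sym (⊗≡0ˡ (⊗≡0ʳ (tanLog-0 ones))))
  ; (suc m) → ι-cancelˡ {2} (s≤s z≤n) (begin
      ι 2 ⊗ D cos₂ (suc m)                                        ≡⟨ 2⊗D cos₂ m ⟩
      ι (dbl (suc m)) ⊗ cos₂ (suc m)                              ≡⟨ cos₂-rec m ⟩
      ⊖ (cos₂ ⋆ τ) m                                              ≡⟨ cong ⊖_ (2⊗tanLog⋆ cos₂ m) ⟨
      ⊖ (ι 2 ⊗ (tanLog ones ⋆ cos₂) (suc m))                      ≡⟨ ⊖1⊗ _ ⟨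
      (⊖ 1ℚ) ⊗ (ι 2 ⊗ (tanLog ones ⋆ cos₂) (suc m))               ≡⟨ ⊗-swapˡ _ _ _ ⟩
      ι 2 ⊗ ((⊖ 1ℚ) ⊗ (tanLog ones ⋆ cos₂) (suc m))               ≡⟨ cong (ι 2 ⊗_) (⋆-⊗ˡ (⊖ 1ℚ) (tanLog ones) cos₂ (suc m)) ⟨
      ι 2 ⊗ ((λ j → (⊖ 1ℚ) ⊗ tanLog ones j) ⋆ cos₂) (suc m)       ∎) } }

euler-def : ∀ k → euler k ≡ ι (k !) ⊗ (secS k ⊕ tan k)
euler-def k = trans (⊗-def _ _) (cong₂ _⊗_ (ι-def _) (trans (⊕-def _ _) (cong (secS k ⊕_) (tanS≡tan k))))

euler-even : ∀ n → euler (2 * n) ≡ ι ((2 * n) !) ⊗ sec₂ n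
euler-even n = trans (euler-def (2 * n)) (cong (ι ((2 * n) !) ⊗_) (trans
  (cong₂ _⊕_ (cong secS (2*≡dbl n)) (tan-even (2 * n) (trans (cong isEven (2*≡dbl n)) (isEven-dbl n)))) (⊕-identityʳ _)))

euler-odd : ∀ m → euler (suc (dbl m)) ≡ ι (suc (dbl m) !) ⊗ τ m
euler-odd m = trans (euler-def (suc (dbl m))) (cong (ι (suc (dbl m) !) ⊗_) (trans
  (cong (_⊕ τ m) (sec-odd (suc (dbl m)) (isEven-suc-dbl m))) (⊕-identityˡ _)))

euler′-τ : ∀ m → euler′ (suc m) ≡ ι (suc m) ⊗ (ι (suc (dbl m) !) ⊗ τ m)
euler′-τ m = trans (⊗-def _ _) (cong₂ _⊗_ (ι-def _) (trans (cong (λ k → euler (k ∸ 1)) (2*≡dbl (suc m))) (euler-odd m)))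

-- E at 2k - 1 is (2k - 1)! times the tan coefficient 2k L k, and the factor 2k completes the
-- factorial.
euler′-L : ∀ {k} → 1 ≤ k → euler′ k ≡ ι ((2 * k) !) ⊗ (ι k ⊗ L k)
euler′-L {suc m} _ = begin
  euler′ (suc m)
    ≡⟨ euler′-τ m ⟩
  ι (suc m) ⊗ (ι (N !) ⊗ τ m)
    ≡⟨ cong (λ x → ι (suc m) ⊗ (ι (N !) ⊗ x)) (∣φfactor∣-τ m) ⟨
  ι (suc m) ⊗ (ι (N !) ⊗ (ι (suc N) ⊗ L (suc m)))
    ≡⟨ regroup _ _ _ _ ⟩
  (ι (suc N) ⊗ ι (N !)) ⊗ (ι (suc m) ⊗ L (suc m))
    ≡⟨ cong (_⊗ (ι (suc m) ⊗ L (suc m))) (trans (sym (ι-* (suc N) (N !))) (cong (λ k → ι (k !)) (sym (2*≡dbl (suc m))))) ⟩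
  ι ((2 * suc m) !) ⊗ (ι (suc m) ⊗ L (suc m)) ∎
  where
  N : ℕ
  N = suc (dbl m)
  opaque
    unfolding _⊕_
    regroup : ∀ k f d l → k ⊗ (f ⊗ (d ⊗ l)) ≡ (d ⊗ f) ⊗ (k ⊗ l)
    regroup = solve-∀ ℚ-ring

κ-cancelˡ : ∀ {k} → 1 ≤ k → ∀ {x y} → κ k ⊗ x ≡ κ k ⊗ y → x ≡ y
κ-cancelˡ {k} 1≤k {x} {y} eq = trans (sym (step x)) (trans (cong (ι k ⊗_) eq) (step y))
  where
  step : ∀ z → ι k ⊗ (κ k ⊗ z) ≡ z
  step z = trans (sym (⊗-assoc _ _ _)) (trans (cong (_⊗ z) (ι⊗κ 1≤k)) (⊗-identityˡ z))

-- In the a² coefficient of an exponential the pair {i, j} occurs in both orders, once with 1/i and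
-- once with 1/j; this merges the two.
κ-partial-fractions : ∀ {i j} → 1 ≤ i → 1 ≤ j → κ (i + j) ⊗ (κ i ⊕ κ j) ≡ κ i ⊗ κ j
κ-partial-fractions {i} {j} 1≤i 1≤j = begin
  κ (i + j) ⊗ (κ i ⊕ κ j)
    ≡⟨ cong (κ (i + j) ⊗_) (cong₂ _⊕_ (sym (⊗-identityʳ _)) (sym (⊗-identityʳ _))) ⟩
  κ (i + j) ⊗ (κ i ⊗ 1ℚ ⊕ κ j ⊗ 1ℚ)
    ≡⟨ cong₂ (λ x y → κ (i + j) ⊗ (κ i ⊗ x ⊕ κ j ⊗ y)) (ι⊗κ 1≤j) (ι⊗κ 1≤i) ⟨
  κ (i + j) ⊗ (κ i ⊗ (ι j ⊗ κ j) ⊕ κ j ⊗ (ι i ⊗ κ i))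
    ≡⟨ regroup _ _ _ _ _ ⟩
  ((ι i ⊕ ι j) ⊗ κ (i + j)) ⊗ (κ i ⊗ κ j)
    ≡⟨ cong (_⊗ (κ i ⊗ κ j)) (trans (cong (_⊗ κ (i + j)) (sym (ι-+ i j))) (ι⊗κ (ℕP.≤-trans 1≤i (ℕP.m≤m+n i j)))) ⟩
  1ℚ ⊗ (κ i ⊗ κ j)
    ≡⟨ ⊗-identityˡ _ ⟩
  κ i ⊗ κ j ∎
  where
  opaque
    unfolding _⊕_
    regroup : ∀ k x y m n → k ⊗ (x ⊗ (n ⊗ y) ⊕ y ⊗ (m ⊗ x)) ≡ ((m ⊕ n) ⊗ k) ⊗ (x ⊗ y)
    regroup = solve-∀ ℚ-ring

-- Polynomials in x for the alphabet {x, 1}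

mono : ℕ → Poly
mono zero    = 1ℚ ∷ []
mono (suc k) = 0ℚ ∷ mono k

evalP-mono : ∀ k x → evalP (mono k) x ≡ pow x k
evalP-mono zero    x = trans (cong (1ℚ ⊕_) (⊗-zeroʳ x)) (⊕-identityʳ 1ℚ)
evalP-mono (suc k) x = trans (⊕-identityˡ _) (cong (x ⊗_) (evalP-mono k x))

coef-mono-≡ : ∀ k → coef (mono k) k ≡ 1ℚ
coef-mono-≡ zero    = refl
coef-mono-≡ (suc k) = coef-mono-≡ k

coef-mono-≢ : ∀ k d → k ≢ d → coef (mono k) d ≡ 0ℚ
coef-mono-≢ zero    zero    k≢d = contradiction refl k≢d
coef-mono-≢ zero    (suc d) k≢d = refl
coef-mono-≢ (suc k) zero    k≢d = refl
coef-mono-≢ (suc k) (suc d) k≢d = coef-mono-≢ k d (k≢d ∘ cong suc)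

pow-+ : ∀ x i j → pow x (i + j) ≡ pow x i ⊗ pow x j
pow-+ x zero    j = sym (⊗-identityˡ _)
pow-+ x (suc i) j = trans (cong (x ⊗_) (pow-+ x i j)) (sym (⊗-assoc _ _ _))

-- (Xⁱ + 1)(Xʲ + 1)
pairs : ℕ → ℕ → Poly
pairs i j = addP (addP (mono 0) (mono (i + j))) (addP (mono i) (mono j))

evalP-pairs : ∀ i j x → evalP (pairs i j) x ≡ (pow x i ⊕ 1ℚ) ⊗ (pow x j ⊕ 1ℚ)
evalP-pairs i j x = trans (evalP-add (addP (mono 0) (mono (i + j))) _ x) (trans (cong₂ _⊕_
  (trans (evalP-add (mono 0) (mono (i + j)) x) (cong₂ _⊕_ (evalP-mono 0 x) (trans (evalP-mono (i + j) x) (pow-+ x i j))))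
  (trans (evalP-add (mono i) (mono j) x) (cong₂ _⊕_ (evalP-mono i x) (evalP-mono j x)))) (expand _ _))
  where
  opaque
    unfolding _⊕_
    expand : ∀ a b → (1ℚ ⊕ a ⊗ b) ⊕ (a ⊕ b) ≡ (a ⊕ 1ℚ) ⊗ (b ⊕ 1ℚ)
    expand = solve-∀ ℚ-ring

quadraticTerm : Series → ℕ → ℕ → Poly
quadraticTerm u n j = scaleP (u j ⊗ (κ (n ∸ j) ⊗ u (n ∸ j))) (pairs j (n ∸ j))

-- The a²tⁿ-coefficient of exp(a ∑ u j (xʲ + 1) tʲ / j), as a polynomial in x.
quadratic : Series → ℕ → Poly
quadratic u n = scaleP (κ n) (sumP (quadraticTerm u n) (upTo (suc n)))

quadratic-eval : ∀ x u {ρ} → (∀ j → ρ j ≡ u j ⊗ (pow x j ⊕ 1ℚ)) → ∀ n → expCoef ρ 2 n ≡ evalP (quadratic u n) x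
quadratic-eval x u {ρ} ρ≡ n = begin
  expCoef ρ 2 n
    ≡⟨ trans (expCoef-2 ρ n) (cong (κ n ⊗_) (⋆≡∑ ρ (λ k → κ k ⊗ ρ k) n)) ⟩
  κ n ⊗ ∑ (suc n) (λ j → ρ j ⊗ (κ (n ∸ j) ⊗ ρ (n ∸ j)))
    ≡⟨ cong (κ n ⊗_) (∑-cong (suc n) (λ j _ → term j)) ⟩
  κ n ⊗ ∑ (suc n) (λ j → evalP (quadraticTerm u n j) x)
    ≡⟨ cong (κ n ⊗_) (trans (evalP-sum (quadraticTerm u n) (upTo (suc n)) x) (∑ˡ-upTo (suc n) (λ j → evalP (quadraticTerm u n j) x))) ⟨
  κ n ⊗ evalP (sumP (quadraticTerm u n) (upTo (suc n))) x
    ≡⟨ evalP-scale (κ n) (sumP (quadraticTerm u n) (upTo (suc n))) x ⟨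
  evalP (quadratic u n) x ∎
  where
  opaque
    unfolding _⊕_
    regroup : ∀ a b k c d → (a ⊗ b) ⊗ (k ⊗ (c ⊗ d)) ≡ (a ⊗ (k ⊗ c)) ⊗ (b ⊗ d)
    regroup = solve-∀ ℚ-ring
  term : ∀ j → ρ j ⊗ (κ (n ∸ j) ⊗ ρ (n ∸ j)) ≡ evalP (quadraticTerm u n j) x
  term j = trans (cong₂ (λ a b → a ⊗ (κ (n ∸ j) ⊗ b)) (ρ≡ j) (ρ≡ (n ∸ j))) (trans (regroup _ _ _ _ _)
    (trans (cong ((u j ⊗ (κ (n ∸ j) ⊗ u (n ∸ j))) ⊗_) (sym (evalP-pairs j (n ∸ j) x)))
      (sym (evalP-scale (u j ⊗ (κ (n ∸ j) ⊗ u (n ∸ j))) (pairs j (n ∸ j)) x))))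

pSum-pair : ∀ x k → pSum k (x ∷ 1ℚ ∷ []) ≡ pow x k ⊕ 1ℚ
pSum-pair x k = trans (pSum-∷ k x ones) (cong (pow x k ⊕_) (pSum-ones k))

module Coefficients (n : ℕ) (1≤n : 1 ≤ n) (c : List ℕ → ℚ)
  (expansion : ∀ (N : ℕ) (x : Vec ℚ N) → hExpansion n c x ≡ ℕtoℚ ((2 * n) !) *ℚ A n x) where

  F : ℚ
  F = ι ((2 * n) !)

  coefficient-sum : sum (map c (partitions n)) ≡ euler (2 * n)
  coefficient-sum = begin
    sum (map c (partitions n))
      ≡⟨ sum-map c (partitions n) ⟩
    ∑ᵖ n n c
      ≡⟨ ∑ˡ-cong (λ μ → trans (cong (c μ ⊗_) (∏ˡ-one μ)) (⊗-identityʳ _)) (partitions n) ⟨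
    ∑ᵖ n n (λ μ → c μ ⊗ ∏ˡ (λ k → hSum k ones) μ)
      ≡⟨ hExpansion-def n c ones ⟨
    hExpansion n c ones
      ≡⟨ trans (expansion 1 ones) (trans (⊗-def _ _) (cong (_⊗ A n ones) (ι-def _))) ⟩
    F ⊗ A n ones
      ≡⟨ cong (F ⊗_) (A-exp n ones sec₂-isExp) ⟩
    F ⊗ sec₂ n
      ≡⟨ euler-even n ⟨
    euler (2 * n) ∎
    where
    hSum-ones : ∀ k → hSum k ones ≡ 1ℚ
    hSum-ones k = trans (hSum-∷ 1ℚ [] k) (trans (⋆-congˡ (pow 1ℚ) (λ { zero → refl ; (suc j) → refl }) k)
      (trans (⋆-identityʳ (pow 1ℚ) k) (pow-1 k)))
    ∏ˡ-one : ∀ μ → ∏ˡ (λ k → hSum k ones) μ ≡ 1ℚ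
    ∏ˡ-one []      = refl
    ∏ˡ-one (k ∷ μ) = trans (cong₂ _⊗_ (hSum-ones k) (∏ˡ-one μ)) (⊗-identityˡ 1ℚ)

  -- At a = -1 the complete functions specialise to H(t) = 1 - t, which only leaves h₁ⁿ.
  coefficient-ones : c (replicate n 1) ≡ ℕtoℚ 1
  coefficient-ones = begin
    c (replicate n 1)
      ≡⟨ ⊗-identityʳ _ ⟨
    c (replicate n 1) ⊗ 1ℚ
      ≡⟨ cong (c (replicate n 1) ⊗_) (sgn² n) ⟨
    c (replicate n 1) ⊗ (sgn n ⊗ sgn n)
      ≡⟨ ⊗-assoc _ _ _ ⟨
    (c (replicate n 1) ⊗ sgn n) ⊗ sgn n
      ≡⟨ cong (_⊗ sgn n) sign-identity ⟩
    sgn n ⊗ sgn n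
      ≡⟨ sgn² n ⟩
    1ℚ
      ≡⟨⟩
    ℕtoℚ 1 ∎
    where
    open Expansion n c expansion ones using (eval-identity)
    sgn² : ∀ k → sgn k ⊗ sgn k ≡ 1ℚ
    sgn² zero          = ⊗-identityˡ 1ℚ
    sgn² (suc zero)    = sym (⊗-def (-ℚ 1ℚ) (-ℚ 1ℚ))
    sgn² (suc (suc k)) = sgn² k
    lin : Series
    lin zero          = 1ℚ
    lin (suc zero)    = ⊖ 1ℚ
    lin (suc (suc _)) = 0ℚ
    r : Series
    r j = (⊖ 1ℚ) ⊗ powerSums ones j
    r-suc : ∀ j → r (suc j) ≡ ⊖ 1ℚ
    r-suc j = trans (cong ((⊖ 1ℚ) ⊗_) (pSum-ones (suc j))) (⊗-identityʳ _)
    lin-suc : ∀ j → lin (suc j) ≡ (⊖ 1ℚ) ⊗ δ j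
    lin-suc zero    = sym (⊗-identityʳ _)
    lin-suc (suc j) = sym (⊗-zeroʳ _)
    lin-isExp : IsExp r lin
    lin-isExp = record { r-0 = ⊗-zeroʳ _ ; G-0 = refl ; D-G = λ
      { zero          → trans (D-0 lin) (sym (⊗≡0ˡ (⊗-zeroʳ _)))
      ; (suc zero)    → trans (trans (cong (_⊗ lin 1) ι-1) (⊗-identityˡ _))
                          (sym (trans (cong₂ _⊕_ (⊗≡0ˡ (⊗-zeroʳ _)) (trans (⊗-identityʳ _) (r-suc 0))) (⊕-identityˡ _)))
      ; (suc (suc k)) → trans (⊗-zeroʳ _) (sym (trans (cong₂ _⊕_ (⊗≡0ˡ (⊗-zeroʳ _)) (telescope k)) (⊕-identityˡ 0ℚ))) } }
      where
      -- `r` is - t / (1 - t) and `lin` is 1 - t; their product is - t, so from index 2 on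
      -- everything cancels.
      telescope : ∀ k → ((r ∘ suc) ⋆ lin) (suc k) ≡ 0ℚ
      telescope k = begin
        ((r ∘ suc) ⋆ lin) (suc k)
          ≡⟨ ⋆-comm (r ∘ suc) lin (suc k) ⟩
        1ℚ ⊗ r (suc (suc k)) ⊕ ((lin ∘ suc) ⋆ (r ∘ suc)) k
          ≡⟨ cong₂ _⊕_ (trans (⊗-identityˡ _) (r-suc (suc k)))
               (trans (⋆-congʳ (r ∘ suc) lin-suc k) (trans (⋆-⊗ˡ (⊖ 1ℚ) δ (r ∘ suc) k)
                 (trans (cong ((⊖ 1ℚ) ⊗_) (trans (⋆-identityˡ (r ∘ suc) k) (r-suc k))) (⊖1⊗ _)))) ⟩
        ⊖ 1ℚ ⊕ ⊖ (⊖ 1ℚ)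
          ≡⟨ x⊕⊖x _ ⟩
        0ℚ ∎
    h≡lin : ∀ k → evalP (hPoly (powerSums ones) k) (⊖ 1ℚ) ≡ lin k
    h≡lin k = sym (exp-expPoly {powerSums ones} {⊖ 1ℚ} refl lin-isExp k (suc k) ℕP.≤-refl)
    ∏-lin-ones : ∀ k → ∏ˡ lin (replicate k 1) ≡ sgn k
    ∏-lin-ones zero    = refl
    ∏-lin-ones (suc k) = trans (⊖1⊗ _) (trans (cong ⊖_ (∏-lin-ones k)) (sym (sgn-suc k)))
    ones-or-zero : ∀ {μ} → Positive μ → μ ≡ replicate (total μ) 1 ⊎ ∏ˡ lin μ ≡ 0ℚ
    ones-or-zero []                         = inj₁ refl
    ones-or-zero (_∷_ {suc zero}    _ pos) with ones-or-zero pos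
    ... | inj₁ eq = inj₁ (cong (1 ∷_) eq)
    ... | inj₂ eq = inj₂ (⊗≡0ʳ eq)
    ones-or-zero (_∷_ {suc (suc k)} _ pos) = inj₂ (⊗-zeroˡ _)
    other : ∀ μ → PartLE n n μ → μ ≢ replicate n 1 → c μ ⊗ ∏ˡ lin μ ≡ 0ℚ
    other μ p μ≢ with ones-or-zero (part-positive p)
    ... | inj₁ eq = contradiction (trans eq (cong (λ k → replicate k 1) (part-total p))) μ≢
    ... | inj₂ eq = ⊗≡0ʳ eq
    -- Both sides carry (-1)ⁿ: h₁ⁿ specialises to it, and the right-hand side is (2n)! times the
    -- coefficient of tⁿ in cos √t.
    sign-identity : c (replicate n 1) ⊗ sgn n ≡ sgn n
    sign-identity = begin
      c (replicate n 1) ⊗ sgn n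
        ≡⟨ cong (c (replicate n 1) ⊗_) (∏-lin-ones n) ⟨
      c (replicate n 1) ⊗ ∏ˡ lin (replicate n 1)
        ≡⟨ ∑ᵖ-single (part-ones n 1≤n) (λ μ → c μ ⊗ ∏ˡ lin μ) other ⟨
      ∑ᵖ n n (λ μ → c μ ⊗ ∏ˡ lin μ)
        ≡⟨ ∑ˡ-cong (λ μ → cong (c μ ⊗_) (∏ˡ-cong h≡lin μ)) (partitions n) ⟨
      ∑ᵖ n n (λ μ → c μ ⊗ ∏ˡ (λ k → evalP (hPoly (powerSums ones) k) (⊖ 1ℚ)) μ)
        ≡⟨ eval-identity (⊖ 1ℚ) ⟩
      F ⊗ evalP (hPoly (tanLog ones) n) (⊖ 1ℚ)
        ≡⟨ cong (F ⊗_) (exp-expPoly (tanLog-0 ones) cos₂-isExp n (suc n) ℕP.≤-refl) ⟨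
      F ⊗ cos₂ n
        ≡⟨ cong₂ (λ k s → ι (k !) ⊗ s) (2*≡dbl n) (trans (cos-even (dbl n) (isEven-dbl n)) (cong (λ k → sgn k ⊗ κ (dbl n !)) (half-dbl n))) ⟩
      ι (dbl n !) ⊗ (sgn n ⊗ κ (dbl n !))
        ≡⟨ ⊗-swapˡ _ _ _ ⟩
      sgn n ⊗ (ι (dbl n !) ⊗ κ (dbl n !))
        ≡⟨ trans (cong (sgn n ⊗_) (ι⊗κ (ℕP.1≤n! (dbl n)))) (⊗-identityʳ _) ⟩
      sgn n ∎

  -- The coefficients of a in h_n and `A n` are 1/n and L n, and partitions with more parts have
  -- none; clearing 1/n produces the factor `ι n`.
  coefficient-single : c (n ∷ []) ≡ F ⊗ (ι n ⊗ L n)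
  coefficient-single = κ-cancelˡ 1≤n (begin
    κ n ⊗ c (n ∷ [])
      ≡⟨ trans (⊗-comm _ _) (cong (c (n ∷ []) ⊗_) (trans (sym (⊗-identityʳ _)) (cong (κ n ⊗_) (sym (ρ-n 1≤n))))) ⟩
    c (n ∷ []) ⊗ (κ n ⊗ ρ n)
      ≡⟨ cong (c (n ∷ []) ⊗_) (trans (coef-prod-1 ρ n 1 1≤n) (expCoef-1 ρ n)) ⟨
    c (n ∷ []) ⊗ coef (prodP (hPoly ρ) (n ∷ [])) 1
      ≡⟨ ∑ᵖ-single (part-one 1≤n ℕP.≤-refl) (λ μ → c μ ⊗ coef (prodP (hPoly ρ) μ) 1) other ⟨
    ∑ᵖ n n (λ μ → c μ ⊗ coef (prodP (hPoly ρ) μ) 1)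
      ≡⟨ coef-identity 1 1≤n ⟩
    F ⊗ expCoef (tanLog ones) 1 n
      ≡⟨ cong (F ⊗_) (trans (expCoef-1 (tanLog ones) n) (cong (λ x → κ n ⊗ (ι n ⊗ x)) (trans (cong (L n ⊗_) (pSum-ones n)) (⊗-identityʳ _)))) ⟩
    F ⊗ (κ n ⊗ (ι n ⊗ L n))
      ≡⟨ ⊗-swapˡ _ _ _ ⟩
    κ n ⊗ (F ⊗ (ι n ⊗ L n)) ∎)
    where
    open Expansion n c expansion ones using (coef-identity)
    ρ : Series
    ρ = powerSums ones
    ρ-n : ∀ {n} → 1 ≤ n → powerSums ones n ≡ 1ℚ
    ρ-n {suc n} _ = pSum-ones (suc n)
    other : ∀ μ → PartLE n n μ → μ ≢ n ∷ [] → c μ ⊗ coef (prodP (hPoly ρ) μ) 1 ≡ 0ℚ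
    other []          p _  = ⊗-zeroʳ _
    other (k ∷ [])    p μ≢ = contradiction (cong (_∷ []) (trans (sym (ℕP.+-identityʳ k)) (part-total p))) μ≢
    other (k ∷ l ∷ μ) p _  = ⊗≡0ʳ (coef-prod-small ρ (part-positive p) 1 (s≤s (s≤s z≤n)))

  module _ (i j : ℕ) (1≤j : 1 ≤ j) (j≤i : j ≤ i) (i+j≡n : i + j ≡ n) where

    1≤i : 1 ≤ i
    1≤i = ℕP.≤-trans 1≤j j≤i

    i<n : i < n
    i<n = subst (i <_) i+j≡n (ℕP.m<m+n i 1≤j)

    j<n : j < n
    j<n = subst (j <_) i+j≡n (ℕP.m<n+m j 1≤i)

    n∸i≡j : n ∸ i ≡ j
    n∸i≡j = trans (cong (_∸ i) (sym i+j≡n)) (ℕP.m+n∸m≡n i j)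

    n∸j≡i : n ∸ j ≡ i
    n∸j≡i = trans (cong (_∸ j) (sym i+j≡n)) (ℕP.m+n∸n≡m i j)

    -- The constant term and the term of degree k + l = n are excluded by 0 < i < n.
    coef-pairs : ∀ k l → k + l ≡ n → coef (pairs k l) i ≡ coef (mono k) i ⊕ coef (mono l) i
    coef-pairs k l k+l≡n = trans (coef-add (addP (mono 0) (mono (k + l))) _ i) (trans (cong₂ _⊕_
      (trans (coef-add (mono 0) (mono (k + l)) i) (trans (cong₂ _⊕_ (coef-mono-≢ 0 i (ℕP.<⇒≢ 1≤i))
        (coef-mono-≢ (k + l) i (λ eq → ℕP.<⇒≢ i<n (sym (trans (sym k+l≡n) eq))))) (⊕-identityˡ 0ℚ)))
      (coef-add (mono k) (mono l) i)) (⊕-identityˡ _))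

    -- The power xⁱ arises from xᵏ at k = i and from the complementary power at k = j. Treating
    -- these as two sums covers i = j as well, where one k counts twice.
    coef-quadratic : ∀ u → coef (quadratic u n) i ≡ (κ i ⊗ κ j) ⊗ (u i ⊗ u j)
    coef-quadratic u = begin
      coef (quadratic u n) i
        ≡⟨ coef-scale (κ n) (sumP (quadraticTerm u n) (upTo (suc n))) i ⟩
      κ n ⊗ coef (sumP (quadraticTerm u n) (upTo (suc n))) i
        ≡⟨ cong (κ n ⊗_) (trans (coef-sum (quadraticTerm u n) (upTo (suc n)) i) (∑ˡ-upTo (suc n) (λ k → coef (quadraticTerm u n k) i))) ⟩
      κ n ⊗ ∑ (suc n) (λ k → coef (quadraticTerm u n k) i)
        ≡⟨ cong (κ n ⊗_) (∑-cong (suc n) (λ { k (s≤s k≤n) → trans (coef-scale (w k) (pairs k (n ∸ k)) i)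
             (trans (cong (w k ⊗_) (coef-pairs k (n ∸ k) (ℕP.m+[n∸m]≡n k≤n))) (⊗-distribˡ _ _ _)) })) ⟩
      κ n ⊗ ∑ (suc n) (λ k → w k ⊗ coef (mono k) i ⊕ w k ⊗ coef (mono (n ∸ k)) i)
        ≡⟨ cong (κ n ⊗_) (trans (∑-⊕ (suc n) (λ k → w k ⊗ coef (mono k) i) (λ k → w k ⊗ coef (mono (n ∸ k)) i)) (cong₂ _⊕_
             (trans (∑-single (suc n) {λ k → w k ⊗ coef (mono k) i} i (ℕP.m<n⇒m<1+n i<n) (λ k _ k≢i → ⊗≡0ʳ (coef-mono-≢ k i k≢i)))
               (trans (cong (w i ⊗_) (coef-mono-≡ i)) (⊗-identityʳ _)))
             (trans (∑-single (suc n) {λ k → w k ⊗ coef (mono (n ∸ k)) i} j (ℕP.m<n⇒m<1+n j<n) (λ { k (s≤s k≤n) k≢j → ⊗≡0ʳ (coef-mono-≢ (n ∸ k) i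
                 (λ eq → k≢j (trans (sym (ℕP.m∸[m∸n]≡n k≤n)) (trans (cong (n ∸_) eq) n∸i≡j)))) }))
               (trans (cong (λ k → w j ⊗ coef (mono k) i) n∸j≡i) (trans (cong (w j ⊗_) (coef-mono-≡ i)) (⊗-identityʳ _)))))) ⟩
      κ n ⊗ (w i ⊕ w j)
        ≡⟨ cong₂ (λ a b → κ n ⊗ (u i ⊗ (κ a ⊗ u a) ⊕ u j ⊗ (κ b ⊗ u b))) n∸i≡j n∸j≡i ⟩
      κ n ⊗ (u i ⊗ (κ j ⊗ u j) ⊕ u j ⊗ (κ i ⊗ u i))
        ≡⟨ collect (κ n) (u i) (κ j) (u j) (κ i) ⟩
      (κ n ⊗ (κ i ⊕ κ j)) ⊗ (u i ⊗ u j)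
        ≡⟨ cong (_⊗ (u i ⊗ u j)) (trans (cong (λ k → κ k ⊗ (κ i ⊕ κ j)) (sym i+j≡n)) (κ-partial-fractions 1≤i 1≤j)) ⟩
      (κ i ⊗ κ j) ⊗ (u i ⊗ u j) ∎
      where
      w : ℕ → ℚ
      w k = u k ⊗ (κ (n ∸ k) ⊗ u (n ∸ k))
      opaque
        unfolding _⊕_
        collect : ∀ a x b y d → a ⊗ (x ⊗ (b ⊗ y) ⊕ y ⊗ (d ⊗ x)) ≡ (a ⊗ (d ⊕ b)) ⊗ (x ⊗ y)
        collect = solve-∀ ℚ-ring

    -- The coefficient of xⁱ in (xⁱ + 1)(xʲ + 1), that is 2 if i = j and 1 otherwise: the origin of
    -- the ½ for equal parts.
    repeated : ℚ
    repeated = 1ℚ ⊕ coef (mono j) i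

    -- The coefficient of a²xⁱ for a copies of the variables (x, 1).
    coefficient-pair : c (n ∷ []) ⊕ c (i ∷ j ∷ []) ⊗ repeated ≡ F ⊗ ((ι i ⊗ L i) ⊗ (ι j ⊗ L j))
    coefficient-pair = κ-cancelˡ 1≤i (κ-cancelˡ 1≤j (begin
      κ j ⊗ (κ i ⊗ (c (n ∷ []) ⊕ c (i ∷ j ∷ []) ⊗ repeated))
        ≡⟨ regroup (κ i) (κ j) (c (n ∷ [])) (c (i ∷ j ∷ [])) repeated ⟩
      c (n ∷ []) ⊗ ((κ i ⊗ κ j) ⊗ (1ℚ ⊗ 1ℚ)) ⊕ c (i ∷ j ∷ []) ⊗ ((κ i ⊗ κ j) ⊗ repeated)
        ≡⟨ cong₂ _⊕_ single-term pair-term ⟨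
      ∑ᵖ n n short ⊕ ∑ᵖ n n long
        ≡⟨ ∑ˡ-⊕ short long (partitions n) ⟨
      ∑ᵖ n n (λ μ → short μ ⊕ long μ)
        ≡⟨ ∑ˡ-cong short⊕long (partitions n) ⟩
      ∑ᵖ n n (λ μ → c μ ⊗ coef (quadraticPart μ) i)
        ≡⟨ ∑ˡ-cong (λ μ → coef-scale (c μ) (quadraticPart μ) i) (partitions n) ⟨
      ∑ᵖ n n (λ μ → coef (scaleP (c μ) (quadraticPart μ)) i)
        ≡⟨ coef-sum (λ μ → scaleP (c μ) (quadraticPart μ)) (partitions n) i ⟨
      coef lhs i
        ≡⟨ Agree.coef-agree lhs rhs agree i ⟩
      coef rhs i
        ≡⟨ trans (coef-scale F (quadratic (λ k → ι k ⊗ L k) n) i) (cong (F ⊗_) (coef-quadratic (λ k → ι k ⊗ L k))) ⟩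
      F ⊗ ((κ i ⊗ κ j) ⊗ ((ι i ⊗ L i) ⊗ (ι j ⊗ L j)))
        ≡⟨ regroup′ F (κ i) (κ j) _ ⟩
      κ j ⊗ (κ i ⊗ (F ⊗ ((ι i ⊗ L i) ⊗ (ι j ⊗ L j)))) ∎))
      where
      opaque
        unfolding _⊕_
        regroup : ∀ x y a b s → y ⊗ (x ⊗ (a ⊕ b ⊗ s)) ≡ a ⊗ ((x ⊗ y) ⊗ (1ℚ ⊗ 1ℚ)) ⊕ b ⊗ ((x ⊗ y) ⊗ s)
        regroup = solve-∀ ℚ-ring
        regroup′ : ∀ f x y z → f ⊗ ((x ⊗ y) ⊗ z) ≡ y ⊗ (x ⊗ (f ⊗ z))
        regroup′ = solve-∀ ℚ-ring
      one : Series
      one = positivePart (λ _ → 1ℚ)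
      one≡1 : ∀ {k} → 1 ≤ k → one k ≡ 1ℚ
      one≡1 {suc k} _ = refl
      -- The a² coefficient of h_μ for a copies of {x, 1}, as a polynomial in x; products of three
      -- or more factors are divisible by a³.
      quadraticPart : List ℕ → Poly
      quadraticPart (k ∷ [])     = quadratic one n
      quadraticPart (k ∷ l ∷ []) = scaleP (κ k ⊗ κ l) (pairs k l)
      quadraticPart _            = []
      lhs rhs : Poly
      lhs = sumP (λ μ → scaleP (c μ) (quadraticPart μ)) (partitions n)
      rhs = scaleP F (quadratic (λ k → ι k ⊗ L k) n)
      -- Two partitions survive, (n) and (i, j). Separating the one-part partitions from the others
      -- leaves one survivor in each sum, as `∑ᵖ-single` requires.
      short long : List ℕ → ℚ
      short (k ∷ []) = c (k ∷ []) ⊗ coef (quadratic one n) i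
      short _        = 0ℚ
      long (k ∷ []) = 0ℚ
      long μ        = c μ ⊗ coef (quadraticPart μ) i
      short⊕long : ∀ μ → short μ ⊕ long μ ≡ c μ ⊗ coef (quadraticPart μ) i
      short⊕long []          = ⊕-identityˡ _
      short⊕long (k ∷ [])    = ⊕-identityʳ _
      short⊕long (k ∷ l ∷ μ) = ⊕-identityˡ _
      single-term : ∑ᵖ n n short ≡ c (n ∷ []) ⊗ ((κ i ⊗ κ j) ⊗ (1ℚ ⊗ 1ℚ))
      single-term = trans (∑ᵖ-single (part-one 1≤n ℕP.≤-refl) short other)
        (cong (c (n ∷ []) ⊗_) (trans (coef-quadratic one) (cong₂ (λ x y → (κ i ⊗ κ j) ⊗ (x ⊗ y)) (one≡1 1≤i) (one≡1 1≤j))))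
        where
        other : ∀ μ → PartLE n n μ → μ ≢ n ∷ [] → short μ ≡ 0ℚ
        other []          p _  = refl
        other (k ∷ [])    p μ≢ = contradiction (cong (_∷ []) (trans (sym (ℕP.+-identityʳ k)) (part-total p))) μ≢
        other (k ∷ l ∷ μ) p _  = refl
      pair-term : ∑ᵖ n n long ≡ c (i ∷ j ∷ []) ⊗ ((κ i ⊗ κ j) ⊗ repeated)
      pair-term = trans
        (∑ᵖ-single (subst (λ m → PartLE n m (i ∷ j ∷ [])) i+j≡n (part-two 1≤j j≤i (ℕP.<⇒≤ i<n))) long other)
        (cong (c (i ∷ j ∷ []) ⊗_) (trans (coef-scale (κ i ⊗ κ j) (pairs i j) i) (cong ((κ i ⊗ κ j) ⊗_)
          (trans (coef-pairs i j i+j≡n) (cong (_⊕ coef (mono j) i) (coef-mono-≡ i))))))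
        where
        other : ∀ μ → PartLE n n μ → μ ≢ i ∷ j ∷ [] → long μ ≡ 0ℚ
        other []              p _  = ⊗-zeroʳ _
        other (k ∷ [])        p _  = refl
        other (k ∷ l ∷ _ ∷ μ) p _  = ⊗-zeroʳ _
        other (k ∷ l ∷ [])    p μ≢ = ⊗≡0ʳ (trans (coef-scale (κ k ⊗ κ l) (pairs k l) i) (⊗≡0ʳ (trans (coef-pairs k l k+l≡n)
          (trans (cong₂ _⊕_ (coef-mono-≢ k i k≢i) (coef-mono-≢ l i l≢i)) (⊕-identityˡ 0ℚ)))))
          where
          k+l≡n : k + l ≡ n
          k+l≡n = trans (cong (k +_) (sym (ℕP.+-identityʳ l))) (part-total p)
          k≢i : k ≢ i
          k≢i refl = μ≢ (cong (λ m → i ∷ m ∷ []) (ℕP.+-cancelˡ-≡ i l j (trans k+l≡n (sym i+j≡n))))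
          l≢i : l ≢ i
          l≢i refl = k≢i (ℕP.≤-antisym (subst (_≤ i) (sym k≡j) j≤i) (part-descending p))
            where
            k≡j : k ≡ j
            k≡j = ℕP.+-cancelʳ-≡ i k j (trans k+l≡n (trans (sym i+j≡n) (ℕP.+-comm i j)))
      agree : ∀ a → evalP lhs (ι a) ≡ evalP rhs (ι a)
      agree a = begin
        evalP lhs x
          ≡⟨ trans (evalP-sum _ (partitions n) x) (∑ˡ-cong (λ μ → evalP-scale (c μ) (quadraticPart μ) x) (partitions n)) ⟩
        ∑ᵖ n n (λ μ → c μ ⊗ evalP (quadraticPart μ) x)
          ≡⟨ ∑ᵖ-cong n n (λ μ p → cong (c μ ⊗_) (sym (part-coef μ p))) ⟩
        ∑ᵖ n n (λ μ → c μ ⊗ coef (prodP (hPoly (powerSums y)) μ) 2)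
          ≡⟨ coef-identity 2 2≤n ⟩
        F ⊗ expCoef (tanLog y) 2 n
          ≡⟨ cong (F ⊗_) (quadratic-eval x (λ k → ι k ⊗ L k)
               (λ k → trans (cong (λ p → ι k ⊗ (L k ⊗ p)) (pSum-pair x k)) (sym (⊗-assoc _ _ _))) n) ⟩
        F ⊗ evalP (quadratic (λ k → ι k ⊗ L k) n) x
          ≡⟨ evalP-scale F (quadratic (λ k → ι k ⊗ L k) n) x ⟨
        evalP rhs x ∎
        where
        -- Here `a` is the value given to x; the number of copies is eliminated by
        -- `coef-identity 2`.
        x : ℚ
        x = ι a
        y : Vec ℚ 2
        y = x ∷ 1ℚ ∷ []
        open Expansion n c expansion y using (coef-identity)
        2≤n : 2 ≤ n
        2≤n = ℕP.≤-trans (s≤s 1≤i) i<n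
        powerSums-pair : ∀ k → powerSums y k ≡ one k ⊗ (pow x k ⊕ 1ℚ)
        powerSums-pair zero    = sym (⊗-zeroˡ _)
        powerSums-pair (suc k) = trans (pSum-pair x (suc k)) (sym (⊗-identityˡ _))
        powerSums-positive : ∀ {k} → 1 ≤ k → powerSums y k ≡ pow x k ⊕ 1ℚ
        powerSums-positive {suc k} _ = pSum-pair x (suc k)
        part-coef : ∀ μ → PartLE n n μ → coef (prodP (hPoly (powerSums y)) μ) 2 ≡ evalP (quadraticPart μ) x
        part-coef [] p = refl
        part-coef (k ∷ []) p with trans (sym (ℕP.+-identityʳ k)) (part-total p)
        ... | refl = trans (coef-prod-1 (powerSums y) n 2 2≤n) (quadratic-eval x one powerSums-pair n)
        part-coef (k ∷ l ∷ []) p with part-positive p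
        ... | 1≤k ∷ 1≤l ∷ [] = begin
          coef (prodP (hPoly (powerSums y)) (k ∷ l ∷ [])) 2
            ≡⟨ coef-prod-2 (powerSums y) k l 1≤k 1≤l ⟩
          (κ k ⊗ powerSums y k) ⊗ (κ l ⊗ powerSums y l)
            ≡⟨ ⊗-interchange _ _ _ _ ⟩
          (κ k ⊗ κ l) ⊗ (powerSums y k ⊗ powerSums y l)
            ≡⟨ cong ((κ k ⊗ κ l) ⊗_) (trans (cong₂ _⊗_ (powerSums-positive 1≤k) (powerSums-positive 1≤l)) (sym (evalP-pairs k l x))) ⟩
          (κ k ⊗ κ l) ⊗ evalP (pairs k l) x
            ≡⟨ evalP-scale (κ k ⊗ κ l) (pairs k l) x ⟨
          evalP (scaleP (κ k ⊗ κ l) (pairs k l)) x ∎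
        part-coef (k ∷ l ∷ m ∷ μ) p = coef-prod-small (powerSums y) (part-positive p) 2 (s≤s (s≤s (s≤s z≤n)))

-- Cyclically alternating permutations

-- Letters are natural numbers, so that words over M letters are also words over M + 1 letters.
∑ʷ : ℕ → ℕ → (List ℕ → ℚ) → ℚ
∑ʷ zero    m f = f []
∑ʷ (suc k) m f = ∑ m (λ a → ∑ʷ k m (λ w → f (a ∷ w)))

ind : Bool → ℚ
ind true  = 1ℚ
ind false = 0ℚ

∑ˡ-tabulate : ∀ {A : Set} {m} (h : Fin m → A) (G : A → ℚ) (g : ℕ → ℚ) → (∀ i → G (h i) ≡ g (toℕ i)) → ∑ˡ G (tabulate h) ≡ ∑ m g
∑ˡ-tabulate {m = zero}  h G g p = refl
∑ˡ-tabulate {m = suc m} h G g p = cong₂ _⊕_ (p Fin.zero) (∑ˡ-tabulate (h ∘ Fin.suc) G (g ∘ suc) (p ∘ Fin.suc))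

∑ˡ-allWords : ∀ k m (f : List ℕ → ℚ) → ∑ˡ (λ w → f (map toℕ (toList w))) (allWords k m) ≡ ∑ʷ k m f
∑ˡ-allWords zero    m f = ⊕-identityʳ _
∑ˡ-allWords (suc k) m f = trans
  (∑ˡ-concatMap (λ w → f (map toℕ (toList w))) (λ i → map (i ∷_) (allWords k m)) (allFin m))
  (∑ˡ-tabulate id (λ i → ∑ˡ (λ w → f (map toℕ (toList w))) (map (i ∷_) (allWords k m)))
    (λ a → ∑ʷ k m (λ w → f (a ∷ w)))
    (λ i → trans (∑ˡ-map (λ w → f (map toℕ (toList w))) (i ∷_) (allWords k m)) (∑ˡ-allWords k m (λ w → f (toℕ i ∷ w)))))

length-filter : ∀ {A : Set} (P : A → Bool) xs → ι (length (filter (λ x → P x ≟ᵇ true) xs)) ≡ ∑ˡ (λ x → ind (P x)) xs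
length-filter P []       = ι-0
length-filter P (x ∷ xs) with P x
... | true  = trans (ι-suc _) (cong (1ℚ ⊕_) (length-filter P xs))
... | false = trans (length-filter P xs) (sym (⊕-identityˡ _))

numCycAlt-∑ʷ : ∀ m → ι (numCycAlt m) ≡ ∑ʷ m m (λ w → ind (distinct w ∧ cycAlt w))
numCycAlt-∑ʷ m = trans (length-filter isCycAltPerm (allWords m m)) (∑ˡ-allWords m m (λ w → ind (distinct w ∧ cycAlt w)))

∑ʷ-cong : ∀ k m {f g} → (∀ w → length w ≡ k → All (_< m) w → f w ≡ g w) → ∑ʷ k m f ≡ ∑ʷ k m g
∑ʷ-cong zero    m p = p [] refl []
∑ʷ-cong (suc k) m p = ∑-cong m (λ a a<m → ∑ʷ-cong k m (λ w len all → p (a ∷ w) (cong suc len) (a<m ∷ all)))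

∑ʷ-zero : ∀ k m {f} → (∀ w → length w ≡ k → All (_< m) w → f w ≡ 0ℚ) → ∑ʷ k m f ≡ 0ℚ
∑ʷ-zero zero    m p = p [] refl []
∑ʷ-zero (suc k) m p = ∑-zero m (λ a a<m → ∑ʷ-zero k m (λ w len all → p (a ∷ w) (cong suc len) (a<m ∷ all)))

∑ʷ-++ : ∀ i j m f → ∑ʷ (i + j) m f ≡ ∑ʷ i m (λ u → ∑ʷ j m (λ v → f (u ++ v)))
∑ʷ-++ zero    j m f = refl
∑ʷ-++ (suc i) j m f = ∑-cong m (λ a _ → ∑ʷ-++ i j m (λ w → f (a ∷ w)))

∑-∑ʷ-swap : ∀ n j m (f : ℕ → List ℕ → ℚ) → ∑ n (λ a → ∑ʷ j m (f a)) ≡ ∑ʷ j m (λ v → ∑ n (λ a → f a v))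
∑-∑ʷ-swap n zero    m f = refl
∑-∑ʷ-swap n (suc j) m f = trans (∑-swap n m (λ a b → ∑ʷ j m (λ v → f a (b ∷ v))))
  (∑-cong m (λ b _ → ∑-∑ʷ-swap n j m (λ a v → f a (b ∷ v))))

∑ʷ-swap : ∀ i j m (f : List ℕ → List ℕ → ℚ) → ∑ʷ i m (λ u → ∑ʷ j m (f u)) ≡ ∑ʷ j m (λ v → ∑ʷ i m (λ u → f u v))
∑ʷ-swap zero    j m f = refl
∑ʷ-swap (suc i) j m f = trans (∑-cong m (λ a _ → ∑ʷ-swap i j m (λ u → f (a ∷ u)))) (∑-∑ʷ-swap m j m _)

-- Words in the letters 0, …, M are split at the first occurrence of M.
∑ʷ-max : ∀ k M f → ∑ʷ k (suc M) f ≡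
  ∑ʷ k M f ⊕ ∑ k (λ i → ∑ʷ i M (λ u → ∑ʷ (k ∸ suc i) (suc M) (λ v → f (u ++ M ∷ v))))
∑ʷ-max zero    M f = sym (⊕-identityʳ _)
∑ʷ-max (suc k) M f = begin
  ∑ (suc M) (λ a → ∑ʷ k (suc M) (λ w → f (a ∷ w)))
    ≡⟨ ∑-last M (λ a → ∑ʷ k (suc M) (λ w → f (a ∷ w))) ⟩
  ∑ M (λ a → ∑ʷ k (suc M) (λ w → f (a ∷ w))) ⊕ top
    ≡⟨ cong (_⊕ top) (∑-cong M (λ a _ → ∑ʷ-max k M (λ w → f (a ∷ w)))) ⟩
  ∑ M (λ a → ∑ʷ k M (λ w → f (a ∷ w)) ⊕ ∑ k (λ i → rest a i)) ⊕ top
    ≡⟨ cong (_⊕ top) (trans (∑-⊕ M (λ a → ∑ʷ k M (λ w → f (a ∷ w))) (λ a → ∑ k (rest a)))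
         (cong (∑ʷ (suc k) M f ⊕_) (∑-swap M k rest))) ⟩
  (∑ʷ (suc k) M f ⊕ ∑ k (λ i → ∑ M (λ a → rest a i))) ⊕ top
    ≡⟨ trans (⊕-assoc _ _ _) (cong (∑ʷ (suc k) M f ⊕_) (⊕-comm _ _)) ⟩
  ∑ʷ (suc k) M f ⊕ (top ⊕ ∑ k (λ i → ∑ M (λ a → rest a i))) ∎
  where
  top : ℚ
  top = ∑ʷ k (suc M) (λ w → f (M ∷ w))
  rest : ℕ → ℕ → ℚ
  rest a i = ∑ʷ i M (λ u → ∑ʷ (k ∸ suc i) (suc M) (λ v → f (a ∷ u ++ M ∷ v)))

∑ʷ-restrict : ∀ k M {f} → (∀ u v → f (u ++ M ∷ v) ≡ 0ℚ) → ∑ʷ k (suc M) f ≡ ∑ʷ k M f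
∑ʷ-restrict k M {f} z = trans (∑ʷ-max k M f) (trans (cong (∑ʷ k M f ⊕_) (∑-zero k (λ i _ →
  ∑ʷ-zero i M (λ u _ _ → ∑ʷ-zero (k ∸ suc i) (suc M) (λ v _ _ → z u v))))) (⊕-identityʳ _))

-- Words with distinct letters

≡ᵇ-comm : ∀ a b → (a ≡ᵇ b) ≡ (b ≡ᵇ a)
≡ᵇ-comm zero    zero    = refl
≡ᵇ-comm zero    (suc b) = refl
≡ᵇ-comm (suc a) zero    = refl
≡ᵇ-comm (suc a) (suc b) = ≡ᵇ-comm a b

≡ᵇ-refl : ∀ a → (a ≡ᵇ a) ≡ true
≡ᵇ-refl zero    = refl
≡ᵇ-refl (suc a) = ≡ᵇ-refl a

>⇒≡ᵇ-false : ∀ {a b} → b < a → (a ≡ᵇ b) ≡ false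
>⇒≡ᵇ-false {suc a} {zero}  _       = refl
>⇒≡ᵇ-false {suc a} {suc b} (s≤s p) = >⇒≡ᵇ-false p

notIn-++ : ∀ a u v → notIn a (u ++ v) ≡ notIn a u ∧ notIn a v
notIn-++ a []      v = refl
notIn-++ a (b ∷ u) v with a ≡ᵇ b
... | true  = refl
... | false = notIn-++ a u v

notIn-self : ∀ a u v → notIn a (u ++ a ∷ v) ≡ false
notIn-self a u v = trans (notIn-++ a u (a ∷ v)) (trans (cong (notIn a u ∧_) self) (∧-zeroʳ _))
  where
  self : notIn a (a ∷ v) ≡ false
  self rewrite ≡ᵇ-refl a = refl

notIn-bounded : ∀ {M w} → All (_< M) w → notIn M w ≡ true
notIn-bounded []        = refl
notIn-bounded (b<M ∷ p) rewrite >⇒≡ᵇ-false b<M = notIn-bounded p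

notIn-sym : ∀ a b → notIn a (b ∷ []) ≡ notIn b (a ∷ [])
notIn-sym a b = cong (λ x → if x then false else true) (≡ᵇ-comm a b)

-- Moving `a` past `b` exchanges the test of b against a for that of a against b, which agree; the
-- tests can thus be made as if `a` came first.
distinct-insert : ∀ u a v → distinct (u ++ a ∷ v) ≡ notIn a (u ++ v) ∧ distinct (u ++ v)
distinct-insert []      a v = refl
distinct-insert (b ∷ u) a v = begin
  notIn b (u ++ a ∷ v) ∧ distinct (u ++ a ∷ v)
    ≡⟨ cong₂ _∧_ b-part (distinct-insert u a v) ⟩
  (notIn b (a ∷ []) ∧ notIn b (u ++ v)) ∧ (notIn a (u ++ v) ∧ distinct (u ++ v))
    ≡⟨ ∧-exchange (notIn b (a ∷ [])) (notIn b (u ++ v)) (notIn a (u ++ v)) _ ⟩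
  (notIn b (a ∷ []) ∧ notIn a (u ++ v)) ∧ (notIn b (u ++ v) ∧ distinct (u ++ v))
    ≡⟨ cong (_∧ (notIn b (u ++ v) ∧ distinct (u ++ v))) (trans (cong (_∧ notIn a (u ++ v)) (notIn-sym b a)) (sym (notIn-++ a (b ∷ []) (u ++ v)))) ⟩
  notIn a (b ∷ u ++ v) ∧ (notIn b (u ++ v) ∧ distinct (u ++ v)) ∎
  where
  ∧-exchange : ∀ x y z t → (x ∧ y) ∧ (z ∧ t) ≡ (x ∧ z) ∧ (y ∧ t)
  ∧-exchange false y     z     t = refl
  ∧-exchange true  false false t = refl
  ∧-exchange true  false true  t = refl
  ∧-exchange true  true  z     t = refl
  b-part : notIn b (u ++ a ∷ v) ≡ notIn b (a ∷ []) ∧ notIn b (u ++ v)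
  b-part = begin
    notIn b (u ++ a ∷ v)                                ≡⟨ notIn-++ b u (a ∷ v) ⟩
    notIn b u ∧ notIn b (a ∷ v)                         ≡⟨ cong (notIn b u ∧_) (notIn-++ b (a ∷ []) v) ⟩
    notIn b u ∧ (notIn b (a ∷ []) ∧ notIn b v)          ≡⟨ ∧-exchange true (notIn b u) (notIn b (a ∷ [])) (notIn b v) ⟩
    notIn b (a ∷ []) ∧ (notIn b u ∧ notIn b v)          ≡⟨ cong (notIn b (a ∷ []) ∧_) (notIn-++ b u v) ⟨
    notIn b (a ∷ []) ∧ notIn b (u ++ v)                 ∎

distinct-max : ∀ {M} u v → All (_< M) u → All (_< M) v → distinct (u ++ M ∷ v) ≡ distinct (u ++ v)
distinct-max {M} u v u<M v<M = trans (distinct-insert u M v) (cong (_∧ distinct (u ++ v)) (notIn-bounded (++⁺ u<M v<M)))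

distinct-twice : ∀ u a v w → distinct (u ++ a ∷ (v ++ a ∷ w)) ≡ false
distinct-twice u a v w = trans (distinct-insert u a (v ++ a ∷ w)) (cong (_∧ distinct (u ++ v ++ a ∷ w))
  (trans (cong (notIn a) (sym (++-assoc u v (a ∷ w)))) (notIn-self a (u ++ v) w)))

distinct-comm : ∀ u v → distinct (u ++ v) ≡ distinct (v ++ u)
distinct-comm []      v = cong distinct (sym (++-identityʳ v))
distinct-comm (a ∷ u) v = sym (trans (distinct-insert v a u) (cong₂ _∧_
  (trans (notIn-++ a v u) (trans (∧-comm (notIn a v) (notIn a u)) (sym (notIn-++ a u v)))) (sym (distinct-comm u v))))

data Occurrence (M : ℕ) : List ℕ → Set where
  absent : ∀ {w} → All (_< M) w → Occurrence M w
  found  : ∀ u v → All (_< suc M) (u ++ v) → Occurrence M (u ++ M ∷ v)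

occurrence : ∀ {M w} → All (_< suc M) w → Occurrence M w
occurrence []                  = absent []
occurrence {M} {a ∷ w} (a<sM ∷ p) with a ℕP.≟ M
... | yes refl = found [] w p
... | no a≢M with occurrence p
...   | absent q    = absent (ℕP.≤∧≢⇒< (ℕP.≤-pred a<sM) a≢M ∷ q)
...   | found u v q = found (a ∷ u) v (a<sM ∷ q)

-- Delete an occurrence of the largest letter: either it occurs again, or what is left is a word
-- over one letter fewer that is still too long.
distinct-pigeonhole : ∀ M {w} → All (_< M) w → M < length w → distinct w ≡ false
distinct-pigeonhole zero    (() ∷ _) (s≤s _)
distinct-pigeonhole (suc M) all M<l with occurrence all
... | absent q    = distinct-pigeonhole M q (ℕP.<⇒≤ M<l)
... | found u v q = trans (distinct-insert u M v) (either (occurrence q) refl)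
  where
  length-insert : length (u ++ M ∷ v) ≡ suc (length (u ++ v))
  length-insert = trans (length-++ u) (trans (ℕP.+-suc (length u) (length v)) (cong suc (sym (length-++ u))))
  -- The word is generalised to `w` with an equation, so that matching on the occurrence meets a
  -- variable instead of the index `u ++ v`.
  either : ∀ {w} → Occurrence M w → w ≡ u ++ v → notIn M (u ++ v) ∧ distinct (u ++ v) ≡ false
  either (absent r)      refl = trans (cong (notIn M (u ++ v) ∧_)
    (distinct-pigeonhole M r (ℕP.≤-pred (subst (suc M <_) length-insert M<l)))) (∧-zeroʳ _)
  either (found u′ v′ _) eq   = cong (_∧ distinct (u ++ v)) (trans (cong (notIn M) (sym eq)) (notIn-self M u′ v′))

perms : ℕ → (List ℕ → Bool) → ℚ
perms m P = ∑ʷ m m (λ w → ind (distinct w ∧ P w))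

-- The maximum occurs at least once by the pigeonhole principle and at most once by distinctness, so
-- the sum runs over its position.
perms-max : ∀ M P → perms (suc M) P ≡
  ∑ (suc M) (λ i → ∑ʷ i M (λ u → ∑ʷ (M ∸ i) M (λ v → ind (distinct (u ++ v) ∧ P (u ++ M ∷ v)))))
perms-max M P = trans (∑ʷ-max (suc M) M f) (trans (cong₂ _⊕_
  (∑ʷ-zero (suc M) M (λ w len all → cong (λ b → ind (b ∧ P w)) (distinct-pigeonhole M all (subst (M <_) (sym len) ℕP.≤-refl))))
  (∑-cong (suc M) (λ i _ → ∑ʷ-cong i M (λ u _ u<M → trans
    (∑ʷ-restrict (M ∸ i) M (λ v w → cong (λ b → ind (b ∧ P (u ++ M ∷ (v ++ M ∷ w)))) (distinct-twice u M v w)))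
    (∑ʷ-cong (M ∸ i) M (λ v _ v<M → cong (λ b → ind (b ∧ P (u ++ M ∷ v))) (distinct-max u v u<M v<M)))))))
  (⊕-identityˡ _))
  where
  f : List ℕ → ℚ
  f w = ind (distinct w ∧ P w)

-- The maximum of an alternating word

<ᵇ-true : ∀ {m n} → m < n → (m <ᵇ n) ≡ true
<ᵇ-true {m} {n} p with m <ᵇ n | ℕP.<⇒<ᵇ p
... | true | _ = refl

<ᵇ-false : ∀ {m n} → n < m → (m <ᵇ n) ≡ false
<ᵇ-false {m} {n} p with m <ᵇ n in e
... | false = refl
... | true  = contradiction (ℕP.<ᵇ⇒< m n (subst T (sym e) tt)) (ℕP.<-asym p)

downUp-max : ∀ {M v} → All (_< M) v → downUp (M ∷ v) ≡ upDown v
downUp-max []                  = refl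
downUp-max {v = b ∷ v} (b<M ∷ p) = cong (_∧ upDown (b ∷ v)) (<ᵇ-true b<M)

mutual
  -- A maximum can only stand at a peak, which in an up-down word is an odd position counted from 0.
  -- The descent after it is automatic and leaves an up-down word.
  upDown-max : ∀ {M a} u {v} → All (_< M) (a ∷ u) → All (_< M) v →
    upDown (a ∷ u ++ M ∷ v) ≡ (if isEven (length u) then upDown (a ∷ u) ∧ upDown v else false)
  upDown-max [] (a<M ∷ _) q = cong₂ _∧_ (<ᵇ-true a<M) (downUp-max q)
  upDown-max {a = a} (b ∷ u) (_ ∷ p) q rewrite downUp-max′ u p q with isEven (length u) | isEven-suc (length u)
  ... | true  | e rewrite e = ∧-zeroʳ _
  ... | false | e rewrite e = sym (∧-assoc (a <ᵇ b) _ _)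

  downUp-max′ : ∀ {M a} u {v} → All (_< M) (a ∷ u) → All (_< M) v →
    downUp (a ∷ u ++ M ∷ v) ≡ (if isEven (length u) then false else downUp (a ∷ u) ∧ upDown v)
  downUp-max′ {M} [] {v} (a<M ∷ _) q = cong (_∧ upDown (M ∷ v)) (<ᵇ-false a<M)
  downUp-max′ {a = a} (b ∷ u) (_ ∷ p) q rewrite upDown-max u p q with isEven (length u) | isEven-suc (length u)
  ... | true  | e rewrite e = sym (∧-assoc (b <ᵇ a) _ _)
  ... | false | e rewrite e = ∧-zeroʳ _

mutual
  upDown-++ : ∀ x u a v → isEven (length u) ≡ true →
    upDown (x ∷ u ++ a ∷ v) ≡ upDown (x ∷ u) ∧ ((lastOr x u <ᵇ a) ∧ downUp (a ∷ v))
  upDown-++ x []      a v _ = refl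
  upDown-++ x (y ∷ u) a v e = trans (cong ((x <ᵇ y) ∧_) (downUp-++ y u a v (even-suc⇒odd u e))) (sym (∧-assoc (x <ᵇ y) _ _))

  downUp-++ : ∀ x u a v → isEven (length u) ≡ false →
    downUp (x ∷ u ++ a ∷ v) ≡ downUp (x ∷ u) ∧ ((lastOr x u <ᵇ a) ∧ downUp (a ∷ v))
  downUp-++ x (y ∷ u) a v e = trans (cong ((y <ᵇ x) ∧_) (upDown-++ y u a v (odd-suc⇒even u e))) (sym (∧-assoc (y <ᵇ x) _ _))

  even-suc⇒odd : ∀ (u : List ℕ) → isEven (suc (length u)) ≡ true → isEven (length u) ≡ false
  even-suc⇒odd u e with isEven (length u) | isEven-suc (length u)
  ... | true  | eq = contradiction (trans (sym e) eq) λ ()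
  ... | false | _  = refl

  odd-suc⇒even : ∀ (u : List ℕ) → isEven (suc (length u)) ≡ false → isEven (length u) ≡ true
  odd-suc⇒even u e with isEven (length u) | isEven-suc (length u)
  ... | true  | _  = refl
  ... | false | eq = contradiction (trans (sym e) eq) λ ()

lastOr-++ : ∀ d u a v → lastOr d (u ++ a ∷ v) ≡ lastOr a v
lastOr-++ d []      a v = refl
lastOr-++ d (b ∷ u) a v = lastOr-++ b u a v

lastOr-bounded : ∀ {M d w} → d < M → All (_< M) w → lastOr d w < M
lastOr-bounded d<M []        = d<M
lastOr-bounded d<M (b<M ∷ p) = lastOr-bounded b<M p

-- Rotating a cyclically alternating word so that its maximum M comes first.
cycAlt-max : ∀ {M} u v → All (_< M) u → All (_< M) v → isEven (length v) ≡ not (isEven (length u)) →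
  cycAlt (u ++ M ∷ v) ≡ (if isEven (length u) then upDown (v ++ u) else false)
cycAlt-max []      []      _       _         ()
cycAlt-max []      (x ∷ v) _       (x<M ∷ q) _ = trans
  (cong₂ _∧_ (downUp-max (x<M ∷ q)) (<ᵇ-true (lastOr-bounded x<M q)))
  (trans (∧-identityʳ _) (cong upDown (sym (++-identityʳ (x ∷ v)))))
cycAlt-max {M} (a ∷ u) v   (a<M ∷ p) q parity rewrite downUp-max′ u (a<M ∷ p) q | lastOr-++ a u M v
  with isEven (length u) | isEven-suc (length u)
... | true  | e rewrite e = refl
... | false | e rewrite e = rotate v q parity
  where
  -- The closing condition, last letter below the first, becomes the ascent at the junction of `v`
  -- and `a ∷ u`.
  rotate : ∀ v → All (_< M) v → isEven (length v) ≡ false →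
    (downUp (a ∷ u) ∧ upDown v) ∧ (lastOr M v <ᵇ a) ≡ upDown (v ++ a ∷ u)
  rotate (x ∷ v) _ v-odd = trans (∧-rotate (downUp (a ∷ u)) (upDown (x ∷ v)) (lastOr x v <ᵇ a))
    (sym (upDown-++ x v a u (odd-suc⇒even v v-odd)))
    where
    ∧-rotate : ∀ x y z → (x ∧ y) ∧ z ≡ y ∧ (z ∧ x)
    ∧-rotate x y z = trans (∧-comm (x ∧ y) z) (trans (sym (∧-assoc z x y)) (∧-comm (z ∧ x) y))

∑-even : ∀ m z → ∑ (dbl m) (λ i → if isEven i then z else 0ℚ) ≡ ι m ⊗ z
∑-even zero    z = sym (⊗≡0ˡ ι-0)
∑-even (suc m) z = begin
  z ⊕ (0ℚ ⊕ ∑ (dbl m) (λ i → if isEven i then z else 0ℚ))    ≡⟨ cong₂ _⊕_ (sym (⊗-identityˡ z)) (trans (⊕-identityˡ _) (∑-even m z)) ⟩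
  1ℚ ⊗ z ⊕ ι m ⊗ z                                          ≡⟨ ⊗-distribʳ _ _ _ ⟨
  (1ℚ ⊕ ι m) ⊗ z                                            ≡⟨ cong (_⊗ z) (ι-suc m) ⟨
  ι (suc m) ⊗ z                                             ∎

-- The maximum stands at one of m + 1 even positions; for each of them rotation leaves an arbitrary
-- up-down permutation of the other letters.
perms-cycAlt : ∀ m → perms (dbl (suc m)) cycAlt ≡ ι (suc m) ⊗ perms (suc (dbl m)) upDown
perms-cycAlt m = trans (perms-max M cycAlt) (trans (∑-cong (suc M) (λ { i (s≤s i≤M) → term i i≤M })) (∑-even (suc m) (perms M upDown)))
  where
  M : ℕ
  M = suc (dbl m)
  M-odd : isEven M ≡ false
  M-odd = isEven-suc-dbl m
  even-∸ : ∀ i k → i ≤ k → isEven k ≡ false → isEven (k ∸ i) ≡ not (isEven i)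
  even-∸ zero          k             _             e = e
  even-∸ (suc zero)    (suc k)       _             e with isEven k | isEven-suc k
  ... | true  | _  = refl
  ... | false | eq = contradiction (trans (sym e) eq) λ ()
  even-∸ (suc (suc i)) (suc (suc k)) (s≤s (s≤s p)) e = even-∸ i k p e
  term : ∀ i → i ≤ M → ∑ʷ i M (λ u → ∑ʷ (M ∸ i) M (λ v → ind (distinct (u ++ v) ∧ cycAlt (u ++ M ∷ v))))
    ≡ (if isEven i then perms M upDown else 0ℚ)
  term i i≤M = trans
    (∑ʷ-cong i M (λ u lu u<M → ∑ʷ-cong (M ∸ i) M (λ v lv v<M → trans
      (cong (λ b → ind (distinct (u ++ v) ∧ b)) (trans
        (cycAlt-max u v u<M v<M (trans (cong isEven lv) (trans (even-∸ i M i≤M M-odd) (cong (not ∘ isEven) (sym lu)))))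
        (cong (λ k → if isEven k then upDown (v ++ u) else false) lu)))
      (cong (λ d → ind (d ∧ (if isEven i then upDown (v ++ u) else false))) (distinct-comm u v)))))
    (by-parity (isEven i))
    where
    by-parity : ∀ b → ∑ʷ i M (λ u → ∑ʷ (M ∸ i) M (λ v → ind (distinct (v ++ u) ∧ (if b then upDown (v ++ u) else false))))
      ≡ (if b then perms M upDown else 0ℚ)
    by-parity false = ∑ʷ-zero i M (λ u _ _ → ∑ʷ-zero (M ∸ i) M (λ v _ _ → cong ind (∧-zeroʳ (distinct (v ++ u)))))
    by-parity true  = trans (∑ʷ-swap i (M ∸ i) M (λ u v → ind (distinct (v ++ u) ∧ upDown (v ++ u))))
      (trans (sym (∑ʷ-++ (M ∸ i) i M (λ w → ind (distinct w ∧ upDown w)))) (cong (λ k → ∑ʷ k M (λ w → ind (distinct w ∧ upDown w))) (ℕP.m∸n+n≡m i≤M)))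

-- ks stands for consecutive blocks of lengths 2k+1, each of which has to alternate.
blocks : List ℕ → List ℕ → Bool
blocks []       w = true
blocks (k ∷ ks) w = upDown (take (suc (dbl k)) w) ∧ blocks ks (drop (suc (dbl k)) w)

size : List ℕ → ℕ
size []       = 0
size (k ∷ ks) = suc (dbl k) + size ks

-- The blocks left when the maximum sits at position i and is removed, if this position is possible.
splitBlock : ℕ → List ℕ → ℕ → Maybe (List ℕ)
splitBlock zero    ks i = just ks
splitBlock (suc k) ks i = if isEven i then nothing else just (half i ∷ (k ∸ half i) ∷ ks)

remove : List ℕ → ℕ → Maybe (List ℕ)
remove []       i = nothing
remove (k ∷ ks) i with i ℕP.<? suc (dbl k)
... | yes _ = splitBlock k ks i
... | no _  = Maybe.map (k ∷_) (remove ks (i ∸ suc (dbl k)))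

remove-< : ∀ k ks i → i < suc (dbl k) → remove (k ∷ ks) i ≡ splitBlock k ks i
remove-< k ks i i<l with i ℕP.<? suc (dbl k)
... | yes _   = refl
... | no i≮l = contradiction i<l i≮l

remove-≥ : ∀ k ks i → remove (k ∷ ks) (suc (dbl k) + i) ≡ Maybe.map (k ∷_) (remove ks i)
remove-≥ k ks i with (suc (dbl k) + i) ℕP.<? suc (dbl k)
... | yes p = contradiction p (ℕP.≤⇒≯ (ℕP.m≤m+n (suc (dbl k)) i))
... | no _  = cong (λ j → Maybe.map (k ∷_) (remove ks j)) (ℕP.m+n∸m≡n (suc (dbl k)) i)

blocks? : Maybe (List ℕ) → List ℕ → Bool
blocks? nothing   w = false
blocks? (just ks) w = blocks ks w

odd⇒dbl : ∀ i → isEven i ≡ false → i ≡ suc (dbl (half i))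
odd⇒dbl (suc zero)    _ = refl
odd⇒dbl (suc (suc i)) e = cong (suc ∘ suc) (odd⇒dbl i e)

dbl-≤ : ∀ i k → dbl i ≤ suc (dbl k) → i ≤ k
dbl-≤ zero    k       _             = z≤n
dbl-≤ (suc i) (suc k) (s≤s (s≤s p)) = s≤s (dbl-≤ i k p)
dbl-≤ (suc i) zero    (s≤s ())

dbl-+ : ∀ i j → dbl (i + j) ≡ dbl i + dbl j
dbl-+ zero    j = refl
dbl-+ (suc i) j = cong (suc ∘ suc) (dbl-+ i j)

half≤ : ∀ {i k} → isEven i ≡ false → i < suc (dbl (suc k)) → half i ≤ k
half≤ {i} {k} e (s≤s p) = dbl-≤ (half i) k (ℕP.≤-pred (subst (_≤ dbl (suc k)) (odd⇒dbl i e) p))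

splitBlock-length : ∀ k i → isEven i ≡ false → half i ≤ k → suc (i + suc (dbl (k ∸ half i))) ≡ suc (dbl (suc k))
splitBlock-length k i e h≤k = cong suc (begin
  i + suc (dbl (k ∸ half i))                      ≡⟨ cong (_+ suc (dbl (k ∸ half i))) (odd⇒dbl i e) ⟩
  suc (dbl (half i)) + suc (dbl (k ∸ half i))     ≡⟨ cong suc (ℕP.+-suc (dbl (half i)) (dbl (k ∸ half i))) ⟩
  suc (suc (dbl (half i) + dbl (k ∸ half i)))     ≡⟨ cong (suc ∘ suc) (trans (sym (dbl-+ (half i) (k ∸ half i))) (cong dbl (ℕP.m+[n∸m]≡n h≤k))) ⟩
  dbl (suc k)                                     ∎)

remove-size : ∀ ks i {ks′} → i < size ks → remove ks i ≡ just ks′ → suc (size ks′) ≡ size ks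
remove-size (k ∷ ks) i {ks′} i<s eq with i ℕP.<? suc (dbl k)
remove-size (zero ∷ ks)  i i<s refl | yes _ = refl
remove-size (suc k ∷ ks) i i<s eq | yes i<l with isEven i in e
remove-size (suc k ∷ ks) i i<s refl | yes i<l | false = begin
  suc (suc (dbl (half i)) + (suc (dbl (k ∸ half i)) + size ks))
    ≡⟨ cong (λ j → suc (j + (suc (dbl (k ∸ half i)) + size ks))) (odd⇒dbl i e) ⟨
  suc (i + (suc (dbl (k ∸ half i)) + size ks))
    ≡⟨ cong suc (ℕP.+-assoc i (suc (dbl (k ∸ half i))) (size ks)) ⟨
  suc (i + suc (dbl (k ∸ half i))) + size ks
    ≡⟨ cong (_+ size ks) (splitBlock-length k i e (half≤ {i} e i<l)) ⟩
  suc (dbl (suc k)) + size ks ∎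
remove-size (k ∷ ks) i i<s eq | no i≮l with remove ks (i ∸ suc (dbl k)) in e
remove-size (k ∷ ks) i i<s refl | no i≮l | just ks′ = trans (sym (ℕP.+-suc (suc (dbl k)) (size ks′)))
  (cong (suc (dbl k) +_) (remove-size ks (i ∸ suc (dbl k)) (ℕP.+-cancelˡ-< (suc (dbl k)) _ _
    (subst (_< suc (dbl k) + size ks) (sym (ℕP.m+[n∸m]≡n (ℕP.≮⇒≥ i≮l))) i<s)) e))

take-++ : ∀ {A : Set} (u : List A) l v → take (length u + l) (u ++ v) ≡ u ++ take l v
take-++ []      l v = refl
take-++ (a ∷ u) l v = cong (a ∷_) (take-++ u l v)

drop-++ : ∀ {A : Set} (u : List A) l v → drop (length u + l) (u ++ v) ≡ drop l v
drop-++ []      l v = refl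
drop-++ (a ∷ u) l v = drop-++ u l v

take-++-short : ∀ {A : Set} l (u v : List A) → l ≤ length u → take l (u ++ v) ≡ take l u
take-++-short zero    u       v _       = refl
take-++-short (suc l) (a ∷ u) v (s≤s p) = cong (a ∷_) (take-++-short l u v p)

drop-++-short : ∀ {A : Set} l (u v : List A) → l ≤ length u → drop l (u ++ v) ≡ drop l u ++ v
drop-++-short zero    u       v _       = refl
drop-++-short (suc l) (a ∷ u) v (s≤s p) = drop-++-short l u v p

-- At an odd position the letters before the maximum and those after it in its block form two
-- up-down words of odd length, the new blocks; at an even position alternation fails.
splitBlock-max : ∀ {M} k ks a u v → All (_< M) (a ∷ u) → All (_< M) v → suc (length u) < suc (dbl (suc k)) →
  blocks (suc k ∷ ks) (a ∷ u ++ M ∷ v) ≡ blocks? (splitBlock (suc k) ks (suc (length u))) (a ∷ u ++ v)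
splitBlock-max {M} k ks a u v p q i<l = trans
  (cong₂ _∧_ (trans (cong upDown take-block) (upDown-max u p (take⁺ r q))) (cong (blocks ks) drop-block))
  (by-parity (isEven (length u)) refl)
  where
  -- `i` is the position of the maximum, `r` the number of letters after it within the first block.
  i r : ℕ
  i = suc (length u)
  r = suc (dbl (suc k)) ∸ suc i
  l≡ : suc (dbl (suc k)) ≡ i + suc r
  l≡ = sym (trans (ℕP.+-suc i r) (ℕP.m+[n∸m]≡n i<l))
  take-block : take (suc (dbl (suc k))) (a ∷ u ++ M ∷ v) ≡ a ∷ u ++ M ∷ take r v
  take-block = trans (cong (λ m → take m (a ∷ u ++ M ∷ v)) l≡) (take-++ (a ∷ u) (suc r) (M ∷ v))
  drop-block : drop (suc (dbl (suc k))) (a ∷ u ++ M ∷ v) ≡ drop r v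
  drop-block = trans (cong (λ m → drop m (a ∷ u ++ M ∷ v)) l≡) (drop-++ (a ∷ u) (suc r) (M ∷ v))
  by-parity : ∀ b → isEven (length u) ≡ b →
    (if isEven (length u) then upDown (a ∷ u) ∧ upDown (take r v) else false) ∧ blocks ks (drop r v)
      ≡ blocks? (splitBlock (suc k) ks i) (a ∷ u ++ v)
  by-parity false e rewrite e | trans (isEven-suc (length u)) (cong not e) = refl
  by-parity true  e rewrite e | trans (isEven-suc (length u)) (cong not e) = trans (∧-assoc (upDown (a ∷ u)) _ _)
    (sym (trans
      (cong₂ (λ x y → upDown x ∧ (upDown (take (suc (dbl (k ∸ h))) y) ∧ blocks ks (drop (suc (dbl (k ∸ h))) y))) take-u drop-u)
      (cong (λ m → upDown (a ∷ u) ∧ (upDown (take m v) ∧ blocks ks (drop m v))) (sym r≡))))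
    where
    i-odd : isEven i ≡ false
    i-odd = trans (isEven-suc (length u)) (cong not e)
    h : ℕ
    h = half i
    i+0≡ : suc (dbl h) ≡ i + 0
    i+0≡ = trans (sym (odd⇒dbl i i-odd)) (sym (ℕP.+-identityʳ i))
    take-u : take (suc (dbl h)) (a ∷ u ++ v) ≡ a ∷ u
    take-u = trans (cong (λ m → take m (a ∷ u ++ v)) i+0≡) (trans (take-++ (a ∷ u) 0 v) (++-identityʳ (a ∷ u)))
    drop-u : drop (suc (dbl h)) (a ∷ u ++ v) ≡ v
    drop-u = trans (cong (λ m → drop m (a ∷ u ++ v)) i+0≡) (drop-++ (a ∷ u) 0 v)
    r≡ : r ≡ suc (dbl (k ∸ h))
    r≡ = ℕP.+-cancelˡ-≡ (suc i) _ _ (trans (sym (trans l≡ (ℕP.+-suc i r))) (sym (splitBlock-length k i i-odd (half≤ {i} i-odd i<l))))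

remaining-length : ∀ l a b s {a′} → l ≤ a → a′ ≡ a ∸ l → suc (a + b) ≡ l + s → suc (a′ + b) ≡ s
remaining-length l a b s l≤a refl eq = ℕP.+-cancelˡ-≡ l _ _ (begin
  l + suc ((a ∸ l) + b)      ≡⟨ ℕP.+-suc l _ ⟩
  suc (l + ((a ∸ l) + b))    ≡⟨ cong suc (ℕP.+-assoc l (a ∸ l) b) ⟨
  suc ((l + (a ∸ l)) + b)    ≡⟨ cong (λ x → suc (x + b)) (ℕP.m+[n∸m]≡n l≤a) ⟩
  suc (a + b)                ≡⟨ eq ⟩
  l + s                      ∎)

-- A first block that lies before the maximum is a prefix of `u` and remains as it is; otherwise the
-- maximum splits it.
blocks-max : ∀ {M} ks u v → All (_< M) u → All (_< M) v → suc (length u + length v) ≡ size ks →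
  blocks ks (u ++ M ∷ v) ≡ blocks? (remove ks (length u)) (u ++ v)
blocks-max [] u v p q ()
blocks-max {M} (k ∷ ks) u v p q len with length u ℕP.<? suc (dbl k)
blocks-max {M} (zero ∷ ks)  []      v p q len | yes _ = refl
blocks-max {M} (zero ∷ ks)  (a ∷ u) v p q len | yes (s≤s ())
blocks-max {M} (suc k ∷ ks) []      []      p q () | yes _
-- A block of length at least 3 that starts with the maximum would have to ascend from it.
blocks-max {M} (suc k ∷ ks) []      (b ∷ v) p (b<M ∷ q) len | yes _ rewrite <ᵇ-false b<M = refl
blocks-max {M} (suc k ∷ ks) (a ∷ u) v p q len | yes i<l = splitBlock-max k ks a u v p q i<l
blocks-max {M} (k ∷ ks) u v p q len | no u≮l
  rewrite take-++-short (suc (dbl k)) u (M ∷ v) (ℕP.≮⇒≥ u≮l)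
        | drop-++-short (suc (dbl k)) u (M ∷ v) (ℕP.≮⇒≥ u≮l)
        | blocks-max ks (drop (suc (dbl k)) u) v (drop⁺ (suc (dbl k)) p) q
            (remaining-length (suc (dbl k)) (length u) (length v) (size ks) (ℕP.≮⇒≥ u≮l) (length-drop (suc (dbl k)) u) len)
        | length-drop (suc (dbl k)) u
  with remove ks (length u ∸ suc (dbl k))
... | nothing  = ∧-zeroʳ _
... | just ks′ = sym (cong₂ (λ x y → upDown x ∧ blocks ks′ y)
    (take-++-short (suc (dbl k)) u v (ℕP.≮⇒≥ u≮l)) (drop-++-short (suc (dbl k)) u v (ℕP.≮⇒≥ u≮l)))

removalWeight : Maybe (List ℕ) → ℚ
removalWeight nothing   = 0ℚ
removalWeight (just ks) = ∏ˡ τ ks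

∑-odd : ∀ m f → (∀ i → isEven i ≡ true → f i ≡ 0ℚ) → ∑ (suc (dbl m)) f ≡ ∑ m (λ a → f (suc (dbl a)))
∑-odd zero    f z = trans (⊕-identityʳ _) (z 0 refl)
∑-odd (suc m) f z = trans (cong₂ _⊕_ (z 0 refl) (cong (f 1 ⊕_) (∑-odd m (f ∘ suc ∘ suc) (λ i → z (suc (suc i)))))) (⊕-identityˡ _)

-- The odd positions give the Cauchy square of τ, and a block of one letter gives 1: together the
-- right-hand side of `τ-rec`.
∑-splitBlock : ∀ k ks → ∑ (suc (dbl k)) (λ i → removalWeight (splitBlock k ks i)) ≡ ι (suc (dbl k)) ⊗ ∏ˡ τ (k ∷ ks)
∑-splitBlock k ks = trans (sum-value k) (trans (cong (_⊗ ∏ˡ τ ks) (sym (τ-rec k))) (⊗-assoc _ _ _))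
  where
  half-suc-dbl : ∀ a → half (suc (dbl a)) ≡ a
  half-suc-dbl zero    = refl
  half-suc-dbl (suc a) = cong suc (half-suc-dbl a)
  sum-value : ∀ k → ∑ (suc (dbl k)) (λ i → removalWeight (splitBlock k ks i)) ≡ (δ k ⊕ shift (τ ⋆ τ) k) ⊗ ∏ˡ τ ks
  sum-value zero    = trans (⊕-identityʳ _) (sym (trans (cong (_⊗ ∏ˡ τ ks) (⊕-identityʳ 1ℚ)) (⊗-identityˡ _)))
  sum-value (suc k) = begin
    ∑ (suc (dbl (suc k))) (λ i → removalWeight (splitBlock (suc k) ks i))
      ≡⟨ ∑-odd (suc k) (λ i → removalWeight (splitBlock (suc k) ks i)) even-zero ⟩
    ∑ (suc k) (λ a → removalWeight (splitBlock (suc k) ks (suc (dbl a))))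
      ≡⟨ ∑-cong (suc k) (λ a _ → odd-value a) ⟩
    ∑ (suc k) (λ a → ∏ˡ τ ks ⊗ (τ a ⊗ τ (k ∸ a)))
      ≡⟨ ∑-⊗ˡ (suc k) (∏ˡ τ ks) (λ a → τ a ⊗ τ (k ∸ a)) ⟩
    ∏ˡ τ ks ⊗ ∑ (suc k) (λ a → τ a ⊗ τ (k ∸ a))
      ≡⟨ cong (∏ˡ τ ks ⊗_) (⋆≡∑ τ τ k) ⟨
    ∏ˡ τ ks ⊗ (τ ⋆ τ) k
      ≡⟨ trans (⊗-comm _ _) (cong (_⊗ ∏ˡ τ ks) (sym (⊕-identityˡ _))) ⟩
    (0ℚ ⊕ (τ ⋆ τ) k) ⊗ ∏ˡ τ ks ∎
    where
    even-zero : ∀ i → isEven i ≡ true → removalWeight (splitBlock (suc k) ks i) ≡ 0ℚ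
    even-zero i e rewrite e = refl
    odd-value : ∀ a → removalWeight (splitBlock (suc k) ks (suc (dbl a))) ≡ ∏ˡ τ ks ⊗ (τ a ⊗ τ (k ∸ a))
    odd-value a rewrite isEven-suc-dbl a | half-suc-dbl a = trans (sym (⊗-assoc _ _ _)) (⊗-comm _ _)

-- Removal acts on one block at a time, like a derivation: each block multiplies the weight by its
-- own length, and the lengths add up.
∑-remove : ∀ ks → ∑ (size ks) (λ i → removalWeight (remove ks i)) ≡ ι (size ks) ⊗ ∏ˡ τ ks
∑-remove []       = sym (⊗≡0ˡ ι-0)
∑-remove (k ∷ ks) = begin
  ∑ (l + size ks) (λ i → removalWeight (remove (k ∷ ks) i))
    ≡⟨ ∑-split l (size ks) (λ i → removalWeight (remove (k ∷ ks) i)) ⟩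
  ∑ l (λ i → removalWeight (remove (k ∷ ks) i)) ⊕ ∑ (size ks) (λ i → removalWeight (remove (k ∷ ks) (l + i)))
    ≡⟨ cong₂ _⊕_ (trans (∑-cong l (λ i i<l → cong removalWeight (remove-< k ks i i<l))) (∑-splitBlock k ks))
         (trans (∑-cong (size ks) (λ i _ → trans (cong removalWeight (remove-≥ k ks i)) (weight-map (remove ks i))))
           (trans (∑-⊗ˡ (size ks) (τ k) (λ i → removalWeight (remove ks i))) (cong (τ k ⊗_) (∑-remove ks)))) ⟩
  ι l ⊗ (τ k ⊗ ∏ˡ τ ks) ⊕ τ k ⊗ (ι (size ks) ⊗ ∏ˡ τ ks)
    ≡⟨ trans (cong (ι l ⊗ (τ k ⊗ ∏ˡ τ ks) ⊕_) (⊗-swapˡ _ _ _)) (sym (⊗-distribʳ _ _ _)) ⟩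
  (ι l ⊕ ι (size ks)) ⊗ (τ k ⊗ ∏ˡ τ ks)
    ≡⟨ cong (_⊗ (τ k ⊗ ∏ˡ τ ks)) (ι-+ l (size ks)) ⟨
  ι (l + size ks) ⊗ (τ k ⊗ ∏ˡ τ ks) ∎
  where
  l : ℕ
  l = suc (dbl k)
  weight-map : ∀ x → removalWeight (Maybe.map (k ∷_) x) ≡ τ k ⊗ removalWeight x
  weight-map nothing   = sym (⊗-zeroʳ _)
  weight-map (just ks) = refl

-- After removal of the maximum the other M letters are counted by induction, and `∑-remove`
-- supplies the factor M + 1. Letters on the two sides of a block boundary are not compared, so
-- cutting a block at its maximum loses no condition.
perms-blocks : ∀ N ks → size ks ≡ N → perms N (blocks ks) ≡ ι (N !) ⊗ ∏ˡ τ ks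
perms-blocks zero    []       _  = sym (trans (⊗-identityʳ _) ι-1)
perms-blocks zero    (k ∷ ks) ()
perms-blocks (suc M) ks       sz = begin
  perms (suc M) (blocks ks)
    ≡⟨ perms-max M (blocks ks) ⟩
  ∑ (suc M) (λ i → ∑ʷ i M (λ u → ∑ʷ (M ∸ i) M (λ v → ind (distinct (u ++ v) ∧ blocks ks (u ++ M ∷ v)))))
    ≡⟨ ∑-cong (suc M) (λ { i (s≤s i≤M) → term i i≤M }) ⟩
  ∑ (suc M) (λ i → ι (M !) ⊗ removalWeight (remove ks i))
    ≡⟨ ∑-⊗ˡ (suc M) (ι (M !)) (λ i → removalWeight (remove ks i)) ⟩
  ι (M !) ⊗ ∑ (suc M) (λ i → removalWeight (remove ks i))
    ≡⟨ cong (λ N → ι (M !) ⊗ ∑ N (λ i → removalWeight (remove ks i))) sz ⟨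
  ι (M !) ⊗ ∑ (size ks) (λ i → removalWeight (remove ks i))
    ≡⟨ cong (ι (M !) ⊗_) (trans (∑-remove ks) (cong (λ N → ι N ⊗ ∏ˡ τ ks) sz)) ⟩
  ι (M !) ⊗ (ι (suc M) ⊗ ∏ˡ τ ks)
    ≡⟨ trans (⊗-swapˡ _ _ _) (sym (⊗-assoc _ _ _)) ⟩
  (ι (suc M) ⊗ ι (M !)) ⊗ ∏ˡ τ ks
    ≡⟨ cong (_⊗ ∏ˡ τ ks) (ι-* (suc M) (M !)) ⟨
  ι (suc M !) ⊗ ∏ˡ τ ks ∎
  where
  removed : ∀ r i → i ≤ M → remove ks i ≡ r → ∑ʷ M M (λ w → ind (distinct w ∧ blocks? r w)) ≡ ι (M !) ⊗ removalWeight r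
  removed nothing   i i≤M e = trans (∑ʷ-zero M M (λ w _ _ → cong ind (∧-zeroʳ (distinct w)))) (sym (⊗-zeroʳ _))
  removed (just ks′) i i≤M e = perms-blocks M ks′
    (ℕP.suc-injective (trans (remove-size ks i (subst (i <_) (sym sz) (s≤s i≤M)) e) sz))
  term : ∀ i → i ≤ M → ∑ʷ i M (λ u → ∑ʷ (M ∸ i) M (λ v → ind (distinct (u ++ v) ∧ blocks ks (u ++ M ∷ v))))
    ≡ ι (M !) ⊗ removalWeight (remove ks i)
  term i i≤M = begin
    ∑ʷ i M (λ u → ∑ʷ (M ∸ i) M (λ v → ind (distinct (u ++ v) ∧ blocks ks (u ++ M ∷ v))))
      ≡⟨ ∑ʷ-cong i M (λ u lu u<M → ∑ʷ-cong (M ∸ i) M (λ v lv v<M → cong (λ b → ind (distinct (u ++ v) ∧ b))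
           (trans (blocks-max ks u v u<M v<M (trans (cong suc (trans (cong₂ _+_ lu lv) (ℕP.m+[n∸m]≡n i≤M))) (sym sz)))
             (cong (λ j → blocks? (remove ks j) (u ++ v)) lu)))) ⟩
    ∑ʷ i M (λ u → ∑ʷ (M ∸ i) M (λ v → f (u ++ v)))
      ≡⟨ ∑ʷ-++ i (M ∸ i) M f ⟨
    ∑ʷ (i + (M ∸ i)) M f
      ≡⟨ cong (λ k → ∑ʷ k M f) (ℕP.m+[n∸m]≡n i≤M) ⟩
    ∑ʷ M M f
      ≡⟨ removed (remove ks i) i i≤M refl ⟩
    ι (M !) ⊗ removalWeight (remove ks i) ∎
    where
    f : List ℕ → ℚ
    f w = ind (distinct w ∧ blocks? (remove ks i) w)

numCycAlt-euler′ : ∀ m → ι (numCycAlt (dbl (suc m))) ≡ euler′ (suc m)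
numCycAlt-euler′ m = begin
  ι (numCycAlt (dbl (suc m)))                       ≡⟨ numCycAlt-∑ʷ (dbl (suc m)) ⟩
  perms (dbl (suc m)) cycAlt                        ≡⟨ perms-cycAlt m ⟩
  ι (suc m) ⊗ perms l upDown                        ≡⟨ cong (ι (suc m) ⊗_) one-block ⟩
  ι (suc m) ⊗ (ι (l !) ⊗ τ m)                       ≡⟨ euler′-τ m ⟨
  euler′ (suc m)                                    ∎
  where
  l : ℕ
  l = suc (dbl m)
  one-block : perms l upDown ≡ ι (l !) ⊗ τ m
  one-block = begin
    perms l upDown
      ≡⟨ ∑ʷ-cong l l (λ w lw _ → cong (λ b → ind (distinct w ∧ b)) (sym (trans (∧-identityʳ _)
           (cong upDown (take-all l w (ℕP.≤-reflexive lw)))))) ⟩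
    perms l (blocks (m ∷ []))
      ≡⟨ perms-blocks l (m ∷ []) (ℕP.+-identityʳ l) ⟩
    ι (l !) ⊗ (τ m ⊗ 1ℚ)
      ≡⟨ cong (ι (l !) ⊗_) (⊗-identityʳ _) ⟩
    ι (l !) ⊗ τ m ∎

-- Binomial coefficients and the four statements

binomial-factorials : ∀ {n k} → k ≤ n → (n C k) * (k ! * (n ∸ k) !) ≡ n !
binomial-factorials {n} {k} k≤n = trans
  (cong (_* (k ! * (n ∸ k) !)) (nCk≡n!/k![n-k]! k≤n)) (m/n*n≡m (k![n∸k]!∣n! k≤n))
  where instance _ = k ℕP.!* (n ∸ k) !≢0

-- By `euler′-L` the Euler numbers bring in (2i)! (2j)!, which the binomial coefficient exchanges
-- for (2n)!.
binomial-euler′ : ∀ {n i j} → 1 ≤ i → 1 ≤ j → i + j ≡ n →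
  (ι ((2 * n) C (2 * i)) ⊗ euler′ i) ⊗ euler′ j ≡ ι ((2 * n) !) ⊗ ((ι i ⊗ L i) ⊗ (ι j ⊗ L j))
binomial-euler′ {n} {i} {j} 1≤i 1≤j i+j≡n = begin
  (ι B ⊗ euler′ i) ⊗ euler′ j
    ≡⟨ cong₂ (λ x y → (ι B ⊗ x) ⊗ y) (euler′-L 1≤i) (euler′-L 1≤j) ⟩
  (ι B ⊗ (ι ((2 * i) !) ⊗ x)) ⊗ (ι ((2 * j) !) ⊗ y)
    ≡⟨ regroup _ _ _ _ _ ⟩
  (ι B ⊗ (ι ((2 * i) !) ⊗ ι ((2 * j) !))) ⊗ (x ⊗ y)
    ≡⟨ cong (_⊗ (x ⊗ y)) (trans (cong (ι B ⊗_) (sym (ι-* _ _))) (sym (ι-* _ _))) ⟩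
  ι (B * ((2 * i) ! * (2 * j) !)) ⊗ (x ⊗ y)
    ≡⟨ cong (λ k → ι k ⊗ (x ⊗ y)) (trans (cong (λ k → B * ((2 * i) ! * k !)) (sym 2n∸2i)) (binomial-factorials 2i≤2n)) ⟩
  ι ((2 * n) !) ⊗ (x ⊗ y) ∎
  where
  B : ℕ
  B = (2 * n) C (2 * i)
  x y : ℚ
  x = ι i ⊗ L i
  y = ι j ⊗ L j
  opaque
    unfolding _⊕_
    regroup : ∀ b f x g y → (b ⊗ (f ⊗ x)) ⊗ (g ⊗ y) ≡ (b ⊗ (f ⊗ g)) ⊗ (x ⊗ y)
    regroup = solve-∀ ℚ-ring
  2n≡ : 2 * n ≡ 2 * i + 2 * j
  2n≡ = trans (cong (2 *_) (sym i+j≡n)) (ℕP.*-distribˡ-+ 2 i j)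
  2i≤2n : 2 * i ≤ 2 * n
  2i≤2n = subst (2 * i ≤_) (sym 2n≡) (ℕP.m≤m+n (2 * i) (2 * j))
  2n∸2i : 2 * n ∸ 2 * i ≡ 2 * j
  2n∸2i = trans (cong (_∸ 2 * i) 2n≡) (ℕP.m+n∸m≡n (2 * i) (2 * j))

opaque
  unfolding _⊕_
  solve-right : ∀ {x y z} → x ⊕ y ≡ z → y ≡ z - x
  solve-right {x} {y} refl = sym (lem x y)
    where
    lem : ∀ x y → (x ⊕ y) ⊕ ⊖ x ≡ y
    lem = solve-∀ ℚ-ring

theorem5p2 : (n : ℕ) → 1 Data.Nat.≤ n →
    (c : List ℕ → ℚ) →
    (∀ (N : ℕ) (x : Vec ℚ N) → hExpansion n c x ≡ ℕtoℚ ((2 * n) !) *ℚ A n x) →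
    (c (replicate n 1) ≡ ℕtoℚ 1)
    × (sum (map c (partitions n)) ≡ euler (2 * n))
    × (c (n ∷ []) ≡ euler′ n × c (n ∷ []) ≡ ℕtoℚ (numCycAlt (2 * n)))
    × (∀ (i j : ℕ) → 1 Data.Nat.≤ i → 1 Data.Nat.≤ j → i + j ≡ n →
    (i ≢ j → c ((i ⊔ j) ∷ (i ⊓ j) ∷ []) ≡
    (ℕtoℚ ((2 * n) C (2 * i)) *ℚ euler′ i *ℚ euler′ j) - euler′ n)
    × (i ≡ j → c (i ∷ j ∷ []) ≡
    recipℕ 2 *ℚ ((ℕtoℚ ((2 * n) C n) *ℚ (euler′ i *ℚ euler′ i)) - euler′ n)))
theorem5p2 n 1≤n c expansion =
  coefficient-ones , coefficient-sum , (single , trans single (count 1≤n)) ,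
  λ i j 1≤i 1≤j i+j≡n → distinct-parts i j 1≤i 1≤j i+j≡n , equal-parts i j 1≤i 1≤j i+j≡n
  where
  open Coefficients n 1≤n c expansion

  single : c (n ∷ []) ≡ euler′ n
  single = trans coefficient-single (sym (euler′-L 1≤n))

  count : ∀ {n} → 1 ≤ n → euler′ n ≡ ℕtoℚ (numCycAlt (2 * n))
  count {suc m} _ = sym (trans (ι-def _) (trans (cong (ι ∘ numCycAlt) (2*≡dbl (suc m))) (numCycAlt-euler′ m)))

  -- Partitions list the larger part first, so the extraction is made for j < i and applied to the
  -- sorted pair.
  ordered : ∀ i j → 1 ≤ j → j < i → i + j ≡ n → c (i ∷ j ∷ []) ≡ F ⊗ ((ι i ⊗ L i) ⊗ (ι j ⊗ L j)) - euler′ n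
  ordered i j 1≤j j<i i+j≡n = trans (solve-right (trans
      (cong (c (n ∷ []) ⊕_) (sym (trans (cong (c (i ∷ j ∷ []) ⊗_) once) (⊗-identityʳ _))))
      (coefficient-pair i j 1≤j (ℕP.<⇒≤ j<i) i+j≡n)))
    (cong (λ e → F ⊗ ((ι i ⊗ L i) ⊗ (ι j ⊗ L j)) - e) single)
    where
    once : repeated i j 1≤j (ℕP.<⇒≤ j<i) i+j≡n ≡ 1ℚ
    once = trans (cong (1ℚ ⊕_) (coef-mono-≢ j i (ℕP.<⇒≢ j<i))) (⊕-identityʳ 1ℚ)

  distinct-parts : ∀ i j → 1 ≤ i → 1 ≤ j → i + j ≡ n → i ≢ j →
    c ((i ⊔ j) ∷ (i ⊓ j) ∷ []) ≡ (ℕtoℚ ((2 * n) C (2 * i)) *ℚ euler′ i *ℚ euler′ j) - euler′ n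
  distinct-parts i j 1≤i 1≤j i+j≡n i≢j = trans (by-order (ℕP.<-cmp i j)) (cong (_- euler′ n) (trans
    (sym (binomial-euler′ 1≤i 1≤j i+j≡n))
    (sym (trans (⊗-def _ _) (cong (_⊗ euler′ j) (trans (⊗-def _ _) (cong (_⊗ euler′ i) (ι-def _))))))))
    where
    by-order : Tri (i < j) (i ≡ j) (j < i) → c ((i ⊔ j) ∷ (i ⊓ j) ∷ []) ≡ F ⊗ ((ι i ⊗ L i) ⊗ (ι j ⊗ L j)) - euler′ n
    by-order (tri< i<j _ _) rewrite ℕP.m≤n⇒m⊔n≡n (ℕP.<⇒≤ i<j) | ℕP.m≤n⇒m⊓n≡m (ℕP.<⇒≤ i<j) = trans
      (ordered j i 1≤i i<j (trans (ℕP.+-comm j i) i+j≡n)) (cong (λ x → F ⊗ x - euler′ n) (⊗-comm _ _))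
    by-order (tri≈ _ i≡j _) = contradiction i≡j i≢j
    by-order (tri> _ _ j<i) rewrite ℕP.m≥n⇒m⊔n≡m (ℕP.<⇒≤ j<i) | ℕP.m≥n⇒m⊓n≡n (ℕP.<⇒≤ j<i) = ordered i j 1≤j j<i i+j≡n

  equal-parts : ∀ i j → 1 ≤ i → 1 ≤ j → i + j ≡ n → i ≡ j →
    c (i ∷ j ∷ []) ≡ recipℕ 2 *ℚ ((ℕtoℚ ((2 * n) C n) *ℚ (euler′ i *ℚ euler′ i)) - euler′ n)
  equal-parts i i 1≤i _ i+i≡n refl = begin
    c (i ∷ i ∷ [])
      ≡⟨ ι-cancelˡ {2} (s≤s z≤n) (begin
           ι 2 ⊗ c (i ∷ i ∷ [])
             -- For equal parts `repeated` is 1 + 1.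
             ≡⟨ trans (⊗-comm _ _) (cong (c (i ∷ i ∷ []) ⊗_) (trans ι-2 (cong (1ℚ ⊕_) (sym (coef-mono-≡ i))))) ⟩
           c (i ∷ i ∷ []) ⊗ repeated i i 1≤i ℕP.≤-refl i+i≡n
             ≡⟨ solve-right (coefficient-pair i i 1≤i ℕP.≤-refl i+i≡n) ⟩
           F ⊗ ((ι i ⊗ L i) ⊗ (ι i ⊗ L i)) - c (n ∷ [])
             ≡⟨ cong₂ _-_ product-form single ⟩
           X
             ≡⟨ trans (sym (⊗-assoc _ _ _)) (trans (cong (_⊗ X) (ι⊗κ {2} (s≤s z≤n))) (⊗-identityˡ X)) ⟨
           ι 2 ⊗ (κ 2 ⊗ X) ∎) ⟩
    κ 2 ⊗ X
      ≡⟨ trans (⊗-def _ _) (cong (_⊗ X) (κ-def 2)) ⟨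
    recipℕ 2 *ℚ X ∎
    where
    X : ℚ
    X = (ℕtoℚ ((2 * n) C n) *ℚ (euler′ i *ℚ euler′ i)) - euler′ n
    2i≡n : 2 * i ≡ n
    2i≡n = trans (cong (i +_) (ℕP.+-identityʳ i)) i+i≡n
    product-form : F ⊗ ((ι i ⊗ L i) ⊗ (ι i ⊗ L i)) ≡ ℕtoℚ ((2 * n) C n) *ℚ (euler′ i *ℚ euler′ i)
    product-form = begin
      F ⊗ ((ι i ⊗ L i) ⊗ (ι i ⊗ L i))
        ≡⟨ binomial-euler′ 1≤i 1≤i i+i≡n ⟨
      (ι ((2 * n) C (2 * i)) ⊗ euler′ i) ⊗ euler′ i
        ≡⟨ trans (⊗-assoc _ _ _) (cong (λ k → ι ((2 * n) C k) ⊗ (euler′ i ⊗ euler′ i)) 2i≡n) ⟩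
      ι ((2 * n) C n) ⊗ (euler′ i ⊗ euler′ i)
        ≡⟨ trans (⊗-def _ _) (cong₂ _⊗_ (ι-def _) (⊗-def _ _)) ⟨
      ℕtoℚ ((2 * n) C n) *ℚ (euler′ i *ℚ euler′ i) ∎
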